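{- For every $\varepsilon>0$ there exists $f_0$ such that the following holds. Let $f$ be a real number and $\Delta$ a positive integer with $f_0\le f\le \Delta^2+1$, and let $G$ be a graph on $n$ vertices of maximum degree $\Delta$ in which, for every vertex $v$, the subgraph induced by the neighbourhood $N(v)$ has at most $\Delta^2/f$ edges. Then (i) an independent set of $G$ drawn uniformly at random from the set of all independent sets of $G$ (including the empty set) has at least $(1/2-\varepsilon)(n/\Delta)\log f$ vertices in expectation, and (ii) the fractional chromatic number of $G$ satisfies $\chi_f(G)\le (2+\varepsilon)\Delta/\log f$.
   Context: $\log$ denotes the natural logarithm. A fractional colouring of $G$ is an assignment $w$ of pairwise disjoint Lebesgue-measurable subsets of $\mathbb{R}$ to the independent sets of $G$ such that for every vertex $v$, $\sum_{I\ni v}\mu(w(I))\ge 1$ (where $\mu$ is Lebesgue measure); its total weight is $\sum_I \mu(w(I))$, and the fractional chromatic number $\chi_f(G)$ is the minimum total weight of a fractional colouring of $G$. -}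

module Defs where

open import Algebra.Bundles using (CommutativeRing)
open import Algebra.Structures using (IsCommutativeRing)
open import Data.Fin.Base using (Fin; toℕ) renaming (_<_ to _<ᶠ_)
open import Data.Fin.Properties using (all?) renaming (_<?_ to _<ᶠ?_)
open import Data.Fin.Subset using (Subset; inside; outside; ∣_∣) renaming (_∈_ to _∈ˢ_)
open import Data.Fin.Subset.Properties using () renaming (_∈?_ to _∈ˢ?_)
open import Data.List.Base using (List; []; _∷_; _++_; map; filter; foldr; length; allFin; cartesianProduct)
open import Data.Nat.Base as ℕ using (ℕ; zero; suc; _!)
open import Data.Product.Base using (Σ; ∃; ∃-syntax; _×_; _,_)
open import Data.Vec.Base using (tabulate) renaming ([] to []ᵛ; _∷_ to _∷ᵛ_)
open import Level using (0ℓ)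
open import Relation.Binary.Core using (Rel)
open import Relation.Binary.Definitions using (Decidable; Symmetric)
open import Relation.Binary.PropositionalEquality using (_≡_; _≢_)
open import Relation.Binary.Structures using (IsDecTotalOrder)
open import Relation.Nullary using (¬_; Dec; does)
open import Relation.Nullary.Decidable using (¬?; _×-dec_; _→-dec_)
open import Relation.Unary using (Pred; _∈_; _∩_; _∖_; _⊥_)

-- Classically, ℝ is the complete ordered field, unique up to unique
-- isomorphism; everything below is relative to an arbitrary model of
-- these axioms.  As in classical mathematics the order is decidable and
-- every inhabited set that is bounded above has a least upper bound.
-- The inverse is a total function with an unspecified value at 0#.

record Reals : Set₁ where
  infix  9 _⁻¹
  infix  8 -_
  infixl 7 _*_ _/_
  infixl 6 _+_ _-_
  infix  4 _≤_ _<_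

  field
    ℝ   : Set
    _≤_ : Rel ℝ 0ℓ
    _+_ : ℝ → ℝ → ℝ
    _*_ : ℝ → ℝ → ℝ
    -_  : ℝ → ℝ
    _⁻¹ : ℝ → ℝ
    0#  : ℝ
    1#  : ℝ

  UpperBound : Pred ℝ 0ℓ → Pred ℝ 0ℓ
  UpperBound A b = ∀ x → x ∈ A → x ≤ b

  LowerBound : Pred ℝ 0ℓ → Pred ℝ 0ℓ
  LowerBound A b = ∀ x → x ∈ A → b ≤ x

  IsSupremum : Pred ℝ 0ℓ → Pred ℝ 0ℓ
  IsSupremum A s = s ∈ UpperBound A × s ∈ LowerBound (UpperBound A)

  IsInfimum : Pred ℝ 0ℓ → Pred ℝ 0ℓ
  IsInfimum A s = s ∈ LowerBound A × s ∈ UpperBound (LowerBound A)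

  field
    isCommutativeRing : IsCommutativeRing _≡_ _+_ _*_ -_ 0# 1#
    isDecTotalOrder   : IsDecTotalOrder _≡_ _≤_
    0≢1               : 0# ≢ 1#
    ⁻¹-inverseʳ       : ∀ x → x ≢ 0# → x * x ⁻¹ ≡ 1#
    +-monoˡ-≤         : ∀ z x y → x ≤ y → x + z ≤ y + z
    *-nonNeg          : ∀ x y → 0# ≤ x → 0# ≤ y → 0# ≤ x * y
    supremum          : (A : Pred ℝ 0ℓ) → ∃ A → ∃ (UpperBound A) → ∃ (IsSupremum A)

  commutativeRing : CommutativeRing 0ℓ 0ℓ
  commutativeRing = record { isCommutativeRing = isCommutativeRing }

  open CommutativeRing commutativeRing using (semiring)
  open import Algebra.Properties.Semiring.Mult semiring public using () renaming (_×_ to _·_)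
  open import Algebra.Properties.Semiring.Exp semiring public using (_^_)
  open import Algebra.Properties.Semiring.Sum semiring public using (sum-syntax)

  _<_ : Rel ℝ 0ℓ
  x < y = x ≤ y × x ≢ y

  _-_ : ℝ → ℝ → ℝ
  x - y = x + (- y)

  _/_ : ℝ → ℝ → ℝ
  x / y = x * y ⁻¹

  fromℕ : ℕ → ℝ
  fromℕ n = n · 1#

  sumOver : {A : Set} → List A → (A → ℝ) → ℝ
  sumOver xs g = foldr (λ x s → g x + s) 0# xs

module Logarithm (R : Reals) where
  open Reals R

  ConvergesTo : (ℕ → ℝ) → ℝ → Set
  ConvergesTo a L = ∀ δ → 0# < δ → ∃[ N ] ∀ m → N ℕ.≤ m → a m < L + δ × L < a m + δ

  expPartialSum : ℝ → ℕ → ℝ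
  expPartialSum y m = ∑[ k < m ] (y ^ toℕ k / fromℕ (toℕ k !))

  -- ℓ is the natural logarithm of x, that is, exp ℓ equals x.
  IsLog : ℝ → ℝ → Set
  IsLog x ℓ = ConvergesTo (expPartialSum ℓ) x

module Lebesgue (R : Reals) where
  open Reals R

  -- The set A is covered by countably many open intervals of total length
  -- at most s.  The lengths are nonnegative, so bounding the partial sums
  -- is the same as bounding the sum of the series.
  CoverBound : Pred ℝ 0ℓ → Pred ℝ 0ℓ
  CoverBound A s =
    Σ (ℕ → ℝ) λ a → Σ (ℕ → ℝ) λ b →
      (∀ i → a i ≤ b i) ×
      (∀ x → x ∈ A → ∃[ i ] (a i < x × x < b i)) ×
      (∀ m → ∑[ i < m ] (b (toℕ i) - a (toℕ i)) ≤ s)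

  -- The outer measure of A is finite and equal to m.
  OuterMeasure : Pred ℝ 0ℓ → ℝ → Set
  OuterMeasure A m = ∃ (CoverBound A) × IsInfimum (CoverBound A) m

  -- Carathéodory's criterion.  Test sets E of infinite outer measure can be
  -- left out, since for these it follows from subadditivity.
  Measurable : Pred ℝ 0ℓ → Set₁
  Measurable A = ∀ (E : Pred ℝ 0ℓ) r p q →
    OuterMeasure E r → OuterMeasure (E ∩ A) p → OuterMeasure (E ∖ A) q → p + q ≡ r

  record FiniteMeasureSet : Set₁ where
    field
      set        : Pred ℝ 0ℓ
      measurable : Measurable set
      μ          : ℝ
      hasMeasure : OuterMeasure set μ

record Graph (n : ℕ) : Set₁ where
  field
    Adj    : Rel (Fin n) 0ℓ
    adj?   : Decidable Adj
    symm   : Symmetric Adj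
    irrefl : ∀ v → ¬ Adj v v

allSubsets : ∀ n → List (Subset n)
allSubsets zero    = []ᵛ ∷ []
allSubsets (suc n) = map (outside ∷ᵛ_) (allSubsets n) ++ map (inside ∷ᵛ_) (allSubsets n)

module _ {n : ℕ} (G : Graph n) where
  open Graph G

  neighbourhood : Fin n → Subset n
  neighbourhood v = tabulate (λ u → does (adj? v u))

  degree : Fin n → ℕ
  degree v = ∣ neighbourhood v ∣

  HasMaxDegree : ℕ → Set
  HasMaxDegree Δ = (∀ v → degree v ℕ.≤ Δ) × (∃[ v ] degree v ≡ Δ)

  -- The edges of the subgraph induced by S, each listed once, as (u , v) with u < v.
  inducedEdges : Subset n → List (Fin n × Fin n)
  inducedEdges S =
    filter (λ (u , v) → u ∈ˢ? S ×-dec v ∈ˢ? S ×-dec u <ᶠ? v ×-dec adj? u v)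
           (cartesianProduct (allFin n) (allFin n))

  Independent : Subset n → Set
  Independent I = ∀ u v → u ∈ˢ I → v ∈ˢ I → ¬ Adj u v

  independent? : ∀ I → Dec (Independent I)
  independent? I = all? λ u → all? λ v → u ∈ˢ? I →-dec v ∈ˢ? I →-dec ¬? (adj? u v)

  independentSets : List (Subset n)
  independentSets = filter independent? (allSubsets n)

  independentSetsThrough : Fin n → List (Subset n)
  independentSetsThrough v = filter (v ∈ˢ?_) independentSets

module IndependentSets (R : Reals) where
  open Reals R

  expectedSize : ∀ {n} → Graph n → ℝ
  expectedSize G =
    sumOver (independentSets G) (λ I → fromℕ ∣ I ∣) / fromℕ (length (independentSets G))

module FractionalColourings (R : Reals) where
  open Reals R
  open Lebesgue R
  open FiniteMeasureSet

  -- Only the values of w at independent sets matter.  Colourings using a set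
  -- of infinite measure have infinite total weight and do not affect the
  -- minimum, so they are left out.
  record FractionalColouring {n} (G : Graph n) : Set₁ where
    field
      w        : Subset n → FiniteMeasureSet
      disjoint : ∀ I J → Independent G I → Independent G J → I ≢ J → set (w I) ⊥ set (w J)
      covers   : ∀ v → 1# ≤ sumOver (independentSetsThrough G v) (λ I → μ (w I))

    totalWeight : ℝ
    totalWeight = sumOver (independentSets G) (λ I → μ (w I))

  open FractionalColouring

  IsFractionalChromaticNumber : ∀ {n} → Graph n → ℝ → Set₁
  IsFractionalChromaticNumber G χ =
    (Σ (FractionalColouring G) λ c → totalWeight c ≡ χ) ×
    (∀ (c : FractionalColouring G) → χ ≤ totalWeight c)

module Submission where

-- Draw an independent set from the hard-core model, weighting I by h ^ ∣ I ∣ with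
-- a fugacity h of order √f / Δ.  Given the part of the set outside N v, the rest
-- is a hard-core set on the graph induced by the available neighbours F of v.
-- If F is small, then v has a fair chance of being occupied, because the partition
-- function of F is at most (1 + h) ^ ∣ F ∣.  If F is large, then many neighbours of
-- v are occupied, because F spans few edges.  Balancing the two cases gives
-- β * P(v occupied) + γ * E(occupied neighbours of v) ≥ 1 with β + γ Δ ≈ 2 Δ / log f,
-- in every induced subgraph of G.  Summing over v bounds the mean size at fugacity h,
-- which by Chebyshev's sum inequality is at most the mean size at fugacity 1.
-- For χ_f, colour greedily: add the hard-core distribution on the vertices that are
-- not yet fully covered until one of them becomes so, and repeat.  The vertex covered
-- last then witnesses that the total weight is at most β + γ Δ.

open import Algebra.Bundles using (CommutativeRing)
import Algebra.Construct.NaturalChoice.Max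
import Algebra.Construct.NaturalChoice.Min
import Algebra.Properties.Ring
import Algebra.Solver.Ring
open import Algebra.Solver.Ring.AlmostCommutativeRing using (AlmostCommutativeRing; fromCommutativeRing; _-Raw-AlmostCommutative⟶_)
open import Data.Bool.Base using (if_then_else_)
open import Data.Empty using (⊥-elim)
open import Data.Fin.Base as Fin using (Fin; zero; suc; toℕ)
import Data.Fin.Properties as Fin
open import Data.Fin.Subset as Subset using (Subset; inside; outside; ∣_∣; _∈_; _∉_; _⊆_; _∪_; ∁; ⁅_⁆)
open import Data.Fin.Subset.Properties
open import Data.Integer.Base as ℤ using (ℤ; -[1+_]; _⊖_) renaming (+_ to pos)
import Data.Integer.Properties as ℤ
open import Data.List.Base as List using (List; []; _∷_; _++_; filter; length; allFin; cartesianProduct)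
import Data.List.Extrema
open import Data.List.Membership.Propositional using () renaming (_∈_ to _∈ˡ_)
open import Data.List.Membership.Propositional.Properties using (∈-allFin; ∈-filter⁺; ∈-++⁺ˡ; ∈-++⁺ʳ; ∈-map⁺)
import Data.List.Properties as List
import Data.List.Relation.Unary.All as All
open import Data.List.Relation.Unary.All.Properties using (all-filter)
open import Data.List.Relation.Unary.Any using (here; there)
open import Data.Maybe.Base using (Maybe; just; nothing)
open import Data.Nat.Base as ℕ using (ℕ; zero; suc; _!) renaming (_<_ to _<ℕ_)
import Data.Nat.Properties as ℕ
open import Data.Product.Base using (∃; ∃-syntax; _×_; _,_; proj₁; proj₂)
open import Data.Sum.Base as Sum using (_⊎_; inj₁; inj₂; [_,_]′)
open import Data.Unit.Base using (⊤; tt)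
open import Data.Vec.Base as Vec using (here; there) renaming ([] to []ᵛ; _∷_ to _∷ᵛ_)
import Data.Vec.Properties as Vec
open import Defs
open import Function.Base using (_∘_; id; case_of_; _$_)
open import Level using (0ℓ)
open import Relation.Binary.Bundles using (Poset; TotalOrder)
import Relation.Binary.Construct.NonStrictToStrict as NonStrictToStrict
open import Relation.Binary.Definitions using (tri<; tri≈; tri>)
open import Relation.Binary.PropositionalEquality
  using (_≡_; _≢_; refl; sym; trans; cong; cong₂; subst; subst₂; module ≡-Reasoning)
import Relation.Binary.Reasoning.PartialOrder
open import Relation.Binary.Structures using (IsDecTotalOrder)
open import Relation.Nullary using (¬_; Dec; yes; no; does; contradiction)
open import Relation.Nullary.Decidable using (_×-dec_; ¬?; dec-true; dec-false; decidable-stable)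
open import Relation.Unary using (Pred; Decidable) renaming (_∈_ to _∈ₚ_; _∩_ to _∩ₚ_; _∖_ to _∖ₚ_)

-- Ordered field arithmetic

-- The constant 2 comes from two limits on the fugacity h. The at most Δ² / f edges in a
-- neighbourhood lower its expected occupation by about h² Δ² / f, which is harmless only while h is
-- a small multiple c of √f / Δ. And β has to be negligible against γ Δ ≈ 2 Δ / log f, so β = c Δ /
-- log f. A set F counts as small if its partition function is at most about β h, which is c² √f /
-- log f; this allows ∣ F ∣ up to nearly log f / (2 h). Beyond that size the expected occupation is
-- nearly log f / 2, whence γ ≈ 2 / log f.
--
-- A second obstacle is that excluded middle is not assumed. The order is decidable, but integer
-- parts and points close to a supremum are obtained only under a double negation. This suffices
-- wherever the goal is an inequality; f₀, however, is data and has to come from a supremum.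
-- Moreover `IsLog` only speaks of convergent partial sums, so every fact about exp is proved for
-- finite sums first.

module OrderedField (R : Reals) where
  open Reals R public
  open CommutativeRing commutativeRing public using
    ( +-comm; +-assoc; +-identityˡ; +-identityʳ; -‿inverseʳ; -‿inverseˡ
    ; *-comm; *-assoc; *-identityˡ; *-identityʳ; zeroˡ; zeroʳ; distribˡ; distribʳ; semiring; ring)
  open Algebra.Properties.Ring ring using (-‿distribˡ-*; -‿distribʳ-*; -‿involutive; -0#≈0#; -‿+-comm)
  open import Algebra.Properties.Semiring.Mult semiring public using (×-homo-+; ×1-homo-*)
  open import Algebra.Properties.Semiring.Exp semiring public using (^-homo-*)
  open IsDecTotalOrder isDecTotalOrder public using (_≤?_; _≟_; isPartialOrder; isTotalOrder; ≤-respˡ-≈; ≤-respʳ-≈)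
    renaming (refl to ≤-refl; reflexive to ≤-reflexive; trans to ≤-trans; antisym to ≤-antisym; total to ≤-total)

  private
    -- Coefficients for the ring solver are taken in ℤ, where numerals normalise by computation; in
    -- the abstract ℝ they do not.
    fromℤ : ℤ → ℝ
    fromℤ (pos n)  = fromℕ n
    fromℤ -[1+ n ] = - fromℕ (suc n)

    fromℤ-neg : ∀ i → fromℤ (ℤ.- i) ≡ - fromℤ i
    fromℤ-neg (pos zero)    = sym -0#≈0#
    fromℤ-neg (pos (suc n)) = refl
    fromℤ-neg -[1+ n ]      = sym (-‿involutive _)

    fromℤ-⊖ : ∀ m n → fromℤ (m ⊖ n) ≡ fromℕ m - fromℕ n
    fromℤ-⊖ m zero = sym (trans (cong (fromℕ m +_) -0#≈0#) (+-identityʳ _))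
    fromℤ-⊖ zero (suc n) = sym (+-identityˡ _)
    fromℤ-⊖ (suc m) (suc n) = begin
      fromℤ (suc m ⊖ suc n)                 ≡⟨ cong fromℤ (ℤ.[1+m]⊖[1+n]≡m⊖n m n) ⟩
      fromℤ (m ⊖ n)                         ≡⟨ fromℤ-⊖ m n ⟩
      fromℕ m - fromℕ n                     ≡⟨ +-identityʳ _ ⟨
      fromℕ m - fromℕ n + 0#                ≡⟨ cong (fromℕ m - fromℕ n +_) (-‿inverseʳ 1#) ⟨
      fromℕ m - fromℕ n + (1# - 1#)         ≡⟨ +-assoc _ _ _ ⟩
      fromℕ m + (- fromℕ n + (1# - 1#))     ≡⟨ cong (fromℕ m +_) (+-comm _ _) ⟩
      fromℕ m + (1# - 1# + - fromℕ n)       ≡⟨ cong (fromℕ m +_) (+-assoc _ _ _) ⟩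
      fromℕ m + (1# + (- 1# + - fromℕ n))   ≡⟨ +-assoc _ _ _ ⟨
      fromℕ m + 1# + (- 1# + - fromℕ n)     ≡⟨ cong₂ _+_ (+-comm _ _) (-‿+-comm _ _) ⟩
      fromℕ (suc m) - fromℕ (suc n)         ∎
      where open ≡-Reasoning

    fromℤ-+ : ∀ i j → fromℤ (i ℤ.+ j) ≡ fromℤ i + fromℤ j
    fromℤ-+ (pos m)  (pos n)  = ×-homo-+ 1# m n
    fromℤ-+ (pos m)  -[1+ n ] = fromℤ-⊖ m (suc n)
    fromℤ-+ -[1+ m ] (pos n)  = trans (fromℤ-⊖ n (suc m)) (+-comm _ _)
    fromℤ-+ -[1+ m ] -[1+ n ] = begin
      - fromℕ (suc (suc (m ℕ.+ n)))      ≡⟨ cong (λ k → - fromℕ (suc k)) (ℕ.+-suc m n) ⟨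
      - fromℕ (suc m ℕ.+ suc n)          ≡⟨ cong -_ (×-homo-+ 1# (suc m) (suc n)) ⟩
      - (fromℕ (suc m) + fromℕ (suc n))  ≡⟨ -‿+-comm _ _ ⟨
      - fromℕ (suc m) - fromℕ (suc n)    ∎
      where open ≡-Reasoning

    fromℤ-*⁺ : ∀ m j → fromℤ (pos m ℤ.* j) ≡ fromℕ m * fromℤ j
    fromℤ-*⁺ m (pos n)  = trans (cong fromℤ (sym (ℤ.pos-* m n))) (×1-homo-* m n)
    fromℤ-*⁺ m -[1+ n ] = begin
      fromℤ (pos m ℤ.* ℤ.- pos (suc n)) ≡⟨ cong fromℤ (ℤ.neg-distribʳ-* (pos m) (pos (suc n))) ⟨
      fromℤ (ℤ.- (pos m ℤ.* pos (suc n))) ≡⟨ fromℤ-neg (pos m ℤ.* pos (suc n)) ⟩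
      - fromℤ (pos m ℤ.* pos (suc n))     ≡⟨ cong -_ (fromℤ-*⁺ m (pos (suc n))) ⟩
      - (fromℕ m * fromℕ (suc n))          ≡⟨ -‿distribʳ-* _ _ ⟩
      fromℕ m * (- fromℕ (suc n))          ∎
      where open ≡-Reasoning

    fromℤ-* : ∀ i j → fromℤ (i ℤ.* j) ≡ fromℤ i * fromℤ j
    fromℤ-* (pos m)  j = fromℤ-*⁺ m j
    fromℤ-* -[1+ m ] j = begin
      fromℤ (ℤ.- pos (suc m) ℤ.* j)   ≡⟨ cong fromℤ (ℤ.neg-distribˡ-* (pos (suc m)) j) ⟨
      fromℤ (ℤ.- (pos (suc m) ℤ.* j)) ≡⟨ fromℤ-neg (pos (suc m) ℤ.* j) ⟩
      - fromℤ (pos (suc m) ℤ.* j)     ≡⟨ cong -_ (fromℤ-*⁺ (suc m) j) ⟩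
      - (fromℕ (suc m) * fromℤ j)     ≡⟨ -‿distribˡ-* _ _ ⟩
      (- fromℕ (suc m)) * fromℤ j     ∎
      where open ≡-Reasoning

    -- Agrees with fromℤ, but sends 1 to 1# itself rather than to 1# + 0#.
    coefficient : ℤ → ℝ
    coefficient (pos 1) = 1#
    coefficient i       = fromℤ i

    coefficient≡fromℤ : ∀ i → coefficient i ≡ fromℤ i
    coefficient≡fromℤ (pos 0)             = refl
    coefficient≡fromℤ (pos 1)             = sym (+-identityʳ 1#)
    coefficient≡fromℤ (pos (suc (suc n))) = refl
    coefficient≡fromℤ -[1+ n ]            = refl

    homo₂ : ∀ (_⊕_ : ℤ → ℤ → ℤ) (_⊞_ : ℝ → ℝ → ℝ) → (∀ i j → fromℤ (i ⊕ j) ≡ fromℤ i ⊞ fromℤ j) →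
            ∀ i j → coefficient (i ⊕ j) ≡ coefficient i ⊞ coefficient j
    homo₂ _⊕_ _⊞_ h i j = trans (coefficient≡fromℤ (i ⊕ j))
      (trans (h i j) (sym (cong₂ _⊞_ (coefficient≡fromℤ i) (coefficient≡fromℤ j))))

    almostCommutativeRing : AlmostCommutativeRing _ _
    almostCommutativeRing = fromCommutativeRing commutativeRing

    coefficient-homo : ℤ.+-*-rawRing -Raw-AlmostCommutative⟶ almostCommutativeRing
    coefficient-homo = record
      { ⟦_⟧    = coefficient
      ; +-homo = homo₂ ℤ._+_ _+_ fromℤ-+
      ; *-homo = homo₂ ℤ._*_ _*_ fromℤ-*
      ; -‿homo = λ i → trans (coefficient≡fromℤ (ℤ.- i)) (trans (fromℤ-neg i) (cong -_ (sym (coefficient≡fromℤ i))))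
      ; 0-homo = refl
      ; 1-homo = refl
      }

    coefficient-≟ : ∀ i j → Maybe (coefficient i ≡ coefficient j)
    coefficient-≟ i j with i ℤ.≟ j
    ... | yes i≡j = just (cong coefficient i≡j)
    ... | no  _   = nothing

  open Algebra.Solver.Ring ℤ.+-*-rawRing almostCommutativeRing coefficient-homo coefficient-≟ public
    using (Polynomial; solve; _:+_; _:*_; _:-_; :-_; _:=_; con; _:^_)

  :0 :1 :2 : ∀ {n} → Polynomial n
  :0 = con (pos 0)
  :1 = con (pos 1)
  :2 = con (pos 2)


  poset : Poset _ _ _
  poset = record { isPartialOrder = isPartialOrder }

  module ≤-Reasoning = Relation.Binary.Reasoning.PartialOrder poset

  open NonStrictToStrict _≡_ _≤_ public using (<⇒≤)

  <-≤-trans : ∀ {x y z} → x < y → y ≤ z → x < z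
  <-≤-trans = NonStrictToStrict.<-≤-trans _≡_ _≤_ sym ≤-trans ≤-antisym ≤-respʳ-≈

  ≤-<-trans : ∀ {x y z} → x ≤ y → y < z → x < z
  ≤-<-trans = NonStrictToStrict.≤-<-trans _≡_ _≤_ ≤-trans ≤-antisym ≤-respˡ-≈

  <⇒≱ : ∀ {x y} → x < y → ¬ (y ≤ x)
  <⇒≱ = NonStrictToStrict.<⇒≱ _≡_ _≤_ ≤-antisym

  ≰⇒> : ∀ {x y} → ¬ (x ≤ y) → y < x
  ≰⇒> = NonStrictToStrict.≰⇒> _≡_ _≤_ sym ≤-reflexive ≤-total

  ≮⇒≥ : ∀ {x y} → ¬ (x < y) → y ≤ x
  ≮⇒≥ = NonStrictToStrict.≮⇒≥ _≡_ _≤_ sym _≟_ ≤-reflexive ≤-total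

  _<?_ : ∀ x y → Dec (x < y)
  _<?_ = NonStrictToStrict.<-decidable _≡_ _≤_ _≟_ _≤?_

  -- Because of this, witnesses that exist only under a double negation may be used in the proof of
  -- any inequality.
  ≤-stable : ∀ {x y} → ¬ ¬ (x ≤ y) → x ≤ y
  ≤-stable {x} {y} = decidable-stable (x ≤? y)

  <-or-≥ : ∀ x y → x < y ⊎ y ≤ x
  <-or-≥ x y with y ≤? x
  ... | yes y≤x = inj₂ y≤x
  ... | no  y≰x = inj₁ (≰⇒> y≰x)

  +-mono-≤ : ∀ {x y u v} → x ≤ y → u ≤ v → x + u ≤ y + v
  +-mono-≤ {x} {y} {u} {v} x≤y u≤v = ≤-trans (+-monoˡ-≤ u x y x≤y)
    (subst₂ _≤_ (+-comm u y) (+-comm v y) (+-monoˡ-≤ y u v u≤v))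

  +-monoʳ-≤ : ∀ z {x y} → x ≤ y → z + x ≤ z + y
  +-monoʳ-≤ z = +-mono-≤ ≤-refl

  -- To prove x ≤ y, name the nonnegative gap and leave the rest to the ring solver.
  ≤-by-gap : ∀ {x y} t → 0# ≤ t → x + t ≡ y → x ≤ y
  ≤-by-gap {x} t 0≤t x+t≡y = subst₂ _≤_ (+-identityʳ x) x+t≡y (+-monoʳ-≤ x 0≤t)

  <-by-gap : ∀ {x y} t → 0# < t → x + t ≡ y → x < y
  <-by-gap {x} {y} t (0≤t , 0≢t) x+t≡y = ≤-by-gap t 0≤t x+t≡y , λ x≡y → 0≢t (sym (begin
    t            ≡⟨ solve 2 (λ x t → t := x :+ t :- x) refl x t ⟩
    x + t - x    ≡⟨ cong (_- x) (trans x+t≡y (sym x≡y)) ⟩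
    x - x        ≡⟨ -‿inverseʳ x ⟩
    0#           ∎))
    where open ≡-Reasoning

  x≤y⇒0≤y-x : ∀ {x y} → x ≤ y → 0# ≤ y - x
  x≤y⇒0≤y-x {x} {y} x≤y = subst (_≤ y - x) (-‿inverseʳ x) (+-monoˡ-≤ (- x) x y x≤y)

  x<y⇒0<y-x : ∀ {x y} → x < y → 0# < y - x
  x<y⇒0<y-x {x} {y} (x≤y , x≢y) = x≤y⇒0≤y-x x≤y , λ 0≡y-x → x≢y
    (trans (sym (+-identityʳ x)) (trans (cong (x +_) 0≡y-x) (solve 2 (λ x y → x :+ (y :- x) := y) refl x y)))

  0≤+ : ∀ {x y} → 0# ≤ x → 0# ≤ y → 0# ≤ x + y
  0≤+ {x} {y} 0≤x 0≤y = ≤-by-gap (x + y) (subst (_≤ x + y) (+-identityʳ 0#) (+-mono-≤ 0≤x 0≤y)) (+-identityˡ _)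

  0<+ : ∀ {x y} → 0# < x → 0# ≤ y → 0# < x + y
  0<+ {x} {y} 0<x 0≤y = <-≤-trans 0<x (≤-by-gap y 0≤y refl)

  0≤* : ∀ {x y} → 0# ≤ x → 0# ≤ y → 0# ≤ x * y
  0≤* {x} {y} = *-nonNeg x y

  neg-mono-≤ : ∀ {x y} → x ≤ y → - y ≤ - x
  neg-mono-≤ {x} {y} x≤y = ≤-by-gap (y - x) (x≤y⇒0≤y-x x≤y) (solve 2 (λ x y → :- y :+ (y :- x) := :- x) refl x y)

  *-monoʳ-≤ : ∀ {z x y} → 0# ≤ z → x ≤ y → z * x ≤ z * y
  *-monoʳ-≤ {z} {x} {y} 0≤z x≤y = ≤-by-gap (z * (y - x)) (0≤* 0≤z (x≤y⇒0≤y-x x≤y))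
    (solve 3 (λ x y z → z :* x :+ z :* (y :- x) := z :* y) refl x y z)

  *-monoˡ-≤ : ∀ {z x y} → 0# ≤ z → x ≤ y → x * z ≤ y * z
  *-monoˡ-≤ {z} {x} {y} 0≤z x≤y = subst₂ _≤_ (*-comm z x) (*-comm z y) (*-monoʳ-≤ 0≤z x≤y)

  *-mono-≤ : ∀ {x y u v} → 0# ≤ u → 0# ≤ y → x ≤ y → u ≤ v → x * u ≤ y * v
  *-mono-≤ 0≤u 0≤y x≤y u≤v = ≤-trans (*-monoˡ-≤ 0≤u x≤y) (*-monoʳ-≤ 0≤y u≤v)

  0≤x² : ∀ x → 0# ≤ x * x
  0≤x² x with ≤-total 0# x
  ... | inj₁ 0≤x = 0≤* 0≤x 0≤x
  ... | inj₂ x≤0 = subst (0# ≤_) (solve 1 (λ x → (:0 :- x) :* (:0 :- x) := x :* x) refl x)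
                     (0≤* (x≤y⇒0≤y-x x≤0) (x≤y⇒0≤y-x x≤0))

  0<1 : 0# < 1#
  0<1 = subst (0# ≤_) (*-identityˡ 1#) (0≤x² 1#) , 0≢1

  0≤1 : 0# ≤ 1#
  0≤1 = <⇒≤ 0<1

  0<⇒≢0 : ∀ {x} → 0# < x → x ≢ 0#
  0<⇒≢0 0<x = proj₂ 0<x ∘ sym

  ⁻¹-inverse : ∀ {x} → 0# < x → x * x ⁻¹ ≡ 1#
  ⁻¹-inverse {x} 0<x = ⁻¹-inverseʳ x (0<⇒≢0 0<x)

  0<⁻¹ : ∀ {x} → 0# < x → 0# < x ⁻¹
  0<⁻¹ {x} 0<x = ≰⇒> λ x⁻¹≤0 → <⇒≱ 0<1 (≤-by-gap (x * (0# - x ⁻¹)) (0≤* (<⇒≤ 0<x) (x≤y⇒0≤y-x x⁻¹≤0))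
    (trans (cong (_+ x * (0# - x ⁻¹)) (sym (⁻¹-inverse 0<x)))
           (solve 2 (λ x y → x :* y :+ x :* (:0 :- y) := :0) refl x (x ⁻¹))))

  0≤⁻¹ : ∀ {x} → 0# < x → 0# ≤ x ⁻¹
  0≤⁻¹ = <⇒≤ ∘ 0<⁻¹

  0<* : ∀ {x y} → 0# < x → 0# < y → 0# < x * y
  0<* {x} {y} 0<x 0<y = 0≤* (<⇒≤ 0<x) (<⇒≤ 0<y) , λ 0≡xy → proj₂ 0<y (begin
    0#                 ≡⟨ zeroˡ _ ⟨
    0# * x ⁻¹          ≡⟨ cong (_* x ⁻¹) 0≡xy ⟩
    x * y * x ⁻¹       ≡⟨ solve 3 (λ x y z → x :* y :* z := x :* z :* y) refl x y (x ⁻¹) ⟩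
    x * x ⁻¹ * y       ≡⟨ cong (_* y) (⁻¹-inverse 0<x) ⟩
    1# * y             ≡⟨ *-identityˡ y ⟩
    y                  ∎)
    where open ≡-Reasoning

  0<x⇒0<x/y : ∀ {x y} → 0# < x → 0# < y → 0# < x / y
  0<x⇒0<x/y 0<x 0<y = 0<* 0<x (0<⁻¹ 0<y)

  0≤x⇒0≤x/y : ∀ {x y} → 0# ≤ x → 0# < y → 0# ≤ x / y
  0≤x⇒0≤x/y 0≤x 0<y = 0≤* 0≤x (0≤⁻¹ 0<y)

  x/y*y≡x : ∀ x {y} → 0# < y → x / y * y ≡ x
  x/y*y≡x x {y} 0<y = begin
    x * y ⁻¹ * y    ≡⟨ solve 3 (λ x y z → x :* z :* y := x :* (y :* z)) refl x y (y ⁻¹) ⟩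
    x * (y * y ⁻¹)  ≡⟨ cong (x *_) (⁻¹-inverse 0<y) ⟩
    x * 1#          ≡⟨ *-identityʳ x ⟩
    x               ∎
    where open ≡-Reasoning

  *-cancelʳ-≤ : ∀ {z x y} → 0# < z → x * z ≤ y * z → x ≤ y
  *-cancelʳ-≤ {z} {x} {y} 0<z xz≤yz = subst₂ _≤_ (lemma x) (lemma y) (*-monoˡ-≤ (0≤⁻¹ 0<z) xz≤yz)
    where
    lemma : ∀ x → x * z * z ⁻¹ ≡ x
    lemma x = trans (solve 3 (λ x y z → x :* z :* y := x :* y :* z) refl x (z ⁻¹) z) (x/y*y≡x x 0<z)

  x≤y/z : ∀ {x y z} → 0# < z → x * z ≤ y → x ≤ y / z
  x≤y/z {x} {y} {z} 0<z xz≤y = *-cancelʳ-≤ 0<z (≤-trans xz≤y (≤-reflexive (sym (x/y*y≡x y 0<z))))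

  x/z≤y : ∀ {x y z} → 0# < z → x ≤ y * z → x / z ≤ y
  x/z≤y {x} {y} {z} 0<z x≤yz = *-cancelʳ-≤ 0<z (≤-trans (≤-reflexive (x/y*y≡x x 0<z)) x≤yz)

  0≤fromℕ : ∀ n → 0# ≤ fromℕ n
  0≤fromℕ zero    = ≤-refl
  0≤fromℕ (suc n) = 0≤+ 0≤1 (0≤fromℕ n)

  0<fromℕ-suc : ∀ n → 0# < fromℕ (suc n)
  0<fromℕ-suc n = 0<+ 0<1 (0≤fromℕ n)

  fromℕ-mono-≤ : ∀ {m n} → m ℕ.≤ n → fromℕ m ≤ fromℕ n
  fromℕ-mono-≤ {n = n} ℕ.z≤n   = 0≤fromℕ n
  fromℕ-mono-≤ (ℕ.s≤s m≤n)     = +-monoʳ-≤ 1# (fromℕ-mono-≤ m≤n)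

  fromℕ-+ : ∀ m n → fromℕ (m ℕ.+ n) ≡ fromℕ m + fromℕ n
  fromℕ-+ = ×-homo-+ 1#

  fromℕ-* : ∀ m n → fromℕ (m ℕ.* n) ≡ fromℕ m * fromℕ n
  fromℕ-* = ×1-homo-*

  0<2 : 0# < fromℕ 2
  0<2 = 0<fromℕ-suc 1

  0≤^ : ∀ {x} n → 0# ≤ x → 0# ≤ x ^ n
  0≤^ zero    0≤x = 0≤1
  0≤^ (suc n) 0≤x = 0≤* 0≤x (0≤^ n 0≤x)

  0<^ : ∀ {x} n → 0# < x → 0# < x ^ n
  0<^ zero    0<x = 0<1
  0<^ (suc n) 0<x = 0<* 0<x (0<^ n 0<x)

  ^-monoˡ-≤ : ∀ {x y} n → 0# ≤ x → x ≤ y → x ^ n ≤ y ^ n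
  ^-monoˡ-≤ zero    0≤x x≤y = ≤-refl
  ^-monoˡ-≤ (suc n) 0≤x x≤y = *-mono-≤ (0≤^ n 0≤x) (≤-trans 0≤x x≤y) x≤y (^-monoˡ-≤ n 0≤x x≤y)

  1≤^ : ∀ {x} n → 1# ≤ x → 1# ≤ x ^ n
  1≤^ zero    1≤x = ≤-refl
  1≤^ {x} (suc n) 1≤x = subst (_≤ x * x ^ n) (*-identityˡ 1#) (*-mono-≤ 0≤1 (≤-trans 0≤1 1≤x) 1≤x (1≤^ n 1≤x))

  ^-monoʳ-≤ : ∀ {x m n} → 1# ≤ x → m ℕ.≤ n → x ^ m ≤ x ^ n
  ^-monoʳ-≤ {n = n} 1≤x ℕ.z≤n = 1≤^ n 1≤x
  ^-monoʳ-≤ 1≤x (ℕ.s≤s m≤n)   = *-monoʳ-≤ (≤-trans 0≤1 1≤x) (^-monoʳ-≤ 1≤x m≤n)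

  ²-cancel-≤ : ∀ {x y} → 0# ≤ y → x * x ≤ y * y → x ≤ y
  ²-cancel-≤ {x} {y} 0≤y x²≤y² = ≤-stable λ x≰y →
    let y<x = ≰⇒> x≰y in
    <⇒≱ (0<* (x<y⇒0<y-x y<x) (0<+ (≤-<-trans 0≤y y<x) 0≤y))
      (≤-by-gap _ (x≤y⇒0≤y-x x²≤y²)
        (solve 2 (λ x y → (x :- y) :* (x :+ y) :+ (y :* y :- x :* x) := :0) refl x y))

  half : ℝ → ℝ
  half x = x / fromℕ 2

  half+half : ∀ x → half x + half x ≡ x
  half+half x = trans (solve 1 (λ h → h :+ h := h :* :2) refl (half x)) (x/y*y≡x x 0<2)

  0<half : ∀ {x} → 0# < x → 0# < half x
  0<half 0<x = 0<x⇒0<x/y 0<x 0<2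

  ≤-by-slack : ∀ {x y} → (∀ δ → 0# < δ → x ≤ y + δ) → x ≤ y
  ≤-by-slack {x} {y} h = ≤-stable λ x≰y →
    let y<x = ≰⇒> x≰y
        δ   = half (x - y)
        0<δ = 0<half (x<y⇒0<y-x y<x)
    in <⇒≱ 0<δ (≤-by-gap _ (x≤y⇒0≤y-x (h δ 0<δ)) (begin
         δ + (y + δ - x)  ≡⟨ solve 3 (λ x y δ → δ :+ (y :+ δ :- x) := (δ :+ δ) :- (x :- y)) refl x y δ ⟩
         δ + δ - (x - y)  ≡⟨ cong (_- (x - y)) (half+half (x - y)) ⟩
         x - y - (x - y)  ≡⟨ -‿inverseʳ (x - y) ⟩
         0#               ∎))
    where open ≡-Reasoning

-- Completeness and the exponential series

-- A finite search; it locates both integer parts and the rough square root of f.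
crossing : {P : Pred ℕ 0ℓ} → (∀ n → Dec (P n)) → P 0 → ∀ n → ¬ P n → ∃[ j ] (P j × ¬ P (suc j))
crossing P? P0 zero    ¬P0  = contradiction P0 ¬P0
crossing P? P0 (suc n) ¬Psn with P? n
... | yes Pn = n , Pn , ¬Psn
... | no ¬Pn = crossing P? P0 n ¬Pn

module Completeness (R : Reals) where
  open OrderedField R

  -- If no natural number exceeded x, the naturals would have a supremum s, and s - 1 would still
  -- bound them. The argument yields no witness, hence the double negation.
  archimedean : ∀ x → ¬ ¬ (∃[ n ] x < fromℕ n)
  archimedean x ¬∃ = <⇒≱ 0<1 (≤-by-gap _ (x≤y⇒0≤y-x s≤s-1) (solve 1 (λ s → :1 :+ (s :- :1 :- s) := :0) refl s))
    where
    A : Pred ℝ 0ℓ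
    A y = ∃[ n ] y ≡ fromℕ n
    sup = supremum A (0# , 0 , refl) (x , λ { _ (n , refl) → ≮⇒≥ (λ x<n → ¬∃ (n , x<n)) })
    s = proj₁ sup
    s≤s-1 : s ≤ s - 1#
    s≤s-1 = proj₂ (proj₂ sup) (s - 1#) λ { _ (n , refl) →
      ≤-by-gap _ (x≤y⇒0≤y-x (proj₁ (proj₂ sup) _ (suc n , refl)))
        (solve 2 (λ s n → n :+ (s :- (:1 :+ n)) := s :- :1) refl s (fromℕ n)) }

  floor : ∀ {x h} → 0# ≤ x → 0# < h → ¬ ¬ (∃[ j ] (fromℕ j * h ≤ x × x < fromℕ (suc j) * h))
  floor {x} {h} 0≤x 0<h ¬∃ = archimedean (x / h) λ (n , x/h<n) →
    let (j , jh≤x , sjh≰x) = crossing (λ j → fromℕ j * h ≤? x) (subst (_≤ x) (sym (zeroˡ h)) 0≤x) n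
          (λ nh≤x → <⇒≱ x/h<n (x≤y/z 0<h nh≤x))
    in ¬∃ (j , jh≤x , ≰⇒> sjh≰x)

  below-supremum : ∀ {A s y} → IsSupremum A s → y < s → ¬ ¬ (∃[ x ] (x ∈ₚ A × y < x))
  below-supremum (_ , least) y<s ¬∃ = <⇒≱ y<s (least _ λ x x∈A → ≮⇒≥ λ y<x → ¬∃ (x , x∈A , y<x))

-- Partial sums and Cauchy products

module PrefixSums (R : Reals) where
  open OrderedField R

  -- Unlike ∑, which splits off the first term, this recursion adds the last one, so that induction
  -- on m compares consecutive partial sums.
  prefix : (ℕ → ℝ) → ℕ → ℝ
  prefix a zero    = 0#
  prefix a (suc m) = prefix a m + a m

  prefix-suc : ∀ a m → prefix a (suc m) ≡ a 0 + prefix (a ∘ suc) m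
  prefix-suc a zero    = trans (+-identityˡ _) (sym (+-identityʳ _))
  prefix-suc a (suc m) = trans (cong (_+ a (suc m)) (prefix-suc a m)) (+-assoc _ _ _)

  ∑≡prefix : ∀ a m → (∑[ k < m ] a (toℕ k)) ≡ prefix a m
  ∑≡prefix a zero    = refl
  ∑≡prefix a (suc m) = trans (cong (a 0 +_) (∑≡prefix (a ∘ suc) m)) (sym (prefix-suc a m))

  prefix-mono-≤ : ∀ {a b} → (∀ i → a i ≤ b i) → ∀ m → prefix a m ≤ prefix b m
  prefix-mono-≤ a≤b zero    = ≤-refl
  prefix-mono-≤ a≤b (suc m) = +-mono-≤ (prefix-mono-≤ a≤b m) (a≤b m)

  prefix-+ : ∀ a b m → prefix (λ i → a i + b i) m ≡ prefix a m + prefix b m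
  prefix-+ a b zero    = sym (+-identityʳ 0#)
  prefix-+ a b (suc m) = trans (cong (_+ (a m + b m)) (prefix-+ a b m))
    (solve 4 (λ p q x y → p :+ q :+ (x :+ y) := p :+ x :+ (q :+ y)) refl (prefix a m) (prefix b m) (a m) (b m))

  prefix-monoʳ-≤ : ∀ {a} → (∀ i → 0# ≤ a i) → ∀ {m n} → m ℕ.≤ n → prefix a m ≤ prefix a n
  prefix-monoʳ-≤ {a} 0≤a m≤n = go (ℕ.≤⇒≤′ m≤n)
    where
    go : ∀ {m n} → m ℕ.≤′ n → prefix a m ≤ prefix a n
    go (ℕ.≤′-reflexive refl) = ≤-refl
    go (ℕ.≤′-step m≤′n)      = ≤-trans (go m≤′n) (≤-by-gap _ (0≤a _) refl)

  0≤prefix : ∀ {a} → (∀ i → 0# ≤ a i) → ∀ m → 0# ≤ prefix a m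
  0≤prefix 0≤a m = prefix-monoʳ-≤ 0≤a (ℕ.z≤n {m})

  -- The Cauchy product of a and b, with its partial sums arranged as a
  -- triangle: conv a b m is Σ a i * b j over i + j ≡ m, and triangle a b m
  -- is the same sum over i + j < m.
  conv : (ℕ → ℝ) → (ℕ → ℝ) → ℕ → ℝ
  conv a b zero    = a 0 * b 0
  conv a b (suc m) = a 0 * b (suc m) + conv (a ∘ suc) b m

  triangle : (ℕ → ℝ) → (ℕ → ℝ) → ℕ → ℝ
  triangle a b zero    = 0#
  triangle a b (suc m) = a 0 * prefix b (suc m) + triangle (a ∘ suc) b m

  triangle-suc : ∀ a b m → triangle a b (suc m) ≡ triangle a b m + conv a b m
  triangle-suc a b zero = solve 2 (λ a b → a :* (:0 :+ b) :+ :0 := :0 :+ a :* b) refl (a 0) (b 0)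
  triangle-suc a b (suc m) = trans (cong (a 0 * prefix b (suc (suc m)) +_) (triangle-suc (a ∘ suc) b m))
    (solve 5 (λ a p b t c → a :* (p :+ b) :+ (t :+ c) := a :* p :+ t :+ (a :* b :+ c)) refl
      (a 0) (prefix b (suc m)) (b (suc m)) (triangle (a ∘ suc) b m) (conv (a ∘ suc) b m))

  prefix-conv : ∀ a b m → prefix (conv a b) m ≡ triangle a b m
  prefix-conv a b zero    = refl
  prefix-conv a b (suc m) = trans (cong (_+ conv a b m) (prefix-conv a b m)) (sym (triangle-suc a b m))

  conv-cong : ∀ {a a′ b b′} → (∀ i → a i ≡ a′ i) → (∀ i → b i ≡ b′ i) → ∀ m → conv a b m ≡ conv a′ b′ m
  conv-cong a≡ b≡ zero    = cong₂ _*_ (a≡ 0) (b≡ 0)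
  conv-cong a≡ b≡ (suc m) = cong₂ _+_ (cong₂ _*_ (a≡ 0) (b≡ (suc m))) (conv-cong (a≡ ∘ suc) b≡ m)

  conv-+ˡ : ∀ a a′ b m → conv (λ i → a i + a′ i) b m ≡ conv a b m + conv a′ b m
  conv-+ˡ a a′ b zero    = distribʳ _ _ _
  conv-+ˡ a a′ b (suc m) = trans (cong ((a 0 + a′ 0) * b (suc m) +_) (conv-+ˡ (a ∘ suc) (a′ ∘ suc) b m))
    (solve 5 (λ a a′ b c c′ → (a :+ a′) :* b :+ (c :+ c′) := a :* b :+ c :+ (a′ :* b :+ c′)) refl
      (a 0) (a′ 0) (b (suc m)) (conv (a ∘ suc) b m) (conv (a′ ∘ suc) b m))

  conv-*ˡ : ∀ x a b m → conv (λ i → x * a i) b m ≡ x * conv a b m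
  conv-*ˡ x a b zero    = *-assoc _ _ _
  conv-*ˡ x a b (suc m) = trans (cong (x * a 0 * b (suc m) +_) (conv-*ˡ x (a ∘ suc) b m))
    (solve 4 (λ x a b c → x :* a :* b :+ x :* c := x :* (a :* b :+ c)) refl x (a 0) (b (suc m)) (conv (a ∘ suc) b m))

  conv-*ʳ : ∀ x a b m → conv a (λ i → x * b i) m ≡ x * conv a b m
  conv-*ʳ x a b zero    = solve 3 (λ x a b → a :* (x :* b) := x :* (a :* b)) refl x (a 0) (b 0)
  conv-*ʳ x a b (suc m) = trans (cong (a 0 * (x * b (suc m)) +_) (conv-*ʳ x (a ∘ suc) b m))
    (solve 4 (λ x a b c → a :* (x :* b) :+ x :* c := x :* (a :* b :+ c)) refl x (a 0) (b (suc m)) (conv (a ∘ suc) b m))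

  -- Acts on coefficients as differentiation acts on power series.
  deriv : (ℕ → ℝ) → ℕ → ℝ
  deriv a i = fromℕ (suc i) * a (suc i)

  leibniz : ∀ a b m → deriv (conv a b) m ≡ conv (deriv a) b m + conv a (deriv b) m
  leibniz a b zero = solve 4 (λ a₀ a₁ b₀ b₁ →
      (:1 :+ :0) :* (a₀ :* b₁ :+ a₁ :* b₀) := (:1 :+ :0) :* a₁ :* b₀ :+ a₀ :* ((:1 :+ :0) :* b₁)) refl
    (a 0) (a 1) (b 0) (b 1)
  leibniz a b (suc m) = begin
    (1# + fromℕ (suc m)) * (a 0 * b (suc (suc m)) + C)
      ≡⟨ solve 4 (λ n a b c → (:1 :+ n) :* (a :* b :+ c) := a :* ((:1 :+ n) :* b) :+ c :+ n :* c) refl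
           (fromℕ (suc m)) (a 0) (b (suc (suc m))) C ⟩
    a 0 * deriv b (suc m) + C + deriv (conv (a ∘ suc) b) m
      ≡⟨ cong (a 0 * deriv b (suc m) + C +_) (leibniz (a ∘ suc) b m) ⟩
    a 0 * deriv b (suc m) + C + (conv (deriv (a ∘ suc)) b m + conv (a ∘ suc) (deriv b) m)
      ≡⟨ solve 6 (λ x a b c d e → x :+ (a :* b :+ c) :+ (d :+ e) := (:1 :+ :0) :* a :* b :+ (c :+ d) :+ (x :+ e)) refl
           (a 0 * deriv b (suc m)) (a 1) (b (suc m)) (conv (a ∘ (2 ℕ.+_)) b m)
           (conv (deriv (a ∘ suc)) b m) (conv (a ∘ suc) (deriv b) m) ⟩
    deriv a 0 * b (suc m) + (conv (a ∘ (2 ℕ.+_)) b m + conv (deriv (a ∘ suc)) b m) + conv a (deriv b) (suc m)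
      ≡⟨ cong (λ c → deriv a 0 * b (suc m) + c + conv a (deriv b) (suc m)) (sym tail) ⟩
    conv (deriv a) b (suc m) + conv a (deriv b) (suc m) ∎
    where
    open ≡-Reasoning
    C = conv (a ∘ suc) b (suc m)
    -- Shifting and `deriv` do not commute: (i + 2) a (i + 2) exceeds (i + 1) a (i + 2) by one copy
    -- of the shifted sequence. That copy absorbs the part of the surplus C that is not the term
    -- with a 1.
    tail : conv (deriv a ∘ suc) b m ≡ conv (a ∘ (2 ℕ.+_)) b m + conv (deriv (a ∘ suc)) b m
    tail = trans
      (conv-cong (λ i → solve 2 (λ n a → (:1 :+ n) :* a := a :+ n :* a) refl (fromℕ (suc i)) (a (suc (suc i)))) (λ _ → refl) m)
      (conv-+ˡ (a ∘ (2 ℕ.+_)) (deriv (a ∘ suc)) b m)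

  -- The triangle i + j < m lies inside the rectangle i < m, j < k, and all terms are nonnegative.
  triangle≤product : ∀ {a b} → (∀ i → 0# ≤ a i) → (∀ i → 0# ≤ b i) →
    ∀ {m k} → m ℕ.≤ k → triangle a b m ≤ prefix a m * prefix b k
  triangle≤product 0≤a 0≤b ℕ.z≤n = ≤-reflexive (sym (zeroˡ _))
  triangle≤product {a} {b} 0≤a 0≤b {suc m} {k} m<k = begin
    a 0 * prefix b (suc m) + triangle (a ∘ suc) b m
      ≤⟨ +-mono-≤ (*-monoʳ-≤ (0≤a 0) (prefix-monoʳ-≤ 0≤b m<k)) (triangle≤product (0≤a ∘ suc) 0≤b (ℕ.<⇒≤ m<k)) ⟩
    a 0 * prefix b k + prefix (a ∘ suc) m * prefix b k
      ≡⟨ distribʳ _ _ _ ⟨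
    (a 0 + prefix (a ∘ suc) m) * prefix b k
      ≡⟨ cong (_* prefix b k) (prefix-suc a m) ⟨
    prefix a (suc m) * prefix b k ∎
    where open ≤-Reasoning

  -- Conversely, i < m and j < k imply i + j < m + k, so the rectangle lies inside a larger
  -- triangle.
  product≤triangle : ∀ {a b} → (∀ i → 0# ≤ a i) → (∀ i → 0# ≤ b i) →
    ∀ m k → prefix a m * prefix b k ≤ triangle a b (m ℕ.+ k)
  product≤triangle {a} {b} 0≤a 0≤b zero k = subst (_≤ triangle a b k) (sym (zeroˡ _)) (0≤triangle 0≤a k)
    where
    0≤triangle : ∀ {a} → (∀ i → 0# ≤ a i) → ∀ m → 0# ≤ triangle a b m
    0≤triangle 0≤a zero    = ≤-refl
    0≤triangle 0≤a (suc m) = 0≤+ (0≤* (0≤a 0) (0≤prefix 0≤b (suc m))) (0≤triangle (0≤a ∘ suc) m)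
  product≤triangle {a} {b} 0≤a 0≤b (suc m) k = begin
    prefix a (suc m) * prefix b k
      ≡⟨ cong (_* prefix b k) (prefix-suc a m) ⟩
    (a 0 + prefix (a ∘ suc) m) * prefix b k
      ≡⟨ distribʳ _ _ _ ⟩
    a 0 * prefix b k + prefix (a ∘ suc) m * prefix b k
      ≤⟨ +-mono-≤ (*-monoʳ-≤ (0≤a 0) (prefix-monoʳ-≤ 0≤b (ℕ.m≤n+m k (suc m)))) (product≤triangle (0≤a ∘ suc) 0≤b m k) ⟩
    triangle a b (suc m ℕ.+ k) ∎
    where open ≤-Reasoning

  -- The difference is the sum of a i * b j over the part of the rectangle with m ≤ i + j. It is
  -- linear in a with nonnegative coefficients, so a itself may take negative values.
  product-triangle-mono : ∀ {a a′ b} → (∀ i → a i ≤ a′ i) → (∀ i → 0# ≤ b i) → ∀ {m k} → m ℕ.≤ k →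
    prefix a m * prefix b k - triangle a b m ≤ prefix a′ m * prefix b k - triangle a′ b m
  product-triangle-mono a≤a′ 0≤b {zero} _ = ≤-refl
  product-triangle-mono {a} {a′} {b} a≤a′ 0≤b {suc m} {k} m<k = subst₂ _≤_ (step a) (step a′)
    (+-mono-≤ (*-monoˡ-≤ (x≤y⇒0≤y-x (prefix-monoʳ-≤ 0≤b m<k)) (a≤a′ 0)) (product-triangle-mono (a≤a′ ∘ suc) 0≤b (ℕ.<⇒≤ m<k)))
    where
    step : ∀ a → a 0 * (prefix b k - prefix b (suc m)) + (prefix (a ∘ suc) m * prefix b k - triangle (a ∘ suc) b m)
      ≡ prefix a (suc m) * prefix b k - triangle a b (suc m)
    step a = trans
      (solve 5 (λ a p q r t → a :* (p :- q) :+ (r :* p :- t) := (a :+ r) :* p :- (a :* q :+ t)) refl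
        (a 0) (prefix b k) (prefix b (suc m)) (prefix (a ∘ suc) m) (triangle (a ∘ suc) b m))
      (cong (λ p → p * prefix b k - triangle a b (suc m)) (sym (prefix-suc a m)))

-- The exponential series and lower bounds for the logarithm

module ExponentialSeries (R : Reals) where
  open OrderedField R
  open Completeness R
  open PrefixSums R
  open Logarithm R

  expTerm : ℝ → ℕ → ℝ
  expTerm x k = x ^ k / fromℕ (k !)

  expSum : ℝ → ℕ → ℝ
  expSum x = prefix (expTerm x)

  0<! : ∀ k → 0# < fromℕ (k !)
  0<! zero    = 0<fromℕ-suc 0
  0<! (suc k) = subst (0# <_) (sym (fromℕ-* (suc k) (k !))) (0<* (0<fromℕ-suc k) (0<! k))

  expTerm-0 : ∀ x → expTerm x 0 ≡ 1#
  expTerm-0 x = trans (sym (*-identityʳ _)) (trans (cong (expTerm x 0 *_) (sym (+-identityʳ 1#))) (x/y*y≡x 1# (0<! 0)))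

  deriv-expTerm : ∀ x k → deriv (expTerm x) k ≡ x * expTerm x k
  deriv-expTerm x k = begin
    n * (x * x ^ k / fromℕ (suc k !))
      ≡⟨ solve 5 (λ n x y g m → n :* (x :* y :* m) := x :* (y :* :1 :* (m :* n))) refl n x (x ^ k) g (fromℕ (suc k !) ⁻¹) ⟩
    x * (x ^ k * 1# * (fromℕ (suc k !) ⁻¹ * n))
      ≡⟨ cong (λ u → x * (x ^ k * u * (fromℕ (suc k !) ⁻¹ * n))) (⁻¹-inverse (0<! k)) ⟨
    x * (x ^ k * (g * g ⁻¹) * (fromℕ (suc k !) ⁻¹ * n))
      ≡⟨ solve 6 (λ n x y g g′ m → x :* (y :* (g :* g′) :* (m :* n)) := x :* (y :* g′) :* (n :* g :* m)) refl
           n x (x ^ k) g (g ⁻¹) (fromℕ (suc k !) ⁻¹) ⟩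
    x * expTerm x k * (n * g * fromℕ (suc k !) ⁻¹)
      ≡⟨ cong (λ u → x * expTerm x k * (u * fromℕ (suc k !) ⁻¹)) (fromℕ-* (suc k) (k !)) ⟨
    x * expTerm x k * (fromℕ (suc k !) * fromℕ (suc k !) ⁻¹)
      ≡⟨ cong (x * expTerm x k *_) (⁻¹-inverse (0<! (suc k))) ⟩
    x * expTerm x k * 1#
      ≡⟨ *-identityʳ _ ⟩
    x * expTerm x k ∎
    where
    open ≡-Reasoning
    n = fromℕ (suc k)
    g = fromℕ (k !)

  -- Both sides satisfy a 0 ≡ 1 and deriv a ≡ (x + y) a, which determines a.
  conv-expTerm : ∀ x y m → conv (expTerm x) (expTerm y) m ≡ expTerm (x + y) m
  conv-expTerm x y zero = trans (cong₂ _*_ (expTerm-0 x) (expTerm-0 y)) (trans (*-identityˡ 1#) (sym (expTerm-0 (x + y))))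
  conv-expTerm x y (suc m) = ≤-antisym (cancel (≤-reflexive eq)) (cancel (≤-reflexive (sym eq)))
    where
    open ≡-Reasoning
    cancel : ∀ {u v} → fromℕ (suc m) * u ≤ fromℕ (suc m) * v → u ≤ v
    cancel {u} {v} h = *-cancelʳ-≤ (0<fromℕ-suc m) (subst₂ _≤_ (*-comm _ u) (*-comm _ v) h)
    eq : deriv (conv (expTerm x) (expTerm y)) m ≡ deriv (expTerm (x + y)) m
    eq = begin
      deriv (conv (expTerm x) (expTerm y)) m
        ≡⟨ leibniz (expTerm x) (expTerm y) m ⟩
      conv (deriv (expTerm x)) (expTerm y) m + conv (expTerm x) (deriv (expTerm y)) m
        ≡⟨ cong₂ _+_ (conv-cong (deriv-expTerm x) (λ _ → refl) m) (conv-cong (λ _ → refl) (deriv-expTerm y) m) ⟩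
      conv (λ i → x * expTerm x i) (expTerm y) m + conv (expTerm x) (λ i → y * expTerm y i) m
        ≡⟨ cong₂ _+_ (conv-*ˡ x (expTerm x) (expTerm y) m) (conv-*ʳ y (expTerm x) (expTerm y) m) ⟩
      x * conv (expTerm x) (expTerm y) m + y * conv (expTerm x) (expTerm y) m
        ≡⟨ distribʳ _ x y ⟨
      (x + y) * conv (expTerm x) (expTerm y) m
        ≡⟨ cong ((x + y) *_) (conv-expTerm x y m) ⟩
      (x + y) * expTerm (x + y) m
        ≡⟨ deriv-expTerm (x + y) m ⟨
      deriv (expTerm (x + y)) m ∎

  expSum-+ : ∀ x y m → triangle (expTerm x) (expTerm y) m ≡ expSum (x + y) m
  expSum-+ x y m = trans (sym (prefix-conv (expTerm x) (expTerm y) m)) (go m)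
    where
    go : ∀ m → prefix (conv (expTerm x) (expTerm y)) m ≡ expSum (x + y) m
    go zero    = refl
    go (suc m) = cong₂ _+_ (go m) (conv-expTerm x y m)

  0≤expTerm : ∀ {x} → 0# ≤ x → ∀ k → 0# ≤ expTerm x k
  0≤expTerm 0≤x k = 0≤x⇒0≤x/y (0≤^ k 0≤x) (0<! k)

  expSum-monoˡ-≤ : ∀ {x y} → 0# ≤ x → x ≤ y → ∀ m → expSum x m ≤ expSum y m
  expSum-monoˡ-≤ 0≤x x≤y = prefix-mono-≤ λ k → *-monoˡ-≤ (0≤⁻¹ (0<! k)) (^-monoˡ-≤ k 0≤x x≤y)

  expSum-monoʳ-≤ : ∀ {x} → 0# ≤ x → ∀ {m n} → m ℕ.≤ n → expSum x m ≤ expSum x n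
  expSum-monoʳ-≤ 0≤x = prefix-monoʳ-≤ (0≤expTerm 0≤x)

  expSum-1 : ∀ x → expSum x 1 ≡ 1#
  expSum-1 x = trans (+-identityˡ _) (expTerm-0 x)

  expSum-0 : ∀ m → expSum 0# (suc m) ≡ 1#
  expSum-0 zero    = expSum-1 0#
  expSum-0 (suc m) = trans (cong₂ _+_ (expSum-0 m) (trans (cong (_/ fromℕ (suc m !)) (zeroˡ (0# ^ m))) (zeroˡ _))) (+-identityʳ 1#)

  1≤expSum : ∀ {x} → 0# ≤ x → ∀ m → 1# ≤ expSum x (suc m)
  1≤expSum {x} 0≤x m = subst (_≤ expSum x (suc m)) (expSum-1 x) (expSum-monoʳ-≤ 0≤x {1} {suc m} (ℕ.s≤s ℕ.z≤n))

  expSum-+-≤ : ∀ {x y} → 0# ≤ x → 0# ≤ y → ∀ m → expSum (x + y) m ≤ expSum x m * expSum y m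
  expSum-+-≤ {x} {y} 0≤x 0≤y m = subst (_≤ expSum x m * expSum y m) (expSum-+ x y m)
    (triangle≤product (0≤expTerm 0≤x) (0≤expTerm 0≤y) (ℕ.≤-refl {m}))

  expSum-2 : ∀ h → expSum h 2 ≡ 1# + h
  expSum-2 h = cong₂ _+_ (expSum-1 h) (begin
    expTerm h 1             ≡⟨ solve 1 (λ e → e := (:1 :+ :0) :* e) refl (expTerm h 1) ⟩
    deriv (expTerm h) 0     ≡⟨ deriv-expTerm h 0 ⟩
    h * expTerm h 0         ≡⟨ cong (h *_) (expTerm-0 h) ⟩
    h * 1#                  ≡⟨ *-identityʳ h ⟩
    h                       ∎)
    where open ≡-Reasoning

  [1+h]*expSum≤ : ∀ {x h} → 0# ≤ x → 0# ≤ h → ∀ m → (1# + h) * expSum x m ≤ expSum (h + x) (2 ℕ.+ m)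
  [1+h]*expSum≤ {x} {h} 0≤x 0≤h m = subst₂ _≤_ (cong (_* expSum x m) (expSum-2 h)) (expSum-+ h x (2 ℕ.+ m))
    (product≤triangle (0≤expTerm 0≤h) (0≤expTerm 0≤x) 2 m)

  -- As 1 + h is the two-term partial sum at h, a product of n such factors is dominated by a
  -- partial sum at n h; each factor lengthens it by 2.
  [1+h]^≤expSum : ∀ {h} → 0# ≤ h → ∀ n → ∃[ m ] (1# + h) ^ n ≤ expSum (fromℕ n * h) m
  [1+h]^≤expSum {h} 0≤h zero    = 1 , ≤-reflexive (sym (expSum-1 (fromℕ 0 * h)))
  [1+h]^≤expSum {h} 0≤h (suc n) = 2 ℕ.+ m , (begin
    (1# + h) * (1# + h) ^ n           ≤⟨ *-monoʳ-≤ (0≤+ 0≤1 0≤h) ih ⟩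
    (1# + h) * expSum (fromℕ n * h) m ≤⟨ [1+h]*expSum≤ (0≤* (0≤fromℕ n) 0≤h) 0≤h m ⟩
    expSum (h + fromℕ n * h) (2 ℕ.+ m)
      ≡⟨ cong (λ x → expSum x (2 ℕ.+ m)) (solve 2 (λ h n → h :+ n :* h := (:1 :+ n) :* h) refl h (fromℕ n)) ⟩
    expSum (fromℕ (suc n) * h) (2 ℕ.+ m) ∎)
    where
    open ≤-Reasoning
    m  = proj₁ ([1+h]^≤expSum 0≤h n)
    ih = proj₂ ([1+h]^≤expSum 0≤h n)

  expSum-half≤2 : ∀ m → expSum (half 1#) m ≤ fromℕ 2
  expSum-half≤2 m = ≤-trans (≤-by-gap (fromℕ 2 * e m) (0≤* (<⇒≤ 0<2) (0≤expTerm 0≤½ m)) refl) (go m)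
    where
    open ≤-Reasoning
    0≤½ = <⇒≤ (0<half 0<1)
    e = expTerm (half 1#)
    e-halves : ∀ k → fromℕ 2 * e (suc k) ≤ e k
    e-halves k = begin
      fromℕ 2 * e (suc k)                  ≤⟨ *-monoʳ-≤ (<⇒≤ 0<2) (≤-by-gap _ (0≤* (0≤fromℕ k) (0≤expTerm 0≤½ (suc k)))
                                                (solve 2 (λ e n → e :+ n :* e := (:1 :+ n) :* e) refl (e (suc k)) (fromℕ k))) ⟩
      fromℕ 2 * (fromℕ (suc k) * e (suc k)) ≡⟨ cong (fromℕ 2 *_) (deriv-expTerm (half 1#) k) ⟩
      fromℕ 2 * (half 1# * e k)            ≡⟨ solve 2 (λ h e → :2 :* (h :* e) := (h :+ h) :* e) refl (half 1#) (e k) ⟩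
      (half 1# + half 1#) * e k            ≡⟨ cong (_* e k) (half+half 1#) ⟩
      1# * e k                             ≡⟨ *-identityˡ (e k) ⟩
      e k                                  ∎
    -- The terms at least halve at each step, so 2 e m bounds everything still to come; carrying it
    -- along makes the induction close.
    go : ∀ m → expSum (half 1#) m + fromℕ 2 * e m ≤ fromℕ 2
    go zero = ≤-reflexive (trans (+-identityˡ _) (trans (cong (fromℕ 2 *_) (expTerm-0 (half 1#))) (*-identityʳ _)))
    go (suc m) = begin
      expSum (half 1#) m + e m + fromℕ 2 * e (suc m)  ≤⟨ +-monoʳ-≤ _ (e-halves m) ⟩
      expSum (half 1#) m + e m + e m                  ≡⟨ solve 2 (λ s e → s :+ e :+ e := s :+ :2 :* e) refl (expSum (half 1#) m) (e m) ⟩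
      expSum (half 1#) m + fromℕ 2 * e m              ≤⟨ go m ⟩
      fromℕ 2                                         ∎

  -- This is √e ≤ 2, multiplied n times. The crude bound is enough to show that partial sums are
  -- bounded and that logarithms grow without bound.
  expSum≤2^ : ∀ n m → expSum (fromℕ n * half 1#) m ≤ fromℕ 2 ^ n
  expSum≤2^ n       zero    = 0≤^ n (<⇒≤ 0<2)
  expSum≤2^ zero    (suc m) = ≤-reflexive (trans (cong (λ x → expSum x (suc m)) (zeroˡ (half 1#))) (expSum-0 m))
  expSum≤2^ (suc n) m@(suc _) = begin
    expSum ((1# + fromℕ n) * half 1#) m
      ≡⟨ cong (λ x → expSum x m) (solve 2 (λ h n → (:1 :+ n) :* h := h :+ n :* h) refl (half 1#) (fromℕ n)) ⟩
    expSum (half 1# + fromℕ n * half 1#) m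
      ≤⟨ expSum-+-≤ 0≤½ (0≤* (0≤fromℕ n) 0≤½) m ⟩
    expSum (half 1#) m * expSum (fromℕ n * half 1#) m
      ≤⟨ *-mono-≤ (0≤prefix (0≤expTerm (0≤* (0≤fromℕ n) 0≤½)) m) (<⇒≤ 0<2) (expSum-half≤2 m) (expSum≤2^ n m) ⟩
    fromℕ 2 ^ suc n ∎
    where
    open ≤-Reasoning
    0≤½ = <⇒≤ (0<half 0<1)

  ∣-x∣^ : ∀ {x} → 0# ≤ x → ∀ k → - (x ^ k) ≤ (- x) ^ k × (- x) ^ k ≤ x ^ k
  ∣-x∣^ 0≤x zero    = ≤-by-gap (fromℕ 2) (<⇒≤ 0<2) (solve 0 (:- :1 :+ :2 := :1) refl) , ≤-refl
  ∣-x∣^ {x} 0≤x (suc k) =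
      ≤-by-gap _ (0≤* 0≤x (x≤y⇒0≤y-x (proj₂ (∣-x∣^ 0≤x k))))
        (solve 3 (λ x y z → :- (x :* y) :+ x :* (y :- z) := (:- x) :* z) refl x (x ^ k) ((- x) ^ k))
    , ≤-by-gap _ (0≤* 0≤x (x≤y⇒0≤y-x (proj₁ (∣-x∣^ 0≤x k))))
        (solve 3 (λ x y z → (:- x) :* z :+ x :* (z :- :- y) := x :* y) refl x (x ^ k) ((- x) ^ k))

  -- exp (- x) * exp x = 1 up to the part of the Cauchy square outside the triangle.
  expSum-neg : ∀ {x} → 0# ≤ x → ∀ m →
    expSum (- x) (suc m) * expSum x (suc m) ≤ 1# + (expSum (x + x) (suc m ℕ.+ suc m) - expSum (x + x) (suc m))
  expSum-neg {x} 0≤x m = begin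
    P
      ≡⟨ solve 2 (λ p t → p := t :+ (p :- t)) refl P T ⟩
    T + (P - T)
      ≤⟨ +-mono-≤ (≤-reflexive T≡1) (≤-trans
           (product-triangle-mono (λ k → *-monoˡ-≤ (0≤⁻¹ (0<! k)) (proj₂ (∣-x∣^ 0≤x k))) (0≤expTerm 0≤x) (ℕ.≤-refl {suc m}))
           (+-mono-≤ (≤-trans (product≤triangle (0≤expTerm 0≤x) (0≤expTerm 0≤x) (suc m) (suc m)) (≤-reflexive (expSum-+ x x (suc m ℕ.+ suc m))))
                     (≤-reflexive (cong -_ (expSum-+ x x (suc m)))))) ⟩
    1# + (expSum (x + x) (suc m ℕ.+ suc m) - expSum (x + x) (suc m)) ∎
    where
    open ≤-Reasoning
    P = expSum (- x) (suc m) * expSum x (suc m)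
    T = triangle (expTerm (- x)) (expTerm x) (suc m)
    T≡1 : T ≡ 1#
    T≡1 = trans (expSum-+ (- x) x (suc m)) (trans (cong (λ y → expSum y (suc m)) (-‿inverseˡ x)) (expSum-0 m))

  IsLog⇒converges : ∀ {f ℓ} → IsLog f ℓ → ∀ {δ} → 0# < δ →
    ∃[ N ] (∀ m → N ℕ.≤ m → expSum ℓ m < f + δ × f < expSum ℓ m + δ)
  IsLog⇒converges {f} {ℓ} isLog {δ} 0<δ = proj₁ (isLog δ 0<δ) , λ m N≤m →
    subst (λ s → s < f + δ × f < s + δ) (∑≡prefix (expTerm ℓ) m) (proj₂ (isLog δ 0<δ) m N≤m)

  -- In the limit this is (1 + h) ^ n ≤ exp (n h) ≤ exp ℓ = f; the finite version loses δ by
  -- stopping at a partial sum close to f.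
  [1+h]^≤ : ∀ {f ℓ h} n → IsLog f ℓ → 0# ≤ h → fromℕ n * h ≤ ℓ → (1# + h) ^ n ≤ f
  [1+h]^≤ {f} {ℓ} {h} n isLog 0≤h nh≤ℓ = ≤-by-slack λ δ 0<δ →
    let (N , near) = IsLog⇒converges isLog 0<δ
        (m , bound) = [1+h]^≤expSum 0≤h n
        0≤nh = 0≤* (0≤fromℕ n) 0≤h
    in begin
      (1# + h) ^ n              ≤⟨ bound ⟩
      expSum (fromℕ n * h) m    ≤⟨ expSum-monoˡ-≤ 0≤nh nh≤ℓ m ⟩
      expSum ℓ m                ≤⟨ expSum-monoʳ-≤ (≤-trans 0≤nh nh≤ℓ) (ℕ.m≤m+n m N) ⟩
      expSum ℓ (m ℕ.+ N)        ≤⟨ <⇒≤ (proj₁ (near (m ℕ.+ N) (ℕ.m≤n+m N m))) ⟩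
      f + δ                     ∎
    where open ≤-Reasoning

  -- At a negative argument the terms alternate in sign and the partial sums are not monotone.
  -- Multiplying by the series at x, which is at least 1, gives a product of at most 2 and thereby a
  -- bound on f. Any absolute constant in place of 3 would serve.
  log-negative : ∀ {f x} → 0# ≤ x → IsLog f (- x) → f ≤ fromℕ 3
  log-negative {f} {x} 0≤x isLog = ≤-stable λ f≰3 → archimedean ((x + x) * fromℕ 2) λ (n , 4x<n) →
    let
      0≤2x = 0≤+ 0≤x 0≤x
      2x≤n/2 : x + x ≤ fromℕ n * half 1#
      2x≤n/2 = *-cancelʳ-≤ 0<2 (≤-trans (<⇒≤ 4x<n) (≤-reflexive (trans (sym (*-identityʳ _)) (trans (cong (fromℕ n *_) (sym (half+half 1#)))
        (solve 2 (λ n h → n :* (h :+ h) := n :* h :* :2) refl (fromℕ n) (half 1#))))))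
      -- The supremum of the partial sums at 2x replaces a Cauchy argument: from some index k on
      -- they stay within 1 of it, which bounds the part of the Cauchy square outside the triangle.
      Range = λ y → ∃[ m ] y ≡ expSum (x + x) m
      sup = supremum Range (0# , 0 , refl) (fromℕ 2 ^ n , λ { _ (m , refl) →
        ≤-trans (expSum-monoˡ-≤ 0≤2x 2x≤n/2 m) (expSum≤2^ n m) })
      s = proj₁ sup
      (N , near) = IsLog⇒converges isLog 0<1
    in below-supremum {Range} {s} {s - 1#} (proj₂ sup)
         (<-by-gap 1# 0<1 (solve 1 (λ s → s :- :1 :+ :1 := s) refl s))
         λ { (_ , (k , refl) , s-1<) →
    let
      m = k ℕ.+ N
      p = expSum (- x) (suc m)
      q = expSum x (suc m)
      pq≤2 : p * q ≤ fromℕ 2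
      pq≤2 = begin
        p * q
          ≤⟨ expSum-neg 0≤x m ⟩
        1# + (expSum (x + x) (suc m ℕ.+ suc m) - expSum (x + x) (suc m))
          ≤⟨ +-monoʳ-≤ 1# (+-mono-≤ (proj₁ (proj₂ sup) _ (suc m ℕ.+ suc m , refl))
               (neg-mono-≤ (≤-trans (<⇒≤ s-1<) (expSum-monoʳ-≤ 0≤2x {k} {suc m} (ℕ.m≤n⇒m≤1+n (ℕ.m≤m+n k N)))))) ⟩
        1# + (s - (s - 1#))
          ≡⟨ solve 1 (λ s → :1 :+ (s :- (s :- :1)) := :2) refl s ⟩
        fromℕ 2 ∎
      p≤2 : p ≤ fromℕ 2
      p≤2 = ≤-stable λ p≰2 → p≰2 (≤-trans (≤-by-gap (p * (q - 1#))
              (0≤* (≤-trans (<⇒≤ 0<2) (<⇒≤ (≰⇒> p≰2))) (x≤y⇒0≤y-x (1≤expSum 0≤x m)))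
              (solve 2 (λ p q → p :+ p :* (q :- :1) := p :* q) refl p q)) pq≤2)
    in f≰3 (begin
         f            ≤⟨ <⇒≤ (proj₂ (near (suc m) (ℕ.m≤n⇒m≤1+n (ℕ.m≤n+m N k)))) ⟩
         p + 1#       ≤⟨ +-mono-≤ p≤2 ≤-refl ⟩
         fromℕ 2 + 1# ≡⟨ solve 0 (:2 :+ :1 := con (pos 3)) refl ⟩
         fromℕ 3      ∎) }
    where open ≤-Reasoning

  -- If 0 ≤ ℓ < n / 2, then f ≤ exp (n / 2) ≤ 2 ^ n. The summand 4 excludes ℓ ≤ 0, where f ≤ 3.
  log-large : ∀ n {f ℓ} → IsLog f ℓ → fromℕ 2 ^ n + fromℕ 4 ≤ f → fromℕ n * half 1# ≤ ℓ
  log-large n {f} {ℓ} isLog f-large with <-or-≥ ℓ (fromℕ n * half 1#)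
  ... | inj₂ n/2≤ℓ = n/2≤ℓ
  ... | inj₁ ℓ<n/2 with ≤-total 0# ℓ
  ...   | inj₁ 0≤ℓ = contradiction (≤-trans f-large f≤2^n) (<⇒≱ (<-by-gap (fromℕ 4) (0<fromℕ-suc 3) refl))
    where
    f≤2^n : f ≤ fromℕ 2 ^ n
    f≤2^n = ≤-by-slack λ δ 0<δ →
      let (N , near) = IsLog⇒converges isLog 0<δ
      in ≤-trans (<⇒≤ (proj₂ (near N ℕ.≤-refl)))
           (+-mono-≤ (≤-trans (expSum-monoˡ-≤ 0≤ℓ (<⇒≤ ℓ<n/2) N) (expSum≤2^ n N)) ≤-refl)
  ...   | inj₂ ℓ≤0 = contradiction
          (≤-trans f-large (log-negative {f} {0# - ℓ} (x≤y⇒0≤y-x ℓ≤0) (subst (IsLog f) (solve 1 (λ x → x := :- (:0 :- x)) refl ℓ) isLog)))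
          (<⇒≱ (<-by-gap (fromℕ 2 ^ n + 1#) (0<+ (0<^ n 0<2) 0≤1)
            (solve 1 (λ x → con (pos 3) :+ (x :+ :1) := x :+ con (pos 4)) refl (fromℕ 2 ^ n))))

  -- The archimedean property gives such an f₀ only under a double negation,
  -- and a supremum turns it into a witness.  The supremum is taken over the
  -- reciprocals of the admissible f₀, since these form a bounded set.
  log-unbounded : ∀ K → ∃[ f₀ ] (∀ f ℓ → f₀ ≤ f → IsLog f ℓ → K ≤ ℓ)
  log-unbounded K = fromℕ 2 / s , λ f ℓ f₀≤f isLog → ≤-stable λ K≰ℓ →
    below-supremum isSup s/2<s λ
      { (_ , inj₁ refl , s/2<0) → <⇒≱ s/2<0 (<⇒≤ 0<s/2)
      ; (t , inj₂ (0<t , t≤1 , good) , s/2<t) → K≰ℓ (good f ℓ (begin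
          1#                    ≡⟨ 1≡ ⟩
          fromℕ 2 / s * half s  ≤⟨ *-mono-≤ (<⇒≤ 0<s/2) (≤-trans (0≤x⇒0≤x/y (<⇒≤ 0<2) 0<s) f₀≤f) f₀≤f (<⇒≤ s/2<t) ⟩
          f * t                 ∎) isLog) }
    where
    open ≤-Reasoning
    Good : ℝ → Set
    Good t = ∀ f ℓ → 1# ≤ f * t → IsLog f ℓ → K ≤ ℓ
    -- The value 0 is included because `supremum` asks for an element, and a positive one is known
    -- only under a double negation.
    A : Pred ℝ 0ℓ
    A t = t ≡ 0# ⊎ (0# < t × t ≤ 1# × Good t)
    sup : ∃ (IsSupremum A)
    sup = supremum A (0# , inj₁ refl) (1# , λ { _ (inj₁ refl) → 0≤1 ; _ (inj₂ (_ , t≤1 , _)) → t≤1 })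
    s     = proj₁ sup
    isSup = proj₂ sup
    0<s : 0# < s
    0<s with 0# <? s
    ... | yes 0<s = 0<s
    ... | no  0≮s = ⊥-elim $ archimedean (K * fromℕ 2) λ (n , 2K<n) →
      let
        g = fromℕ 2 ^ n + fromℕ 4
        0<g = 0<+ (0<^ n 0<2) (0≤fromℕ 4)
        1≤g = ≤-by-gap (fromℕ 2 ^ n + fromℕ 3) (0≤+ (0≤^ n (<⇒≤ 0<2)) (0≤fromℕ 3))
          (solve 1 (λ x → :1 :+ (x :+ con (pos 3)) := x :+ con (pos 4)) refl (fromℕ 2 ^ n))
        K≤n/2 : K ≤ fromℕ n * half 1#
        K≤n/2 = *-cancelʳ-≤ 0<2 (≤-trans (<⇒≤ 2K<n) (≤-reflexive (trans (sym (*-identityʳ _)) (trans (cong (fromℕ n *_) (sym (half+half 1#)))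
          (solve 2 (λ n h → n :* (h :+ h) := n :* h :* :2) refl (fromℕ n) (half 1#))))))
        good : Good (1# / g)
        good f ℓ 1≤f/g isLog = ≤-trans K≤n/2 (log-large n isLog (begin
          g                ≡⟨ *-identityˡ g ⟨
          1# * g           ≤⟨ *-monoˡ-≤ (<⇒≤ 0<g) 1≤f/g ⟩
          f * (1# / g) * g ≡⟨ *-assoc _ _ _ ⟩
          f * (1# / g * g) ≡⟨ cong (f *_) (x/y*y≡x 1# 0<g) ⟩
          f * 1#           ≡⟨ *-identityʳ f ⟩
          f                ∎))
        0<1/g = 0<x⇒0<x/y 0<1 0<g
      in 0≮s (<-≤-trans 0<1/g (proj₁ isSup _ (inj₂ (0<1/g , x/z≤y 0<g (subst (1# ≤_) (sym (*-identityˡ g)) 1≤g) , good))))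
    0<s/2 = 0<half 0<s
    s/2<s : half s < s
    s/2<s = <-by-gap (half s) 0<s/2 (half+half s)
    1≡ : 1# ≡ fromℕ 2 / s * half s
    1≡ = sym (≡R.begin
      fromℕ 2 / s * half s   ≡R.≡⟨ solve 4 (λ t s h r → t :* r :* (s :* h) := t :* h :* (s :* r)) refl (fromℕ 2) s (fromℕ 2 ⁻¹) (s ⁻¹) ⟩
      (fromℕ 2 * fromℕ 2 ⁻¹) * (s * s ⁻¹) ≡R.≡⟨ cong₂ _*_ (⁻¹-inverse 0<2) (⁻¹-inverse 0<s) ⟩
      1# * 1#                ≡R.≡⟨ *-identityˡ 1# ⟩
      1#                     ≡R.∎)
      where module ≡R = ≡-Reasoning

-- Lebesgue measure of intervals

module _ {A : Set} where

  -- Merges two countable covers into one. The sequences swap roles at each step, so that no parity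
  -- of an index is ever tested.
  interleave : (ℕ → A) → (ℕ → A) → ℕ → A
  interleave f g zero    = f 0
  interleave f g (suc i) = interleave g (f ∘ suc) i

  interleave-all : ∀ (P : Pred A 0ℓ) f g → (∀ i → P (f i)) → (∀ i → P (g i)) → ∀ i → P (interleave f g i)
  interleave-all P f g Pf Pg zero    = Pf 0
  interleave-all P f g Pf Pg (suc i) = interleave-all P g (f ∘ suc) Pg (Pf ∘ suc) i

  interleave-anyˡ : ∀ (P : Pred A 0ℓ) f g i → P (f i) → ∃[ j ] P (interleave f g j)
  interleave-anyʳ : ∀ (P : Pred A 0ℓ) f g i → P (g i) → ∃[ j ] P (interleave f g j)
  interleave-anyˡ P f g zero    p = 0 , p
  interleave-anyˡ P f g (suc i) p = let (j , q) = interleave-anyʳ P g (f ∘ suc) i p in suc j , q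
  interleave-anyʳ P f g i       p = let (j , q) = interleave-anyˡ P g (f ∘ suc) i p in suc j , q

module Intervals (R : Reals) where
  open OrderedField R
  open Completeness R
  open PrefixSums R
  open Lebesgue R

  totalOrder : TotalOrder _ _ _
  totalOrder = record { isTotalOrder = isTotalOrder }

  open Algebra.Construct.NaturalChoice.Min totalOrder
    using (_⊓_; x⊓y≤x; x⊓y≤y; ⊓-sel; ⊓-monoˡ-≤; x≤y⇒x⊓y≈x; x≤y⇒y⊓x≈x; ⊓-glb)
  open Algebra.Construct.NaturalChoice.Max totalOrder
    using (_⊔_; x≤x⊔y; ⊔-monoˡ-≤; x≤y⇒x⊔y≈y; x≤y⇒y⊔x≈y; ⊔-lub)

  ⊓-glb-< : ∀ {x y z} → x < y → x < z → x < y ⊓ z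
  ⊓-glb-< {x} {y} {z} x<y x<z with ⊓-sel y z
  ... | inj₁ y⊓z≡y = subst (x <_) (sym y⊓z≡y) x<y
  ... | inj₂ y⊓z≡z = subst (x <_) (sym y⊓z≡z) x<z

  [_,_⟩ : ℝ → ℝ → Pred ℝ 0ℓ
  [ a , b ⟩ x = a ≤ x × x < b

  [_,_⟩? : ∀ a b x → Dec (x ∈ₚ [ a , b ⟩)
  [ a , b ⟩? x = (a ≤? x) ×-dec (x <? b)

  Interval : Set
  Interval = ℝ × ℝ

  Ordered : Pred Interval 0ℓ
  Ordered (l , r) = l ≤ r

  _Contains_ : Interval → ℝ → Set
  (l , r) Contains x = l < x × x < r

  len : Interval → ℝ
  len (l , r) = r - l

  record Cover (A : Pred ℝ 0ℓ) (s : ℝ) : Set where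
    constructor mkCover
    field
      interval : ℕ → Interval
      ordered  : ∀ i → Ordered (interval i)
      covers   : ∀ x → x ∈ₚ A → ∃[ i ] interval i Contains x
      bounded  : ∀ m → prefix (len ∘ interval) m ≤ s

  toCoverBound : ∀ {A s} → Cover A s → CoverBound A s
  toCoverBound {s = s} (mkCover I ord cov bnd) =
    proj₁ ∘ I , proj₂ ∘ I , ord , cov , λ m → subst (_≤ s) (sym (∑≡prefix (len ∘ I) m)) (bnd m)

  fromCoverBound : ∀ {A s} → CoverBound A s → Cover A s
  fromCoverBound {s = s} (a , b , ord , cov , bnd) =
    mkCover (λ i → a i , b i) ord cov λ m → subst (_≤ s) (∑≡prefix (λ i → b i - a i) m) (bnd m)

  term≤prefix : ∀ {a} → (∀ i → 0# ≤ a i) → ∀ {i m} → i ℕ.< m → a i ≤ prefix a m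
  term≤prefix {a} 0≤a {i} {m} i<m = ≤-trans
    (≤-by-gap (prefix a i) (0≤prefix 0≤a i) (+-comm (a i) (prefix a i))) (prefix-monoʳ-≤ 0≤a i<m)

  -- A supremum argument in place of compactness. Let `left x i` be the length of the part of
  -- interval i to the left of x, and call x reached if finitely many of these add up to x - a. If
  -- the supremum c of the reached points were below b, some interval i would contain c. From a
  -- reached point of that interval one could then move on to the smaller of its right end and b,
  -- which lies beyond c.
  interval-length-≤ : ∀ {a b} → a ≤ b → ∀ {s} → Cover [ a , b ⟩ s → b - a ≤ s
  interval-length-≤ {a} {b} a≤b {s} C = ≤-trans (+-mono-≤ b≤c ≤-refl) c-a≤s
    where
    open Cover C
    l r : ℕ → ℝ
    l = proj₁ ∘ interval
    r = proj₂ ∘ interval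

    left : ℝ → ℕ → ℝ
    left x i = (r i ⊓ x) - (l i ⊓ x)

    0≤left : ∀ x i → 0# ≤ left x i
    0≤left x i = x≤y⇒0≤y-x (⊓-monoˡ-≤ x (ordered i))

    left-mono : ∀ {x y} → x ≤ y → ∀ i → left x i ≤ left y i
    left-mono {x} {y} x≤y i with ≤-total x (l i)
    ... | inj₁ x≤l = subst (_≤ left y i)
            (sym (trans (cong₂ _-_ (x≤y⇒y⊓x≈x (≤-trans x≤l (ordered i))) (x≤y⇒y⊓x≈x x≤l)) (-‿inverseʳ x))) (0≤left y i)
    ... | inj₂ l≤x = subst₂ (λ u v → (r i ⊓ x) - u ≤ (r i ⊓ y) - v)
            (sym (x≤y⇒x⊓y≈x l≤x)) (sym (x≤y⇒x⊓y≈x (≤-trans l≤x x≤y)))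
            (+-mono-≤ (⊓-glb (x⊓y≤x (r i) x) (≤-trans (x⊓y≤y (r i) x) x≤y)) ≤-refl)

    left≤len : ∀ x i → left x i ≤ len (interval i)
    left≤len x i = [ ≤-reflexive ∘ left≡len , (λ x≤r → ≤-trans (left-mono x≤r i) (≤-reflexive (left≡len ≤-refl))) ]′ (≤-total (r i) x)
      where
      left≡len : ∀ {x} → r i ≤ x → left x i ≡ len (interval i)
      left≡len r≤x = cong₂ _-_ (x≤y⇒x⊓y≈x r≤x) (x≤y⇒x⊓y≈x (≤-trans (ordered i) r≤x))

    Reached : Pred ℝ 0ℓ
    Reached x = a ≤ x × x ≤ b × ∃[ m ] x - a ≤ prefix (left x) m

    sup : ∃ (IsSupremum Reached)
    sup = supremum Reached (a , ≤-refl , a≤b , 0 , ≤-reflexive (-‿inverseʳ a)) (b , λ _ → proj₁ ∘ proj₂)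
    c     = proj₁ sup
    isSup = proj₂ sup

    c-a≤s : c - a ≤ s
    c-a≤s = ≤-by-gap _ (x≤y⇒0≤y-x (proj₂ isSup (a + s) λ x (_ , _ , m , x-a≤) →
        ≤-by-gap _ (x≤y⇒0≤y-x (≤-trans x-a≤ (≤-trans (prefix-mono-≤ (left≤len x) m) (bounded m))))
          (solve 3 (λ x a s → x :+ (s :- (x :- a)) := a :+ s) refl x a s)))
      (solve 3 (λ c a s → c :- a :+ (a :+ s :- c) := s) refl c a s)

    b≤c : b ≤ c
    b≤c = ≮⇒≥ λ c<b →
      let
        (i , l<c , c<r) = covers c (proj₁ isSup a (≤-refl , a≤b , 0 , ≤-reflexive (-‿inverseʳ a)) , c<b)
        y   = r i ⊓ b
        c<y = ⊓-glb-< c<r c<b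
      in below-supremum isSup l<c λ (x , reached@(a≤x , _ , m , x-a≤) , l<x) →
      let
        x≤y = ≤-trans (proj₁ isSup x reached) (<⇒≤ c<y)
        -- Large enough to include both the first m intervals, which reach x, and the interval i,
        -- which carries x on to y.
        n   = m ℕ.+ suc i
        y-x≤ : y - x ≤ prefix (λ j → left y j - left x j) n
        y-x≤ = ≤-trans
          (≤-reflexive (trans (solve 3 (λ x y l → y :- x := y :- l :- (x :- l)) refl x y (l i)) (cong₂ _-_
            (sym (cong₂ _-_ (x≤y⇒y⊓x≈x (x⊓y≤x (r i) b)) (x≤y⇒x⊓y≈x (≤-trans (<⇒≤ l<x) x≤y))))
            (sym (cong₂ _-_ (x≤y⇒y⊓x≈x (≤-trans x≤y (x⊓y≤x (r i) b))) (x≤y⇒x⊓y≈x (<⇒≤ l<x)))))))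
          (term≤prefix (λ j → x≤y⇒0≤y-x (left-mono x≤y j)) (ℕ.m≤n+m (suc i) m))
        y-a≤ : y - a ≤ prefix (left y) n
        y-a≤ = begin
          y - a                     ≡⟨ solve 3 (λ x y a → y :- a := x :- a :+ (y :- x)) refl x y a ⟩
          x - a + (y - x)           ≤⟨ +-mono-≤ (≤-trans x-a≤ (prefix-monoʳ-≤ (0≤left x) (ℕ.m≤m+n m (suc i)))) y-x≤ ⟩
          prefix (left x) n + prefix (λ j → left y j - left x j) n
                                    ≡⟨ prefix-+ (left x) (λ j → left y j - left x j) n ⟨
          prefix (λ j → left x j + (left y j - left x j)) n
                                    ≤⟨ prefix-mono-≤ (λ j → ≤-reflexive
                                         (solve 2 (λ u v → u :+ (v :- u) := v) refl (left x j) (left y j))) n ⟩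
          prefix (left y) n         ∎
      in <⇒≱ c<y (proj₁ isSup y (≤-trans a≤x x≤y , x⊓y≤y (r i) b , n , y-a≤))
      where open ≤-Reasoning

  outerMeasure-interval : ∀ {a b} → a ≤ b → OuterMeasure [ a , b ⟩ (b - a)
  outerMeasure-interval {a} {b} a≤b =
      (b - a + 1# , toCoverBound (cover 0<1))
    , (λ s C → interval-length-≤ a≤b (fromCoverBound C))
    , λ y lower → ≤-by-slack λ δ 0<δ → lower _ (toCoverBound (cover 0<δ))
    where
    cover : ∀ {δ} → 0# < δ → Cover [ a , b ⟩ (b - a + δ)
    cover {δ} 0<δ = mkCover I ord (λ x (a≤x , x<b) → 0 , <-≤-trans a-δ<a a≤x , x<b) bnd
      where
      I : ℕ → Interval
      -- An open interval has to start strictly before a to contain it; all later intervals are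
      -- empty.
      I zero    = a - δ , b
      I (suc _) = a , a
      a-δ<a : a - δ < a
      a-δ<a = <-by-gap δ 0<δ (solve 2 (λ a δ → a :- δ :+ δ := a) refl a δ)
      ord : ∀ i → Ordered (I i)
      ord zero    = ≤-trans (<⇒≤ a-δ<a) a≤b
      ord (suc _) = ≤-refl
      bnd : ∀ m → prefix (len ∘ I) m ≤ b - a + δ
      bnd zero          = 0≤+ (x≤y⇒0≤y-x a≤b) (<⇒≤ 0<δ)
      bnd (suc zero)    = ≤-reflexive (solve 3 (λ a b δ → :0 :+ (b :- (a :- δ)) := b :- a :+ δ) refl a b δ)
      bnd (suc (suc m)) = subst (_≤ b - a + δ) (solve 2 (λ p a → p := p :+ (a :- a)) refl (prefix (len ∘ I) (suc m)) a) (bnd (suc m))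

  interleave-len : ∀ f g m → ∃[ j ] ∃[ k ] prefix (len ∘ interleave f g) m ≡ prefix (len ∘ f) j + prefix (len ∘ g) k
  interleave-len f g zero    = 0 , 0 , sym (+-identityʳ 0#)
  interleave-len f g (suc m) with interleave-len g (f ∘ suc) m
  ... | j , k , eq = suc k , j , (begin
    prefix (len ∘ interleave f g) (suc m)
      ≡⟨ prefix-suc (len ∘ interleave f g) m ⟩
    len (f 0) + prefix (len ∘ interleave g (f ∘ suc)) m
      ≡⟨ cong (len (f 0) +_) eq ⟩
    len (f 0) + (prefix (len ∘ g) j + prefix (len ∘ f ∘ suc) k)
      ≡⟨ solve 3 (λ x p q → x :+ (p :+ q) := x :+ q :+ p) refl (len (f 0)) (prefix (len ∘ g) j) (prefix (len ∘ f ∘ suc) k) ⟩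
    len (f 0) + prefix (len ∘ f ∘ suc) k + prefix (len ∘ g) j
      ≡⟨ cong (_+ prefix (len ∘ g) j) (prefix-suc (len ∘ f) k) ⟨
    prefix (len ∘ f) (suc k) + prefix (len ∘ g) j ∎)
    where open ≡-Reasoning

  cover-union : ∀ {E A s t} → (∀ x → Dec (x ∈ₚ A)) → Cover (E ∩ₚ A) s → Cover (E ∖ₚ A) t → Cover E (s + t)
  cover-union {E} {A} {s} {t} A? (mkCover I ordI covI bndI) (mkCover J ordJ covJ bndJ) = mkCover (interleave I J)
    (interleave-all Ordered I J ordI ordJ)
    cov
    λ m → let (j , k , eq) = interleave-len I J m in subst (_≤ s + t) (sym eq) (+-mono-≤ (bndI j) (bndJ k))
    where
    cov : ∀ x → x ∈ₚ E → ∃[ i ] interleave I J i Contains x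
    cov x x∈E with A? x
    ... | yes x∈A = let (i , h) = covI x (x∈E , x∈A) in interleave-anyˡ (_Contains x) I J i h
    ... | no  x∉A = let (i , h) = covJ x (x∈E , x∉A) in interleave-anyʳ (_Contains x) I J i h

  dyadic : ℝ → ℕ → ℝ
  dyadic δ zero    = half δ
  dyadic δ (suc i) = dyadic (half δ) i

  0<dyadic : ∀ {δ} → 0# < δ → ∀ i → 0# < dyadic δ i
  0<dyadic 0<δ zero    = 0<half 0<δ
  0<dyadic 0<δ (suc i) = 0<dyadic (0<half 0<δ) i

  prefix-dyadic : ∀ {δ} → 0# < δ → ∀ m → prefix (dyadic δ) m ≤ δ
  prefix-dyadic 0<δ zero        = <⇒≤ 0<δ
  prefix-dyadic {δ} 0<δ (suc m) = subst₂ _≤_ (sym (prefix-suc (dyadic δ) m)) (half+half δ)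
    (+-monoʳ-≤ (half δ) (prefix-dyadic (0<half 0<δ) m))

  -- Each interval of a cover of E is cut at a and at b. The middle pieces cover the part of E
  -- inside, the two outer ones the part outside. Open pieces could miss the points a and b
  -- themselves, so the middle and the right piece are extended to the left by dyadic amounts, each
  -- family costing at most δ / 2. The other inequality merges two covers.
  measurable-interval : ∀ {a b} → a ≤ b → Measurable [ a , b ⟩
  measurable-interval {a} {b} a≤b E r p q (_ , r-lower , r-greatest) (_ , p-lower , p-greatest) (_ , q-lower , q-greatest) =
    ≤-antisym (r-greatest (p + q) λ s C → ≤-by-slack λ δ 0<δ → split (fromCoverBound C) 0<δ) r≤p+q
    where
    open ≤-Reasoning
    r≤p+q : r ≤ p + q
    r≤p+q = ≤-by-gap _ (x≤y⇒0≤y-x (q-greatest (r - p) λ t D → ≤-by-gap _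
        (x≤y⇒0≤y-x (p-greatest (r - t) λ s C → ≤-by-gap _
          (x≤y⇒0≤y-x (r-lower (s + t) (toCoverBound (cover-union [ a , b ⟩? (fromCoverBound C) (fromCoverBound D)))))
          (solve 3 (λ r s t → r :- t :+ (s :+ t :- r) := s) refl r s t)))
        (solve 3 (λ r p t → r :- p :+ (p :- (r :- t)) := t) refl r p t)))
      (solve 3 (λ r p q → r :+ (q :- (r :- p)) := p :+ q) refl r p q)

    clamp : ℝ → ℝ
    clamp x = (x ⊔ a) ⊓ b

    clamp-mono : ∀ {x y} → x ≤ y → clamp x ≤ clamp y
    clamp-mono = ⊓-monoˡ-≤ b ∘ ⊔-monoˡ-≤ a

    -- The three functions that cut at a and b add up to x plus a constant, so the three pieces have
    -- the length of the original interval in total, wherever it lies.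
    pieces : ∀ x → clamp x + (x ⊓ a) + (x ⊔ b) ≡ x + a + b
    pieces x = [ below , (λ a≤x → [ within a≤x , above a≤x ]′ (≤-total x b)) ]′ (≤-total x a)
      where
      below : x ≤ a → clamp x + (x ⊓ a) + (x ⊔ b) ≡ x + a + b
      below x≤a = trans
        (cong₂ _+_ (cong₂ _+_ (trans (cong (_⊓ b) (x≤y⇒x⊔y≈y x≤a)) (x≤y⇒x⊓y≈x a≤b)) (x≤y⇒x⊓y≈x x≤a)) (x≤y⇒x⊔y≈y (≤-trans x≤a a≤b)))
        (cong (_+ b) (+-comm a x))
      within : a ≤ x → x ≤ b → clamp x + (x ⊓ a) + (x ⊔ b) ≡ x + a + b
      within a≤x x≤b =
        cong₂ _+_ (cong₂ _+_ (trans (cong (_⊓ b) (x≤y⇒y⊔x≈y a≤x)) (x≤y⇒x⊓y≈x x≤b)) (x≤y⇒y⊓x≈x a≤x)) (x≤y⇒x⊔y≈y x≤b)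
      above : a ≤ x → b ≤ x → clamp x + (x ⊓ a) + (x ⊔ b) ≡ x + a + b
      above a≤x b≤x = trans
        (cong₂ _+_ (cong₂ _+_ (trans (cong (_⊓ b) (x≤y⇒y⊔x≈y a≤x)) (x≤y⇒y⊓x≈x b≤x)) (x≤y⇒y⊓x≈x a≤x)) (x≤y⇒y⊔x≈y b≤x))
        (solve 3 (λ x a b → b :+ a :+ x := x :+ a :+ b) refl x a b)

    split : ∀ {s δ} → Cover E s → 0# < δ → p + q ≤ s + δ
    split {s} {δ} (mkCover I ord cov bnd) 0<δ = ≤-by-gap _ (x≤y⇒0≤y-x q≤)
      (solve 3 (λ p q t → p :+ q :+ (t :- p :- q) := t) refl p q (s + δ))
      where
      l  = proj₁ ∘ I
      u  = proj₂ ∘ I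
      ε  = dyadic (half δ)
      0<ε : ∀ i → 0# < ε i
      0<ε = 0<dyadic (0<half 0<δ)

      inner lower upper : ℕ → Interval
      inner i = clamp (l i) - ε i , clamp (u i)
      lower i = (l i ⊓ a) , (u i ⊓ a)
      upper i = (l i ⊔ b) - ε i , (u i ⊔ b)

      x-ε<x : ∀ x i → x - ε i < x
      x-ε<x x i = <-by-gap (ε i) (0<ε i) (solve 2 (λ x e → x :- e :+ e := x) refl x (ε i))

      inner-ord : ∀ i → Ordered (inner i)
      inner-ord i = ≤-trans (<⇒≤ (x-ε<x _ i)) (clamp-mono (ord i))
      lower-ord : ∀ i → Ordered (lower i)
      lower-ord i = ⊓-monoˡ-≤ a (ord i)
      upper-ord : ∀ i → Ordered (upper i)
      upper-ord i = ≤-trans (<⇒≤ (x-ε<x _ i)) (⊔-monoˡ-≤ b (ord i))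

      inner-cov : ∀ x → x ∈ₚ E ∩ₚ [ a , b ⟩ → ∃[ i ] inner i Contains x
      inner-cov x (x∈E , a≤x , x<b) = let (i , l<x , x<u) = cov x x∈E in
        i , <-≤-trans (x-ε<x _ i) (≤-trans (x⊓y≤x _ b) (⊔-lub (<⇒≤ l<x) a≤x)) ,
        ⊓-glb-< (<-≤-trans x<u (x≤x⊔y (u i) a)) x<b

      outer : ℕ → Interval
      outer = interleave lower upper

      outer-cov : ∀ x → x ∈ₚ E ∖ₚ [ a , b ⟩ → ∃[ i ] outer i Contains x
      outer-cov x (x∈E , x∉) with cov x x∈E | a ≤? x
      ... | i , l<x , x<u | no a≰x  = interleave-anyˡ (_Contains x) lower upper i
              (≤-<-trans (x⊓y≤x (l i) a) l<x , ⊓-glb-< x<u (≰⇒> a≰x))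
      ... | i , l<x , x<u | yes a≤x = interleave-anyʳ (_Contains x) lower upper i
              (<-≤-trans (x-ε<x _ i) (⊔-lub (<⇒≤ l<x) (≮⇒≥ λ x<b → x∉ (a≤x , x<b))) , <-≤-trans x<u (x≤x⊔y (u i) b))

      total : ∀ m → prefix (len ∘ inner) m + (prefix (len ∘ lower) m + prefix (len ∘ upper) m) ≤ s + δ
      total m = begin
        prefix (len ∘ inner) m + (prefix (len ∘ lower) m + prefix (len ∘ upper) m)
          ≡⟨ cong (prefix (len ∘ inner) m +_) (prefix-+ _ _ m) ⟨
        prefix (len ∘ inner) m + prefix (λ i → len (lower i) + len (upper i)) m
          ≡⟨ prefix-+ _ _ m ⟨
        prefix (λ i → len (inner i) + (len (lower i) + len (upper i))) m
          ≤⟨ prefix-mono-≤ (λ i → ≤-reflexive (lengths i)) m ⟩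
        prefix (λ i → len (I i) + (ε i + ε i)) m
          ≡⟨ trans (prefix-+ _ _ m) (cong (prefix (len ∘ I) m +_) (prefix-+ _ _ m)) ⟩
        prefix (len ∘ I) m + (prefix ε m + prefix ε m)
          ≤⟨ +-mono-≤ (bnd m) (+-mono-≤ (prefix-dyadic (0<half 0<δ) m) (prefix-dyadic (0<half 0<δ) m)) ⟩
        s + (half δ + half δ)
          ≡⟨ cong (s +_) (half+half δ) ⟩
        s + δ ∎
        where
        lengths : ∀ i → len (inner i) + (len (lower i) + len (upper i)) ≡ len (I i) + (ε i + ε i)
        lengths i = trans
          (solve 7 (λ c c′ d d′ e e′ ε → c′ :- (c :- ε) :+ (d′ :- d :+ (e′ :- (e :- ε))) := c′ :+ d′ :+ e′ :- (c :+ d :+ e) :+ (ε :+ ε)) refl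
            (clamp (l i)) (clamp (u i)) (l i ⊓ a) (u i ⊓ a) (l i ⊔ b) (u i ⊔ b) (ε i))
          (trans (cong₂ (λ x y → x - y + (ε i + ε i)) (pieces (u i)) (pieces (l i)))
            (solve 5 (λ l u a b ε → u :+ a :+ b :- (l :+ a :+ b) :+ (ε :+ ε) := u :- l :+ (ε :+ ε)) refl (l i) (u i) a b (ε i)))

      -- A prefix of the interleaved cover takes different numbers of lower and upper pieces;
      -- extending all three families to a common length only increases the sums.
      inner+outer≤ : ∀ j m → prefix (len ∘ inner) j + prefix (len ∘ outer) m ≤ s + δ
      inner+outer≤ j m with interleave-len lower upper m
      ... | k , n , eq = begin
        prefix (len ∘ inner) j + prefix (len ∘ outer) m
          ≡⟨ cong (prefix (len ∘ inner) j +_) eq ⟩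
        prefix (len ∘ inner) j + (prefix (len ∘ lower) k + prefix (len ∘ upper) n)
          ≤⟨ +-mono-≤ (prefix-monoʳ-≤ (x≤y⇒0≤y-x ∘ inner-ord) (ℕ.≤-trans (ℕ.m≤m+n j k) (ℕ.m≤m+n (j ℕ.+ k) n)))
             (+-mono-≤ (prefix-monoʳ-≤ (x≤y⇒0≤y-x ∘ lower-ord) (ℕ.≤-trans (ℕ.m≤n+m k j) (ℕ.m≤m+n (j ℕ.+ k) n)))
                       (prefix-monoʳ-≤ (x≤y⇒0≤y-x ∘ upper-ord) (ℕ.m≤n+m n (j ℕ.+ k)))) ⟩
        prefix (len ∘ inner) (j ℕ.+ k ℕ.+ n) + (prefix (len ∘ lower) (j ℕ.+ k ℕ.+ n) + prefix (len ∘ upper) (j ℕ.+ k ℕ.+ n))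
          ≤⟨ total (j ℕ.+ k ℕ.+ n) ⟩
        s + δ ∎

      p≤ : ∀ m → p ≤ s + δ - prefix (len ∘ outer) m
      p≤ m = p-lower _ (toCoverBound (mkCover inner inner-ord inner-cov λ j →
        ≤-by-gap _ (x≤y⇒0≤y-x (inner+outer≤ j m))
          (solve 3 (λ x y t → x :+ (t :- (x :+ y)) := t :- y) refl (prefix (len ∘ inner) j) (prefix (len ∘ outer) m) (s + δ))))

      q≤ : q ≤ s + δ - p
      q≤ = q-lower _ (toCoverBound (mkCover outer (interleave-all Ordered lower upper lower-ord upper-ord) outer-cov λ m →
        ≤-by-gap _ (x≤y⇒0≤y-x (p≤ m))
          (solve 3 (λ y p t → y :+ (t :- y :- p) := t :- p) refl (prefix (len ∘ outer) m) p (s + δ))))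

-- Finite sums

∈-allSubsets : ∀ {n} (K : Subset n) → K ∈ˡ allSubsets n
∈-allSubsets []ᵛ             = here refl
∈-allSubsets (outside ∷ᵛ K)  = ∈-++⁺ˡ (∈-map⁺ _ (∈-allSubsets K))
∈-allSubsets (inside ∷ᵛ K)   = ∈-++⁺ʳ _ (∈-map⁺ _ (∈-allSubsets K))

∣p∪q∣≡∣p∣+∣q∣ : ∀ {n} (p q : Subset n) → (∀ {x} → x ∈ p → x ∉ q) → ∣ p ∪ q ∣ ≡ ∣ p ∣ ℕ.+ ∣ q ∣
∣p∪q∣≡∣p∣+∣q∣ []ᵛ []ᵛ disj = refl
∣p∪q∣≡∣p∣+∣q∣ (outside ∷ᵛ p) (outside ∷ᵛ q) disj = ∣p∪q∣≡∣p∣+∣q∣ p q (λ x∈p x∈q → disj (there x∈p) (there x∈q))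
∣p∪q∣≡∣p∣+∣q∣ (outside ∷ᵛ p) (inside ∷ᵛ q)  disj = trans (cong suc (∣p∪q∣≡∣p∣+∣q∣ p q (λ x∈p x∈q → disj (there x∈p) (there x∈q))))
  (sym (ℕ.+-suc ∣ p ∣ ∣ q ∣))
∣p∪q∣≡∣p∣+∣q∣ (inside ∷ᵛ p)  (outside ∷ᵛ q) disj = cong suc (∣p∪q∣≡∣p∣+∣q∣ p q (λ x∈p x∈q → disj (there x∈p) (there x∈q)))
∣p∪q∣≡∣p∣+∣q∣ (inside ∷ᵛ p)  (inside ∷ᵛ q)  disj = contradiction here (disj here)

module _ {n} {P : Fin n → Set} (P? : Decidable P) where

  ∈-tabulate⁺ : ∀ {x} → P x → x ∈ Vec.tabulate (does ∘ P?)
  ∈-tabulate⁺ {x} Px = Vec.lookup⇒[]= x _ (trans (Vec.lookup∘tabulate (does ∘ P?) x) (dec-true (P? x) Px))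

  ∈-tabulate⁻ : ∀ {x} → x ∈ Vec.tabulate (does ∘ P?) → P x
  ∈-tabulate⁻ {x} x∈ with P? x | trans (sym (Vec.lookup∘tabulate (does ∘ P?) x)) (Vec.[]=⇒lookup x∈)
  ... | yes Px | _ = Px

module FiniteSums (R : Reals) where
  open OrderedField R

  private variable
    A B : Set
    P Q : Set

  𝟙 : Dec P → ℝ
  𝟙 P? = if does P? then 1# else 0#

  𝟙-yes : (P? : Dec P) → P → 𝟙 P? ≡ 1#
  𝟙-yes P? p = cong (if_then 1# else 0#) (dec-true P? p)

  𝟙-no : (P? : Dec P) → ¬ P → 𝟙 P? ≡ 0#
  𝟙-no P? ¬p = cong (if_then 1# else 0#) (dec-false P? ¬p)

  0≤𝟙 : (P? : Dec P) → 0# ≤ 𝟙 P?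
  0≤𝟙 (yes _) = 0≤1
  0≤𝟙 (no  _) = ≤-refl

  𝟙≤1 : (P? : Dec P) → 𝟙 P? ≤ 1#
  𝟙≤1 (yes _) = ≤-refl
  𝟙≤1 (no  _) = 0≤1

  𝟙-cong : (P? : Dec P) (Q? : Dec Q) → (P → Q) → (Q → P) → 𝟙 P? ≡ 𝟙 Q?
  𝟙-cong (yes p) Q? f g = sym (𝟙-yes Q? (f p))
  𝟙-cong (no ¬p) Q? f g = sym (𝟙-no Q? (¬p ∘ g))

  𝟙-mono : (P? : Dec P) (Q? : Dec Q) → (P → Q) → 𝟙 P? ≤ 𝟙 Q?
  𝟙-mono (yes p) Q? f = ≤-reflexive (sym (𝟙-yes Q? (f p)))
  𝟙-mono (no ¬p) Q? f = 0≤𝟙 Q?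

  𝟙-× : (P? : Dec P) (Q? : Dec Q) → 𝟙 (P? ×-dec Q?) ≡ 𝟙 P? * 𝟙 Q?
  𝟙-× (yes _) Q? = sym (*-identityˡ (𝟙 Q?))
  𝟙-× (no  _) Q? = sym (zeroˡ (𝟙 Q?))

  𝟙-¬ : (P? : Dec P) → 𝟙 P? + 𝟙 (¬? P?) ≡ 1#
  𝟙-¬ (yes _) = +-identityʳ 1#
  𝟙-¬ (no  _) = +-identityˡ 1#

  𝟙*-yes : (P? : Dec P) → P → ∀ x → 𝟙 P? * x ≡ x
  𝟙*-yes P? p x = trans (cong (_* x) (𝟙-yes P? p)) (*-identityˡ x)

  𝟙*-no : (P? : Dec P) → ¬ P → ∀ x → 𝟙 P? * x ≡ 0#
  𝟙*-no P? ¬p x = trans (cong (_* x) (𝟙-no P? ¬p)) (zeroˡ x)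

  𝟙*-cong : (P? : Dec P) → ∀ {x y} → (P → x ≡ y) → 𝟙 P? * x ≡ 𝟙 P? * y
  𝟙*-cong (yes p) x≡y = cong (1# *_) (x≡y p)
  𝟙*-cong (no  _) _   = trans (zeroˡ _) (sym (zeroˡ _))

  𝟙*-mono : (P? : Dec P) → ∀ {x y} → (P → x ≤ y) → 𝟙 P? * x ≤ 𝟙 P? * y
  𝟙*-mono (yes p) x≤y = *-monoʳ-≤ 0≤1 (x≤y p)
  𝟙*-mono (no  _) _   = ≤-reflexive (trans (zeroˡ _) (sym (zeroˡ _)))

  0≤𝟙* : (P? : Dec P) → ∀ {x} → 0# ≤ x → 0# ≤ 𝟙 P? * x
  0≤𝟙* P? = 0≤* (0≤𝟙 P?)

  𝟙*≤ : (P? : Dec P) → ∀ {x} → 0# ≤ x → 𝟙 P? * x ≤ x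
  𝟙*≤ P? {x} 0≤x = subst (𝟙 P? * x ≤_) (*-identityˡ x) (*-monoˡ-≤ 0≤x (𝟙≤1 P?))

  sum-cong : ∀ (xs : List A) {g h} → (∀ x → g x ≡ h x) → sumOver xs g ≡ sumOver xs h
  sum-cong []       g≡h = refl
  sum-cong (x ∷ xs) g≡h = cong₂ _+_ (g≡h x) (sum-cong xs g≡h)

  sum-mono : ∀ (xs : List A) {g h} → (∀ x → g x ≤ h x) → sumOver xs g ≤ sumOver xs h
  sum-mono []       g≤h = ≤-refl
  sum-mono (x ∷ xs) g≤h = +-mono-≤ (g≤h x) (sum-mono xs g≤h)

  0≤sum : ∀ (xs : List A) {g} → (∀ x → 0# ≤ g x) → 0# ≤ sumOver xs g
  0≤sum []       0≤g = ≤-refl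
  0≤sum (x ∷ xs) 0≤g = 0≤+ (0≤g x) (0≤sum xs 0≤g)

  sum-0 : ∀ (xs : List A) → sumOver xs (λ _ → 0#) ≡ 0#
  sum-0 []       = refl
  sum-0 (x ∷ xs) = trans (+-identityˡ _) (sum-0 xs)

  sum-+ : ∀ (xs : List A) g h → sumOver xs (λ x → g x + h x) ≡ sumOver xs g + sumOver xs h
  sum-+ []       g h = sym (+-identityʳ 0#)
  sum-+ (x ∷ xs) g h = trans (cong (g x + h x +_) (sum-+ xs g h))
    (solve 4 (λ a b c d → a :+ b :+ (c :+ d) := a :+ c :+ (b :+ d)) refl (g x) (h x) (sumOver xs g) (sumOver xs h))

  sum-*ˡ : ∀ (xs : List A) c g → sumOver xs (λ x → c * g x) ≡ c * sumOver xs g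
  sum-*ˡ []       c g = sym (zeroʳ c)
  sum-*ˡ (x ∷ xs) c g = trans (cong (c * g x +_) (sum-*ˡ xs c g)) (sym (distribˡ c (g x) (sumOver xs g)))

  sum-*ʳ : ∀ (xs : List A) c g → sumOver xs (λ x → g x * c) ≡ sumOver xs g * c
  sum-*ʳ xs c g = trans (sum-cong xs (λ x → *-comm (g x) c)) (trans (sum-*ˡ xs c g) (*-comm c _))

  sum-const : ∀ (xs : List A) c → sumOver xs (λ _ → c) ≡ fromℕ (length xs) * c
  sum-const []       c = sym (zeroˡ c)
  sum-const (x ∷ xs) c = trans (cong (c +_) (sum-const xs c))
    (solve 2 (λ c n → c :+ n :* c := (:1 :+ n) :* c) refl c (fromℕ (length xs)))

  sum-++ : ∀ (xs ys : List A) g → sumOver (xs ++ ys) g ≡ sumOver xs g + sumOver ys g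
  sum-++ []       ys g = sym (+-identityˡ _)
  sum-++ (x ∷ xs) ys g = trans (cong (g x +_) (sum-++ xs ys g)) (sym (+-assoc _ _ _))

  sum-map : ∀ (f : A → B) xs g → sumOver (List.map f xs) g ≡ sumOver xs (g ∘ f)
  sum-map f []       g = refl
  sum-map f (x ∷ xs) g = cong (g (f x) +_) (sum-map f xs g)

  sum-swap : ∀ (xs : List A) (ys : List B) (g : A → B → ℝ) →
    sumOver xs (λ x → sumOver ys (g x)) ≡ sumOver ys (λ y → sumOver xs (λ x → g x y))
  sum-swap []       ys g = sym (sum-0 ys)
  sum-swap (x ∷ xs) ys g = trans (cong (sumOver ys (g x) +_) (sum-swap xs ys g)) (sym (sum-+ ys _ _))

  sum-filter : ∀ {P : A → Set} (P? : Decidable P) xs g → sumOver (filter P? xs) g ≡ sumOver xs (λ x → 𝟙 (P? x) * g x)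
  sum-filter P? []       g = refl
  sum-filter P? (x ∷ xs) g with P? x
  ... | yes _ = cong₂ _+_ (sym (*-identityˡ (g x))) (sum-filter P? xs g)
  ... | no  _ = trans (sum-filter P? xs g) (sym (trans (cong (_+ rest) (zeroˡ (g x))) (+-identityˡ _)))
    where rest = sumOver xs (λ x → 𝟙 (P? x) * g x)

  sum-product : ∀ (xs : List A) (ys : List B) g →
    sumOver (cartesianProduct xs ys) g ≡ sumOver xs (λ x → sumOver ys (λ y → g (x , y)))
  sum-product []       ys g = refl
  sum-product (x ∷ xs) ys g = trans (sum-++ (List.map (x ,_) ys) (cartesianProduct xs ys) g)
    (cong₂ _+_ (sum-map (x ,_) ys g) (sum-product xs ys g))

  fromℕ-length : ∀ (xs : List A) → fromℕ (length xs) ≡ sumOver xs (λ _ → 1#)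
  fromℕ-length xs = sym (trans (sum-const xs 1#) (*-identityʳ _))

  term≤sum : ∀ {x} {xs : List A} {g} → (∀ y → 0# ≤ g y) → x ∈ˡ xs → g x ≤ sumOver xs g
  term≤sum {xs = y ∷ xs} {g} 0≤g (here refl) = ≤-by-gap (sumOver xs g) (0≤sum xs 0≤g) refl
  term≤sum {xs = y ∷ xs} {g} 0≤g (there x∈xs) = ≤-trans (term≤sum 0≤g x∈xs) (≤-by-gap (g y) (0≤g y) (+-comm _ _))

  sumᵛ : ∀ {n} → (Fin n → ℝ) → ℝ
  sumᵛ {n} = sumOver (allFin n)

  sumˢ : ∀ {n} → (Subset n → ℝ) → ℝ
  sumˢ {n} = sumOver (allSubsets n)

  sumᵛ-suc : ∀ {n} (g : Fin (suc n) → ℝ) → sumᵛ g ≡ g zero + sumᵛ (g ∘ suc)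
  sumᵛ-suc {n} g = cong (g zero +_) (trans (cong (λ xs → sumOver xs g) (sym (List.map-tabulate id suc))) (sum-map suc (allFin n) g))

  sumˢ-suc : ∀ {n} (g : Subset (suc n) → ℝ) → sumˢ g ≡ sumˢ (g ∘ (outside ∷ᵛ_)) + sumˢ (g ∘ (inside ∷ᵛ_))
  sumˢ-suc {n} g = trans (sum-++ (List.map (outside ∷ᵛ_) (allSubsets n)) _ g)
    (cong₂ _+_ (sum-map (outside ∷ᵛ_) (allSubsets n) g) (sum-map (inside ∷ᵛ_) (allSubsets n) g))

  fromℕ-∣∣ : ∀ {n} (K : Subset n) → fromℕ ∣ K ∣ ≡ sumᵛ (λ u → 𝟙 (u ∈? K))
  fromℕ-∣∣ []ᵛ = refl
  fromℕ-∣∣ (s ∷ᵛ K) = trans (head s) (sym (trans (sumᵛ-suc (λ u → 𝟙 (u ∈? s ∷ᵛ K)))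
    (cong (𝟙 (zero ∈? s ∷ᵛ K) +_) (sum-cong (allFin _) λ u → 𝟙-cong (suc u ∈? s ∷ᵛ K) (u ∈? K) drop-there there))))
    where
    head : ∀ s → fromℕ ∣ s ∷ᵛ K ∣ ≡ 𝟙 (zero ∈? s ∷ᵛ K) + sumᵛ (λ u → 𝟙 (u ∈? K))
    head outside = trans (fromℕ-∣∣ K) (sym (+-identityˡ _))
    head inside  = cong (1# +_) (fromℕ-∣∣ K)

  -- The binomial theorem before grouping by size: each element of F is left out, contributing 1, or
  -- taken, contributing x.
  sum-⊆-^ : ∀ {n} (F : Subset n) x → sumˢ (λ K → 𝟙 (K ⊆? F) * x ^ ∣ K ∣) ≡ (1# + x) ^ ∣ F ∣
  sum-⊆-^ []ᵛ x = solve 0 (:1 :* :1 :+ :0 := :1) refl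
  sum-⊆-^ {suc n} (s ∷ᵛ F) x = trans (sumˢ-suc (λ K → 𝟙 (K ⊆? (s ∷ᵛ F)) * x ^ ∣ K ∣)) (trans
    (cong₂ _+_
      (trans (sum-cong (allSubsets _) λ K → cong (_* x ^ ∣ K ∣) (𝟙-cong (outside ∷ᵛ K ⊆? s ∷ᵛ F) (K ⊆? F) drop-∷-⊆ out⊆)) (sum-⊆-^ F x))
      refl)
    (rest s))
    where
    rest : ∀ s → (1# + x) ^ ∣ F ∣ + sumˢ (λ K → 𝟙 (inside ∷ᵛ K ⊆? s ∷ᵛ F) * x ^ suc ∣ K ∣) ≡ (1# + x) ^ ∣ s ∷ᵛ F ∣
    rest outside = trans (cong ((1# + x) ^ ∣ F ∣ +_)
      (trans (sum-cong (allSubsets _) λ K → 𝟙*-no (inside ∷ᵛ K ⊆? outside ∷ᵛ F) (λ K⊆F → case K⊆F here of λ ()) (x ^ suc ∣ K ∣)) (sum-0 (allSubsets n))))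
      (+-identityʳ _)
    rest inside = trans (cong ((1# + x) ^ ∣ F ∣ +_)
      (trans (sum-cong (allSubsets _) λ K → trans (cong (_* x ^ suc ∣ K ∣) (𝟙-cong (inside ∷ᵛ K ⊆? inside ∷ᵛ F) (K ⊆? F) drop-∷-⊆ in⊆in))
               (solve 3 (λ i x p → i :* (x :* p) := x :* (i :* p)) refl (𝟙 (K ⊆? F)) x (x ^ ∣ K ∣)))
        (trans (sum-*ˡ (allSubsets _) x (λ K → 𝟙 (K ⊆? F) * x ^ ∣ K ∣)) (cong (x *_) (sum-⊆-^ F x)))))
      (solve 2 (λ x p → p :+ x :* p := (:1 :+ x) :* p) refl x ((1# + x) ^ ∣ F ∣))

  -- K ↦ K ∪ ⁅ u ⁆ is a bijection from the sets without u onto the sets with u.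
  sum-insert : ∀ {n} (u : Fin n) (g : Subset n → ℝ) →
    sumˢ (λ K → 𝟙 (u ∈? K) * g K) ≡ sumˢ (λ K → 𝟙 (¬? (u ∈? K)) * g (K ∪ ⁅ u ⁆))
  sum-insert {suc n} zero g = begin
    sumˢ (λ K → 𝟙 (zero ∈? K) * g K)
      ≡⟨ sumˢ-suc (λ K → 𝟙 (zero ∈? K) * g K) ⟩
    sumˢ (λ K → 0# * g (outside ∷ᵛ K)) + sumˢ (λ K → 1# * g (inside ∷ᵛ K))
      ≡⟨ +-comm _ _ ⟩
    sumˢ (λ K → 1# * g (inside ∷ᵛ K)) + sumˢ (λ K → 0# * g (outside ∷ᵛ K))
      ≡⟨ cong₂ _+_ (sum-cong (allSubsets n) (λ K → cong (λ K′ → 1# * g (inside ∷ᵛ K′)) (sym (∪-identityʳ K))))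
                   (sum-cong (allSubsets n) (λ K → trans (zeroˡ _) (sym (zeroˡ _)))) ⟩
    sumˢ (λ K → 1# * g ((outside ∷ᵛ K) ∪ ⁅ zero ⁆)) + sumˢ (λ K → 0# * g ((inside ∷ᵛ K) ∪ ⁅ zero ⁆))
      ≡⟨ sumˢ-suc (λ K → 𝟙 (¬? (zero ∈? K)) * g (K ∪ ⁅ zero ⁆)) ⟨
    sumˢ (λ K → 𝟙 (¬? (zero ∈? K)) * g (K ∪ ⁅ zero ⁆)) ∎
    where open ≡-Reasoning
  sum-insert {suc n} (suc u) g = begin
    sumˢ (λ K → 𝟙 (suc u ∈? K) * g K)
      ≡⟨ sumˢ-suc (λ K → 𝟙 (suc u ∈? K) * g K) ⟩
    sumˢ (λ K → 𝟙 (suc u ∈? outside ∷ᵛ K) * g (outside ∷ᵛ K)) + sumˢ (λ K → 𝟙 (suc u ∈? inside ∷ᵛ K) * g (inside ∷ᵛ K))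
      ≡⟨ cong₂ _+_ (half-sum outside (g ∘ (outside ∷ᵛ_))) (half-sum inside (g ∘ (inside ∷ᵛ_))) ⟩
    sumˢ (λ K → 𝟙 (¬? (suc u ∈? outside ∷ᵛ K)) * g (outside ∷ᵛ (K ∪ ⁅ u ⁆))) +
    sumˢ (λ K → 𝟙 (¬? (suc u ∈? inside ∷ᵛ K)) * g (inside ∷ᵛ (K ∪ ⁅ u ⁆)))
      ≡⟨ sumˢ-suc (λ K → 𝟙 (¬? (suc u ∈? K)) * g (K ∪ ⁅ suc u ⁆)) ⟨
    sumˢ (λ K → 𝟙 (¬? (suc u ∈? K)) * g (K ∪ ⁅ suc u ⁆)) ∎
    where
    open ≡-Reasoning
    half-sum : ∀ s h → sumˢ (λ K → 𝟙 (suc u ∈? s ∷ᵛ K) * h K) ≡ sumˢ (λ K → 𝟙 (¬? (suc u ∈? s ∷ᵛ K)) * h (K ∪ ⁅ u ⁆))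
    half-sum s h = trans
      (sum-cong (allSubsets n) λ K → cong (_* h K) (𝟙-cong (suc u ∈? s ∷ᵛ K) (u ∈? K) drop-there there))
      (trans (sum-insert u h)
        (sum-cong (allSubsets n) λ K → cong (_* h (K ∪ ⁅ u ⁆)) (𝟙-cong (¬? (u ∈? K)) (¬? (suc u ∈? s ∷ᵛ K)) (_∘ drop-there) (_∘ there))))

  -- Every subset is J ∪ K for exactly one J outside A and one K inside A.
  sum-split : ∀ {n} (A : Subset n) (g : Subset n → ℝ) →
    sumˢ g ≡ sumˢ (λ J → 𝟙 (J ⊆? ∁ A) * sumˢ (λ K → 𝟙 (K ⊆? A) * g (J ∪ K)))
  sum-split []ᵛ g = solve 1 (λ x → x :+ :0 := :1 :* (:1 :* x :+ :0) :+ :0) refl (g []ᵛ)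
  sum-split {suc n} (s ∷ᵛ A) g = begin
    sumˢ g
      ≡⟨ sumˢ-suc g ⟩
    sumˢ (g ∘ (outside ∷ᵛ_)) + sumˢ (g ∘ (inside ∷ᵛ_))
      ≡⟨ cong₂ _+_ (sum-split A _) (sum-split A _) ⟩
    sumˢ (outer (g ∘ (outside ∷ᵛ_))) + sumˢ (outer (g ∘ (inside ∷ᵛ_)))
      ≡⟨ sides s ⟩
    sumˢ (λ J → 𝟙 (outside ∷ᵛ J ⊆? ∁ (s ∷ᵛ A)) * inner s outside J) + sumˢ (λ J → 𝟙 (inside ∷ᵛ J ⊆? ∁ (s ∷ᵛ A)) * inner s inside J)
      ≡⟨ sumˢ-suc (λ J → 𝟙 (J ⊆? ∁ (s ∷ᵛ A)) * sumˢ (λ K → 𝟙 (K ⊆? s ∷ᵛ A) * g (J ∪ K))) ⟨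
    sumˢ (λ J → 𝟙 (J ⊆? ∁ (s ∷ᵛ A)) * sumˢ (λ K → 𝟙 (K ⊆? s ∷ᵛ A) * g (J ∪ K))) ∎
    where
    open ≡-Reasoning
    outer : (Subset n → ℝ) → Subset n → ℝ
    outer h J = 𝟙 (J ⊆? ∁ A) * sumˢ (λ K → 𝟙 (K ⊆? A) * h (J ∪ K))
    inner : Subset.Side → Subset.Side → Subset n → ℝ
    inner s t J = sumˢ (λ K → 𝟙 (K ⊆? s ∷ᵛ A) * g ((t ∷ᵛ J) ∪ K))

    𝟙-out : ∀ {t} (K B : Subset n) → 𝟙 (outside ∷ᵛ K ⊆? t ∷ᵛ B) ≡ 𝟙 (K ⊆? B)
    𝟙-out {t} K B = 𝟙-cong (outside ∷ᵛ K ⊆? t ∷ᵛ B) (K ⊆? B) drop-∷-⊆ out⊆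
    𝟙-in : ∀ (K B : Subset n) → 𝟙 (inside ∷ᵛ K ⊆? inside ∷ᵛ B) ≡ 𝟙 (K ⊆? B)
    𝟙-in K B = 𝟙-cong (inside ∷ᵛ K ⊆? inside ∷ᵛ B) (K ⊆? B) drop-∷-⊆ in⊆in
    𝟙-in-out : ∀ (K B : Subset n) x → 𝟙 (inside ∷ᵛ K ⊆? outside ∷ᵛ B) * x ≡ 0#
    𝟙-in-out K B = 𝟙*-no (inside ∷ᵛ K ⊆? outside ∷ᵛ B) (λ K⊆B → case K⊆B here of λ ())

    inner-outside : ∀ t J → inner outside t J ≡ sumˢ (λ K → 𝟙 (K ⊆? A) * g ((t ∷ᵛ J) ∪ (outside ∷ᵛ K)))
    inner-outside t J = trans (sumˢ-suc (λ K → 𝟙 (K ⊆? outside ∷ᵛ A) * g ((t ∷ᵛ J) ∪ K))) (trans (cong₂ _+_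
      (sum-cong (allSubsets n) λ K → cong (_* g ((t ∷ᵛ J) ∪ (outside ∷ᵛ K))) (𝟙-out {outside} K A))
      (trans (sum-cong (allSubsets n) λ K → 𝟙-in-out K A (g ((t ∷ᵛ J) ∪ (inside ∷ᵛ K)))) (sum-0 (allSubsets n)))) (+-identityʳ _))

    inner-inside : ∀ J → inner inside outside J ≡
      sumˢ (λ K → 𝟙 (K ⊆? A) * g (outside ∷ᵛ (J ∪ K))) + sumˢ (λ K → 𝟙 (K ⊆? A) * g (inside ∷ᵛ (J ∪ K)))
    inner-inside J = trans (sumˢ-suc (λ K → 𝟙 (K ⊆? inside ∷ᵛ A) * g ((outside ∷ᵛ J) ∪ K))) (cong₂ _+_
      (sum-cong (allSubsets n) λ K → cong (_* g (outside ∷ᵛ (J ∪ K))) (𝟙-out {inside} K A))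
      (sum-cong (allSubsets n) λ K → cong (_* g (inside ∷ᵛ (J ∪ K))) (𝟙-in K A)))

    sides : ∀ s → sumˢ (outer (g ∘ (outside ∷ᵛ_))) + sumˢ (outer (g ∘ (inside ∷ᵛ_))) ≡
      sumˢ (λ J → 𝟙 (outside ∷ᵛ J ⊆? ∁ (s ∷ᵛ A)) * inner s outside J) + sumˢ (λ J → 𝟙 (inside ∷ᵛ J ⊆? ∁ (s ∷ᵛ A)) * inner s inside J)
    sides outside = cong₂ _+_
      (sum-cong (allSubsets n) λ J → sym (cong₂ _*_ (𝟙-out {inside} J (∁ A)) (inner-outside outside J)))
      (sum-cong (allSubsets n) λ J → sym (cong₂ _*_ (𝟙-in J (∁ A)) (inner-outside inside J)))
    sides inside = begin
      sumˢ (outer (g ∘ (outside ∷ᵛ_))) + sumˢ (outer (g ∘ (inside ∷ᵛ_)))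
        ≡⟨ sum-+ (allSubsets n) (outer (g ∘ (outside ∷ᵛ_))) (outer (g ∘ (inside ∷ᵛ_))) ⟨
      sumˢ (λ J → outer (g ∘ (outside ∷ᵛ_)) J + outer (g ∘ (inside ∷ᵛ_)) J)
        ≡⟨ sum-cong (allSubsets n) (λ J → sym (trans (cong₂ _*_ (𝟙-out {outside} J (∁ A)) (inner-inside J)) (distribˡ (𝟙 (J ⊆? ∁ A)) _ _))) ⟩
      sumˢ (λ J → 𝟙 (outside ∷ᵛ J ⊆? ∁ (inside ∷ᵛ A)) * inner inside outside J)
        ≡⟨ +-identityʳ _ ⟨
      sumˢ (λ J → 𝟙 (outside ∷ᵛ J ⊆? ∁ (inside ∷ᵛ A)) * inner inside outside J) + 0#
        ≡⟨ cong (sumˢ (λ J → 𝟙 (outside ∷ᵛ J ⊆? ∁ (inside ∷ᵛ A)) * inner inside outside J) +_)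
             (trans (sum-cong (allSubsets n) λ J → 𝟙-in-out J (∁ A) (inner inside inside J)) (sum-0 (allSubsets n))) ⟨
      sumˢ (λ J → 𝟙 (outside ∷ᵛ J ⊆? ∁ (inside ∷ᵛ A)) * inner inside outside J) + sumˢ (λ J → 𝟙 (inside ∷ᵛ J ⊆? ∁ (inside ∷ᵛ A)) * inner inside inside J) ∎

-- The hard-core model

module HardCore (R : Reals) {n} (G : Graph n) (λ₀ : Reals.ℝ R) (0<λ₀ : Reals._<_ R (Reals.0# R) λ₀) where
  open OrderedField R
  open FiniteSums R
  open Graph G

  private
    0≤λ₀ = <⇒≤ 0<λ₀
    subsets = allSubsets n
    vertices = allFin n

  N : Fin n → Subset n
  N = neighbourhood G

  Adj⇒∈N : ∀ {u v} → Adj v u → u ∈ N v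
  Adj⇒∈N {v = v} = ∈-tabulate⁺ (adj? v)

  ∈N⇒Adj : ∀ {u v} → u ∈ N v → Adj v u
  ∈N⇒Adj {v = v} = ∈-tabulate⁻ (adj? v)

  u∉Nu : ∀ {u} → u ∉ N u
  u∉Nu {u} u∈Nu = irrefl u (∈N⇒Adj u∈Nu)

  admissible? : ∀ F K → Dec (K ⊆ F × Independent G K)
  admissible? F K = K ⊆? F ×-dec independent? G K

  weight : Subset n → Subset n → ℝ
  weight F K = 𝟙 (admissible? F K) * λ₀ ^ ∣ K ∣

  Z : Subset n → ℝ
  Z F = sumˢ (weight F)

  -- Not probabilities: both have to be divided by the partition function Z F.
  occupied : Subset n → Fin n → ℝ
  occupied F u = sumˢ (λ K → 𝟙 (u ∈? K) * weight F K)

  uncovered : Subset n → Fin n → ℝ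
  uncovered F u = sumˢ (λ K → 𝟙 (K ⊆? ∁ (N u)) * weight F K)

  0≤weight : ∀ F K → 0# ≤ weight F K
  0≤weight F K = 0≤𝟙* (admissible? F K) (0≤^ ∣ K ∣ 0≤λ₀)

  -- The empty set is always admissible and alone contributes λ₀ ^ 0 = 1.
  1≤Σ : ∀ F {P : Subset n → Set} (P? : ∀ K → Dec (P K)) → P Subset.⊥ → 1# ≤ sumˢ (λ K → 𝟙 (P? K) * weight F K)
  1≤Σ F P? P⊥ = subst (_≤ sumˢ (λ K → 𝟙 (P? K) * weight F K)) at-⊥
    (term≤sum (λ K → 0≤𝟙* (P? K) (0≤weight F K)) (∈-allSubsets Subset.⊥))
    where
    at-⊥ : 𝟙 (P? Subset.⊥) * weight F Subset.⊥ ≡ 1#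
    at-⊥ = trans (𝟙*-yes (P? _) P⊥ _) (trans
      (𝟙*-yes (admissible? F Subset.⊥) (⊆-min F , λ _ _ u∈⊥ → contradiction u∈⊥ ∉⊥) _)
      (cong (λ₀ ^_) (∣⊥∣≡0 n)))

  uncovered≤Z : ∀ F u → uncovered F u ≤ Z F
  uncovered≤Z F u = sum-mono subsets λ K → 𝟙*≤ (K ⊆? ∁ (N u)) (0≤weight F K)

  0<uncovered : ∀ F u → 0# < uncovered F u
  0<uncovered F u = <-≤-trans 0<1 (1≤Σ F (_⊆? ∁ (N u)) (⊆-min (∁ (N u))))

  0<Z : ∀ F → 0# < Z F
  0<Z F = <-≤-trans 0<1 (≤-trans (1≤Σ F (λ K → K ⊆? K) ⊆-refl) (sum-mono subsets λ K → 𝟙*≤ (K ⊆? K) (0≤weight F K)))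

  -- Forgetting the edges only adds terms, and the edgeless partition function is a binomial sum.
  Z≤ : ∀ F → Z F ≤ (1# + λ₀) ^ ∣ F ∣
  Z≤ F = subst (Z F ≤_) (sum-⊆-^ F λ₀) (sum-mono subsets λ K →
    *-monoˡ-≤ (0≤^ ∣ K ∣ 0≤λ₀) (𝟙-mono (admissible? F K) (K ⊆? F) proj₁))

  0≤occupied : ∀ F u → 0# ≤ occupied F u
  0≤occupied F u = 0≤sum subsets λ K → 0≤𝟙* (u ∈? K) (0≤weight F K)

  occupied-∉ : ∀ {F u} → u ∉ F → occupied F u ≡ 0#
  occupied-∉ {F} {u} u∉F = trans (sum-cong subsets λ K → trans (𝟙*-cong (u ∈? K) λ u∈K →
    𝟙*-no (admissible? F K) (λ (K⊆F , _) → u∉F (K⊆F u∈K)) (λ₀ ^ ∣ K ∣)) (zeroʳ _)) (sum-0 subsets)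

  weight-insert : ∀ {F u K} → u ∈ F → u ∉ K → weight F (K ∪ ⁅ u ⁆) ≡ λ₀ * (𝟙 (K ⊆? ∁ (N u)) * weight F K)
  weight-insert {F} {u} {K} u∈F u∉K = begin
    𝟙 (admissible? F K∪u) * λ₀ ^ ∣ K∪u ∣
      ≡⟨ cong₂ _*_ (trans (𝟙-cong (admissible? F K∪u) (K ⊆? ∁ (N u) ×-dec admissible? F K) to from) (𝟙-× (K ⊆? ∁ (N u)) (admissible? F K)))
                   (cong (λ₀ ^_) size) ⟩
    𝟙 (K ⊆? ∁ (N u)) * 𝟙 (admissible? F K) * (λ₀ * λ₀ ^ ∣ K ∣)
      ≡⟨ solve 4 (λ i j l p → i :* j :* (l :* p) := l :* (i :* (j :* p))) refl
           (𝟙 (K ⊆? ∁ (N u))) (𝟙 (admissible? F K)) λ₀ (λ₀ ^ ∣ K ∣) ⟩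
    λ₀ * (𝟙 (K ⊆? ∁ (N u)) * weight F K) ∎
    where
    open ≡-Reasoning
    K∪u = K ∪ ⁅ u ⁆
    K⊆K∪u : K ⊆ K∪u
    K⊆K∪u = p⊆p∪q ⁅ u ⁆
    u∈K∪u : u ∈ K∪u
    u∈K∪u = q⊆p∪q K ⁅ u ⁆ (x∈⁅x⁆ u)
    size : ∣ K∪u ∣ ≡ suc ∣ K ∣
    size = trans (∣p∪q∣≡∣p∣+∣q∣ K ⁅ u ⁆ (λ x∈K x∈⁅u⁆ → u∉K (subst (_∈ K) (x∈⁅y⁆⇒x≡y u x∈⁅u⁆) x∈K)))
      (trans (cong (∣ K ∣ ℕ.+_) (∣⁅x⁆∣≡1 u)) (ℕ.+-comm ∣ K ∣ 1))
    to : K∪u ⊆ F × Independent G K∪u → K ⊆ ∁ (N u) × K ⊆ F × Independent G K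
    to (K∪u⊆F , indep) =
        (λ x∈K → x∉p⇒x∈∁p λ x∈Nu → indep _ _ u∈K∪u (K⊆K∪u x∈K) (∈N⇒Adj x∈Nu))
      , K∪u⊆F ∘ K⊆K∪u
      , λ x y x∈K y∈K → indep x y (K⊆K∪u x∈K) (K⊆K∪u y∈K)
    from : K ⊆ ∁ (N u) × K ⊆ F × Independent G K → K∪u ⊆ F × Independent G K∪u
    from (K⊆∁N , K⊆F , indep) =
        (λ x∈ → [ K⊆F , (λ x∈⁅u⁆ → subst (_∈ F) (sym (x∈⁅y⁆⇒x≡y u x∈⁅u⁆)) u∈F) ]′ (x∈p∪q⁻ K ⁅ u ⁆ x∈))
      , λ x y x∈ y∈ → independent (x∈p∪q⁻ K ⁅ u ⁆ x∈) (x∈p∪q⁻ K ⁅ u ⁆ y∈)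
      where
      ¬Adj-u : ∀ {x} → x ∈ K → ¬ Adj u x
      ¬Adj-u x∈K adj = x∈∁p⇒x∉p (K⊆∁N x∈K) (Adj⇒∈N adj)
      independent : ∀ {x y} → x ∈ K ⊎ x ∈ ⁅ u ⁆ → y ∈ K ⊎ y ∈ ⁅ u ⁆ → ¬ Adj x y
      independent (inj₁ x∈K) (inj₁ y∈K) = indep _ _ x∈K y∈K
      independent (inj₁ x∈K) (inj₂ y∈u) rewrite x∈⁅y⁆⇒x≡y u y∈u = ¬Adj-u x∈K ∘ symm
      independent (inj₂ x∈u) (inj₁ y∈K) rewrite x∈⁅y⁆⇒x≡y u x∈u = ¬Adj-u y∈K
      independent (inj₂ x∈u) (inj₂ y∈u) rewrite x∈⁅y⁆⇒x≡y u x∈u | x∈⁅y⁆⇒x≡y u y∈u = irrefl u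

  -- K ↦ K ∪ ⁅ u ⁆ matches the independent sets avoiding N u and u with those containing u.
  occupied-uncovered : ∀ {F u} → u ∈ F → (1# + λ₀) * occupied F u ≡ λ₀ * uncovered F u
  occupied-uncovered {F} {u} u∈F = begin
    (1# + λ₀) * occupied F u
      ≡⟨ solve 2 (λ l o → (:1 :+ l) :* o := o :+ l :* o) refl λ₀ (occupied F u) ⟩
    occupied F u + λ₀ * occupied F u
      ≡⟨ cong (_+ λ₀ * occupied F u) insertion ⟩
    λ₀ * absent + λ₀ * occupied F u
      ≡⟨ solve 3 (λ l o a → l :* a :+ l :* o := l :* (o :+ a)) refl λ₀ (occupied F u) absent ⟩
    λ₀ * (occupied F u + absent)
      ≡⟨ cong (λ₀ *_) (sum-+ subsets (λ K → 𝟙 (u ∈? K) * weight F K) (λ K → 𝟙 (¬? (u ∈? K)) * w K)) ⟨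
    λ₀ * sumˢ (λ K → 𝟙 (u ∈? K) * weight F K + 𝟙 (¬? (u ∈? K)) * w K)
      ≡⟨ cong (λ₀ *_) (sum-cong subsets λ K → trans (cong (_+ 𝟙 (¬? (u ∈? K)) * w K) (𝟙*-cong (u ∈? K) (present K)))
           (trans (sym (distribʳ (w K) _ _)) (trans (cong (_* w K) (𝟙-¬ (u ∈? K))) (*-identityˡ _)))) ⟩
    λ₀ * uncovered F u ∎
    where
    open ≡-Reasoning
    w : Subset n → ℝ
    w K = 𝟙 (K ⊆? ∁ (N u)) * weight F K
    absent = sumˢ (λ K → 𝟙 (¬? (u ∈? K)) * w K)
    insertion : occupied F u ≡ λ₀ * absent
    insertion = trans (sum-insert u (weight F)) (trans
      (sum-cong subsets λ K → trans (𝟙*-cong (¬? (u ∈? K)) (weight-insert u∈F))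
        (solve 3 (λ i l x → i :* (l :* x) := l :* (i :* x)) refl (𝟙 (¬? (u ∈? K))) λ₀ (w K)))
      (sum-*ˡ subsets λ₀ (λ K → 𝟙 (¬? (u ∈? K)) * w K)))
    present : ∀ K → u ∈ K → weight F K ≡ w K
    present K u∈K = trans (sym (trans (cong (_* λ₀ ^ ∣ K ∣) (sym (𝟙-× (K ⊆? ∁ (N u)) (admissible? F K))))
        (cong (_* λ₀ ^ ∣ K ∣) (𝟙-cong (K ⊆? ∁ (N u) ×-dec admissible? F K) (admissible? F K) proj₂ λ (K⊆F , indep) →
          (λ x∈K → x∉p⇒x∈∁p λ x∈Nu → indep _ _ u∈K x∈K (∈N⇒Adj x∈Nu)) , K⊆F , indep))))
      (*-assoc (𝟙 (K ⊆? ∁ (N u))) (𝟙 (admissible? F K)) (λ₀ ^ ∣ K ∣))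

  0<occupied : ∀ {F u} → u ∈ F → 0# < occupied F u
  0<occupied {F} {u} u∈F = ≰⇒> λ occ≤0 → <⇒≱ (0<* 0<λ₀ (0<uncovered F u)) (subst₂ _≤_ (occupied-uncovered u∈F) (zeroʳ (1# + λ₀))
    (*-monoʳ-≤ (0≤+ 0≤1 0≤λ₀) occ≤0))

  occupied≤ : ∀ F u → occupied F u ≤ 𝟙 (u ∈? F) * (λ₀ * Z F)
  occupied≤ F u with u ∈? F
  ... | no  u∉F = ≤-reflexive (trans (occupied-∉ u∉F) (sym (zeroˡ _)))
  ... | yes u∈F = begin
    occupied F u              ≤⟨ ≤-by-gap (λ₀ * occupied F u) (0≤* 0≤λ₀ (0≤occupied F u))
                                   (solve 2 (λ l o → o :+ l :* o := (:1 :+ l) :* o) refl λ₀ (occupied F u)) ⟩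
    (1# + λ₀) * occupied F u  ≡⟨ occupied-uncovered u∈F ⟩
    λ₀ * uncovered F u        ≤⟨ *-monoʳ-≤ 0≤λ₀ (uncovered≤Z F u) ⟩
    λ₀ * Z F                  ≡⟨ *-identityˡ _ ⟨
    1# * (λ₀ * Z F)           ∎
    where open ≤-Reasoning

  Z≤uncovered+ : ∀ F u → Z F ≤ uncovered F u + sumᵛ (λ w → 𝟙 (w ∈? N u) * occupied F w)
  Z≤uncovered+ F u = begin
    Z F
      ≤⟨ sum-mono subsets (λ K → ≤-trans (≤-reflexive (sym (*-identityˡ _))) (*-monoˡ-≤ (0≤weight F K) (union-bound K))) ⟩
    sumˢ (λ K → (𝟙 (K ⊆? ∁ (N u)) + sumᵛ (λ w → 𝟙 (w ∈? N u) * 𝟙 (w ∈? K))) * weight F K)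
      ≡⟨ sum-cong subsets (λ K → trans (distribʳ (weight F K) _ _) (cong (𝟙 (K ⊆? ∁ (N u)) * weight F K +_)
           (trans (sym (sum-*ʳ vertices (weight F K) (λ w → 𝟙 (w ∈? N u) * 𝟙 (w ∈? K)))) (sum-cong vertices λ w → *-assoc _ _ _)))) ⟩
    sumˢ (λ K → 𝟙 (K ⊆? ∁ (N u)) * weight F K + sumᵛ (λ w → 𝟙 (w ∈? N u) * (𝟙 (w ∈? K) * weight F K)))
      ≡⟨ sum-+ subsets (λ K → 𝟙 (K ⊆? ∁ (N u)) * weight F K) (λ K → sumᵛ (λ w → 𝟙 (w ∈? N u) * (𝟙 (w ∈? K) * weight F K))) ⟩
    uncovered F u + sumˢ (λ K → sumᵛ (λ w → 𝟙 (w ∈? N u) * (𝟙 (w ∈? K) * weight F K)))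
      ≡⟨ cong (uncovered F u +_) (trans (sum-swap subsets vertices (λ K w → 𝟙 (w ∈? N u) * (𝟙 (w ∈? K) * weight F K)))
           (sum-cong vertices λ w → sum-*ˡ subsets (𝟙 (w ∈? N u)) (λ K → 𝟙 (w ∈? K) * weight F K))) ⟩
    uncovered F u + sumᵛ (λ w → 𝟙 (w ∈? N u) * occupied F w) ∎
    where
    open ≤-Reasoning
    union-bound : ∀ K → 1# ≤ 𝟙 (K ⊆? ∁ (N u)) + sumᵛ (λ w → 𝟙 (w ∈? N u) * 𝟙 (w ∈? K))
    union-bound K with Fin.any? (λ w → w ∈? N u ×-dec w ∈? K)
    ... | yes (w , w∈N , w∈K) = ≤-trans
          (≤-trans (≤-reflexive (sym (trans (cong₂ _*_ (𝟙-yes (w ∈? N u) w∈N) (𝟙-yes (w ∈? K) w∈K)) (*-identityˡ 1#))))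
            (term≤sum (λ w → 0≤* (0≤𝟙 (w ∈? N u)) (0≤𝟙 (w ∈? K))) (∈-allFin w)))
          (≤-by-gap (𝟙 (K ⊆? ∁ (N u))) (0≤𝟙 (K ⊆? ∁ (N u))) (+-comm _ _))
    ... | no ¬∃ = ≤-trans (≤-reflexive (sym (𝟙-yes (K ⊆? ∁ (N u)) λ x∈K → x∉p⇒x∈∁p λ x∈N → ¬∃ (_ , x∈N , x∈K))))
          (≤-by-gap _ (0≤sum vertices λ w → 0≤* (0≤𝟙 (w ∈? N u)) (0≤𝟙 (w ∈? K))) refl)

  -- Kept as a sum over ordered pairs, the shape in which it arises when the neighbours of each
  -- vertex are summed.
  degreeSum : Subset n → ℝ
  degreeSum F = sumᵛ (λ u → sumᵛ (λ w → 𝟙 (u ∈? F) * (𝟙 (w ∈? N u) * 𝟙 (w ∈? F))))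

  degreeSum-mono : ∀ {F F′} → F ⊆ F′ → degreeSum F ≤ degreeSum F′
  degreeSum-mono {F} {F′} F⊆F′ = sum-mono vertices λ u → sum-mono vertices λ w →
    *-mono-≤ (0≤𝟙* (w ∈? N u) (0≤𝟙 (w ∈? F))) (0≤𝟙 (u ∈? F′)) (𝟙-mono (u ∈? F) (u ∈? F′) F⊆F′)
      (*-monoʳ-≤ (0≤𝟙 (w ∈? N u)) (𝟙-mono (w ∈? F) (w ∈? F′) F⊆F′))

  degreeSum≡2*edges : ∀ F → degreeSum F ≡ fromℕ 2 * fromℕ (length (inducedEdges G F))
  degreeSum≡2*edges F = begin
    degreeSum F
      ≡⟨ sum-cong vertices (λ u → sum-cong vertices λ w → orient u w) ⟩
    sumᵛ (λ u → sumᵛ (λ w → edge u w + edge w u))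
      ≡⟨ trans (sum-cong vertices λ u → sum-+ vertices (edge u) (λ w → edge w u)) (sum-+ vertices (λ u → sumᵛ (edge u)) _) ⟩
    sumᵛ (λ u → sumᵛ (edge u)) + sumᵛ (λ u → sumᵛ (λ w → edge w u))
      ≡⟨ cong (sumᵛ (λ u → sumᵛ (edge u)) +_) (sum-swap vertices vertices (λ u w → edge w u)) ⟩
    sumᵛ (λ u → sumᵛ (edge u)) + sumᵛ (λ u → sumᵛ (edge u))
      ≡⟨ solve 1 (λ e → e :+ e := :2 :* e) refl (sumᵛ (λ u → sumᵛ (edge u))) ⟩
    fromℕ 2 * sumᵛ (λ u → sumᵛ (edge u))
      ≡⟨ cong (fromℕ 2 *_) (sym count) ⟩
    fromℕ 2 * fromℕ (length (inducedEdges G F)) ∎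
    where
    open ≡-Reasoning
    edge? : ∀ u w → Dec (u ∈ F × w ∈ F × u Fin.< w × Adj u w)
    edge? u w = u ∈? F ×-dec w ∈? F ×-dec u Fin.<? w ×-dec adj? u w
    edge : Fin n → Fin n → ℝ
    edge u w = 𝟙 (edge? u w)
    count : fromℕ (length (inducedEdges G F)) ≡ sumᵛ (λ u → sumᵛ (edge u))
    count = trans (fromℕ-length (inducedEdges G F)) (trans
      (sum-filter (λ (u , w) → edge? u w) (cartesianProduct vertices vertices) (λ _ → 1#))
      (trans (sum-product vertices vertices (λ (u , w) → edge u w * 1#))
        (sum-cong vertices λ u → sum-cong vertices λ w → *-identityʳ _)))
    both : ∀ u w → 𝟙 (u ∈? F) * (𝟙 (w ∈? N u) * 𝟙 (w ∈? F)) ≡ 𝟙 (u ∈? F ×-dec (w ∈? N u ×-dec w ∈? F))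
    both u w = sym (trans (𝟙-× (u ∈? F) (w ∈? N u ×-dec w ∈? F)) (cong (𝟙 (u ∈? F) *_) (𝟙-× (w ∈? N u) (w ∈? F))))
    -- `inducedEdges` lists a pair only in increasing order, so exactly one of the two summands can
    -- be nonzero, and neither is when u = w.
    orient : ∀ u w → 𝟙 (u ∈? F) * (𝟙 (w ∈? N u) * 𝟙 (w ∈? F)) ≡ edge u w + edge w u
    orient u w with Fin.<-cmp u w
    ... | tri< u<w _ w≮u = trans (both u w) (trans
          (𝟙-cong (u ∈? F ×-dec (w ∈? N u ×-dec w ∈? F)) (edge? u w)
            (λ (u∈F , w∈N , w∈F) → u∈F , w∈F , u<w , ∈N⇒Adj w∈N) (λ (u∈F , w∈F , _ , a) → u∈F , Adj⇒∈N a , w∈F))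
          (sym (trans (cong (edge u w +_) (𝟙-no (edge? w u) λ (_ , _ , w<u , _) → w≮u w<u)) (+-identityʳ _))))
    ... | tri> u≮w _ w<u = trans (both u w) (trans
          (𝟙-cong (u ∈? F ×-dec (w ∈? N u ×-dec w ∈? F)) (edge? w u)
            (λ (u∈F , w∈N , w∈F) → w∈F , u∈F , w<u , symm (∈N⇒Adj w∈N)) (λ (w∈F , u∈F , _ , a) → u∈F , Adj⇒∈N (symm a) , w∈F))
          (sym (trans (cong (_+ edge w u) (𝟙-no (edge? u w) λ (_ , _ , u<w , _) → u≮w u<w)) (+-identityˡ _))))
    ... | tri≈ u≮u refl _ = trans (both u u) (trans
          (𝟙-no (u ∈? F ×-dec (u ∈? N u ×-dec u ∈? F)) λ (_ , u∈N , _) → u∉Nu u∈N)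
          (sym (trans (cong₂ _+_ ¬edge ¬edge) (+-identityʳ 0#))))
      where ¬edge = 𝟙-no (edge? u u) λ (_ , _ , u<u , _) → u≮u u<u

  -- By the insertion bijection u is occupied with probability λ₀ / (1 + λ₀) times that of having no
  -- occupied neighbour. A union bound, with each neighbour occupied with probability at most λ₀,
  -- makes the latter at least 1 - λ₀ times the degree of u in F. This is summed over F and
  -- multiplied by `Z F`.
  expected-size-≥ : ∀ F → λ₀ * (fromℕ ∣ F ∣ - λ₀ * degreeSum F) * Z F ≤ (1# + λ₀) * sumᵛ (occupied F)
  expected-size-≥ F = begin
    λ₀ * (fromℕ ∣ F ∣ - λ₀ * degreeSum F) * Z F
      ≡⟨ cong (λ c → λ₀ * (c - λ₀ * degreeSum F) * Z F) (fromℕ-∣∣ F) ⟩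
    λ₀ * (sumᵛ (λ u → 𝟙 (u ∈? F)) - λ₀ * degreeSum F) * Z F
      ≡⟨ solve 4 (λ l c d z → l :* (c :- l :* d) :* z := c :* (l :* z) :+ d :* (:- (l :* l :* z))) refl
           λ₀ (sumᵛ (λ u → 𝟙 (u ∈? F))) (degreeSum F) (Z F) ⟩
    sumᵛ (λ u → 𝟙 (u ∈? F)) * (λ₀ * Z F) + degreeSum F * κ
      ≡⟨ cong₂ _+_ (sum-*ʳ vertices (λ₀ * Z F) (λ u → 𝟙 (u ∈? F))) (sum-*ʳ vertices κ d) ⟨
    sumᵛ (λ u → 𝟙 (u ∈? F) * (λ₀ * Z F)) + sumᵛ (λ u → d u * κ)
      ≡⟨ sum-+ vertices (λ u → 𝟙 (u ∈? F) * (λ₀ * Z F)) (λ u → d u * κ) ⟨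
    sumᵛ (λ u → 𝟙 (u ∈? F) * (λ₀ * Z F) + d u * κ)
      ≤⟨ sum-mono vertices at-vertex ⟩
    sumᵛ (λ u → (1# + λ₀) * occupied F u)
      ≡⟨ sum-*ˡ vertices (1# + λ₀) (occupied F) ⟩
    (1# + λ₀) * sumᵛ (occupied F) ∎
    where
    open ≤-Reasoning
    κ = - (λ₀ * λ₀ * Z F)
    e : Fin n → ℝ
    e u = sumᵛ (λ w → 𝟙 (w ∈? N u) * 𝟙 (w ∈? F))
    d : Fin n → ℝ
    d u = sumᵛ (λ w → 𝟙 (u ∈? F) * (𝟙 (w ∈? N u) * 𝟙 (w ∈? F)))
    neighbours : ∀ u → sumᵛ (λ w → 𝟙 (w ∈? N u) * occupied F w) ≤ e u * (λ₀ * Z F)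
    neighbours u = ≤-trans (sum-mono vertices λ w → ≤-trans
        (*-monoʳ-≤ (0≤𝟙 (w ∈? N u)) (occupied≤ F w)) (≤-reflexive (sym (*-assoc _ _ _))))
      (≤-reflexive (sum-*ʳ vertices (λ₀ * Z F) (λ w → 𝟙 (w ∈? N u) * 𝟙 (w ∈? F))))
    at-vertex : ∀ u → 𝟙 (u ∈? F) * (λ₀ * Z F) + d u * κ ≤ (1# + λ₀) * occupied F u
    at-vertex u = begin
      𝟙 (u ∈? F) * (λ₀ * Z F) + d u * κ
        ≡⟨ cong (λ x → 𝟙 (u ∈? F) * (λ₀ * Z F) + x * κ) (sum-*ˡ vertices (𝟙 (u ∈? F)) (λ w → 𝟙 (w ∈? N u) * 𝟙 (w ∈? F))) ⟩
      𝟙 (u ∈? F) * (λ₀ * Z F) + 𝟙 (u ∈? F) * e u * κ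
        ≡⟨ solve 4 (λ i l z e → i :* (l :* z) :+ i :* e :* (:- (l :* l :* z)) := i :* (l :* (z :- e :* (l :* z)))) refl
             (𝟙 (u ∈? F)) λ₀ (Z F) (e u) ⟩
      𝟙 (u ∈? F) * (λ₀ * (Z F - e u * (λ₀ * Z F)))
        ≤⟨ 𝟙*-mono (u ∈? F) (λ u∈F → begin
             λ₀ * (Z F - e u * (λ₀ * Z F))  ≤⟨ *-monoʳ-≤ 0≤λ₀ (≤-by-gap _ (0≤+ (x≤y⇒0≤y-x (Z≤uncovered+ F u)) (x≤y⇒0≤y-x (neighbours u)))
                                                 (solve 4 (λ z x y t → z :- x :+ (y :+ t :- z :+ (x :- t)) := y) refl
                                                   (Z F) (e u * (λ₀ * Z F)) (uncovered F u) (sumᵛ (λ w → 𝟙 (w ∈? N u) * occupied F w)))) ⟩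
             λ₀ * uncovered F u             ≡⟨ occupied-uncovered u∈F ⟨
             (1# + λ₀) * occupied F u       ∎) ⟩
      𝟙 (u ∈? F) * ((1# + λ₀) * occupied F u)
        ≤⟨ 𝟙*≤ (u ∈? F) (0≤* (0≤+ 0≤1 0≤λ₀) (0≤occupied F u)) ⟩
      (1# + λ₀) * occupied F u ∎

  -- Conditioning on the independent set outside a neighbourhood

  module _ (H : Subset n) (v : Fin n) where

    free? : ∀ J u → Dec (u ∈ N v × u ∈ H × J ⊆ ∁ (N u))
    free? J u = u ∈? N v ×-dec u ∈? H ×-dec J ⊆? ∁ (N u)

    -- The neighbours of v in H that remain available once J is occupied outside N v.
    free : Subset n → Subset n
    free J = Vec.tabulate λ u → does (free? J u)

    free⊆N : ∀ J → free J ⊆ N v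
    free⊆N J = proj₁ ∘ ∈-tabulate⁻ (free? J)

    -- The spatial Markov property: J restricts the part inside N v only by blocking the neighbours
    -- of its own vertices, so the weight factorises.
    weight-∪ : ∀ {J} → J ⊆ ∁ (N v) → ∀ K → 𝟙 (K ⊆? N v) * weight H (J ∪ K) ≡ weight H J * weight (free J) K
    weight-∪ {J} J⊆∁N K = begin
      𝟙 (K ⊆? N v) * weight H (J ∪ K)
        ≡⟨ 𝟙*-cong (K ⊆? N v) (λ K⊆N → cong (λ k → 𝟙 (admissible? H (J ∪ K)) * k) (trans (cong (λ₀ ^_) (size K⊆N)) (^-homo-* λ₀ ∣ J ∣ ∣ K ∣))) ⟩
      𝟙 (K ⊆? N v) * (𝟙 (admissible? H (J ∪ K)) * (λ₀ ^ ∣ J ∣ * λ₀ ^ ∣ K ∣))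
        ≡⟨ trans (sym (*-assoc _ _ _)) (cong (_* (λ₀ ^ ∣ J ∣ * λ₀ ^ ∣ K ∣)) (trans (sym (𝟙-× (K ⊆? N v) (admissible? H (J ∪ K))))
             (trans (𝟙-cong (K ⊆? N v ×-dec admissible? H (J ∪ K)) (admissible? H J ×-dec admissible? (free J) K) to from)
                    (𝟙-× (admissible? H J) (admissible? (free J) K))))) ⟩
      𝟙 (admissible? H J) * 𝟙 (admissible? (free J) K) * (λ₀ ^ ∣ J ∣ * λ₀ ^ ∣ K ∣)
        ≡⟨ solve 4 (λ i j p q → i :* j :* (p :* q) := i :* p :* (j :* q)) refl
             (𝟙 (admissible? H J)) (𝟙 (admissible? (free J) K)) (λ₀ ^ ∣ J ∣) (λ₀ ^ ∣ K ∣) ⟩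
      weight H J * weight (free J) K ∎
      where
      open ≡-Reasoning
      size : K ⊆ N v → ∣ J ∪ K ∣ ≡ ∣ J ∣ ℕ.+ ∣ K ∣
      size K⊆N = ∣p∪q∣≡∣p∣+∣q∣ J K λ x∈J x∈K → x∈∁p⇒x∉p (J⊆∁N x∈J) (K⊆N x∈K)
      J⊆ : J ⊆ J ∪ K
      J⊆ = p⊆p∪q K
      K⊆ : K ⊆ J ∪ K
      K⊆ = q⊆p∪q J K
      to : K ⊆ N v × (J ∪ K ⊆ H × Independent G (J ∪ K)) → (J ⊆ H × Independent G J) × (K ⊆ free J × Independent G K)
      to (K⊆N , J∪K⊆H , indep) =
          (J∪K⊆H ∘ J⊆ , λ x y x∈ y∈ → indep x y (J⊆ x∈) (J⊆ y∈))
        , ((λ x∈K → ∈-tabulate⁺ (free? J) (K⊆N x∈K , J∪K⊆H (K⊆ x∈K) ,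
              λ y∈J → x∉p⇒x∈∁p λ y∈Nx → indep _ _ (K⊆ x∈K) (J⊆ y∈J) (∈N⇒Adj y∈Nx)))
          , λ x y x∈ y∈ → indep x y (K⊆ x∈) (K⊆ y∈))
      from : (J ⊆ H × Independent G J) × (K ⊆ free J × Independent G K) → K ⊆ N v × (J ∪ K ⊆ H × Independent G (J ∪ K))
      from ((J⊆H , indepJ) , K⊆free , indepK) =
          free⊆N J ∘ K⊆free
        , (λ x∈ → [ J⊆H , (λ x∈K → proj₁ (proj₂ (isFree x∈K))) ]′ (x∈p∪q⁻ J K x∈))
        , λ x y x∈ y∈ → independent (x∈p∪q⁻ J K x∈) (x∈p∪q⁻ J K y∈)
        where
        isFree : ∀ {x} → x ∈ K → x ∈ N v × x ∈ H × J ⊆ ∁ (N x)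
        isFree = ∈-tabulate⁻ (free? J) ∘ K⊆free
        ¬Adj-KJ : ∀ {x y} → x ∈ K → y ∈ J → ¬ Adj x y
        ¬Adj-KJ x∈K y∈J adj = x∈∁p⇒x∉p (proj₂ (proj₂ (isFree x∈K)) y∈J) (Adj⇒∈N adj)
        independent : ∀ {x y} → x ∈ J ⊎ x ∈ K → y ∈ J ⊎ y ∈ K → ¬ Adj x y
        independent (inj₁ x∈J) (inj₁ y∈J) = indepJ _ _ x∈J y∈J
        independent (inj₁ x∈J) (inj₂ y∈K) = ¬Adj-KJ y∈K x∈J ∘ symm
        independent (inj₂ x∈K) (inj₁ y∈J) = ¬Adj-KJ x∈K y∈J
        independent (inj₂ x∈K) (inj₂ y∈K) = indepK _ _ x∈K y∈K

    private
      w : Subset n → ℝ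
      w J = 𝟙 (J ⊆? ∁ (N v)) * weight H J

    -- The law of total probability for an event that depends only on the part of the independent
    -- set inside N v. The trivial event gives the partition function, membership gives the
    -- occupation of a neighbour.
    condition : ∀ {P : Fin n → Subset n → Set} (P? : ∀ u K → Dec (P u K)) u →
      (∀ {J K} → J ⊆ ∁ (N v) → P u (J ∪ K) → P u K) → (∀ {J K} → P u K → P u (J ∪ K)) →
      sumˢ (λ I → 𝟙 (P? u I) * weight H I) ≡ sumˢ (λ J → w J * sumˢ (λ K → 𝟙 (P? u K) * weight (free J) K))
    condition {P} P? u to from = trans (sum-split (N v) (λ I → 𝟙 (P? u I) * weight H I)) (sum-cong subsets λ J →
      trans (𝟙*-cong (J ⊆? ∁ (N v)) λ J⊆∁N → trans
          (sum-cong subsets λ K → begin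
            𝟙 (K ⊆? N v) * (𝟙 (P? u (J ∪ K)) * weight H (J ∪ K))
              ≡⟨ cong (λ i → 𝟙 (K ⊆? N v) * (i * weight H (J ∪ K))) (𝟙-cong (P? u (J ∪ K)) (P? u K) (to J⊆∁N) from) ⟩
            𝟙 (K ⊆? N v) * (𝟙 (P? u K) * weight H (J ∪ K))
              ≡⟨ solve 3 (λ i j x → i :* (j :* x) := j :* (i :* x)) refl (𝟙 (K ⊆? N v)) (𝟙 (P? u K)) (weight H (J ∪ K)) ⟩
            𝟙 (P? u K) * (𝟙 (K ⊆? N v) * weight H (J ∪ K))
              ≡⟨ cong (𝟙 (P? u K) *_) (weight-∪ J⊆∁N K) ⟩
            𝟙 (P? u K) * (weight H J * weight (free J) K)
              ≡⟨ solve 3 (λ i j x → i :* (j :* x) := j :* (i :* x)) refl (𝟙 (P? u K)) (weight H J) (weight (free J) K) ⟩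
            weight H J * (𝟙 (P? u K) * weight (free J) K) ∎)
          (sum-*ˡ subsets (weight H J) (λ K → 𝟙 (P? u K) * weight (free J) K)))
        (sym (*-assoc _ _ _)))
      where open ≡-Reasoning

    Z-condition : Z H ≡ sumˢ (λ J → w J * Z (free J))
    Z-condition = trans (sum-cong subsets λ I → sym (*-identityˡ _)) (trans
      (condition {λ _ _ → ⊤} (λ _ _ → yes tt) v (λ _ _ → tt) (λ _ → tt))
      (sum-cong subsets λ J → cong (w J *_) (sum-cong subsets λ K → *-identityˡ _)))

    occupied-condition : ∀ u → 𝟙 (u ∈? N v) * occupied H u ≡ sumˢ (λ J → w J * occupied (free J) u)
    occupied-condition u with u ∈? N v
    ... | yes u∈N = trans (*-identityˡ _) (condition _∈?_ u
            (λ {J} {K} J⊆∁N u∈J∪K → [ (λ u∈J → contradiction u∈N (x∈∁p⇒x∉p (J⊆∁N u∈J))) , id ]′ (x∈p∪q⁻ J K u∈J∪K))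
            (λ {J} {K} → q⊆p∪q J K))
    ... | no  u∉N = trans (zeroˡ _) (sym (trans
            (sum-cong subsets λ J → trans (cong (w J *_) (occupied-∉ (u∉N ∘ free⊆N J))) (zeroʳ _)) (sum-0 subsets)))

    -- The local inequality is averaged over the outside part J with weights w J. These add up to
    -- `uncovered H v` by definition, which is why C is multiplied by that sum.
    local-occupancy : ∀ {C γ} → (∀ F → F ⊆ N v → Z F ≤ C + γ * sumᵛ (occupied F)) →
      Z H ≤ C * uncovered H v + γ * sumᵛ (λ u → 𝟙 (u ∈? N v) * occupied H u)
    local-occupancy {C} {γ} local = begin
      Z H
        ≡⟨ Z-condition ⟩
      sumˢ (λ J → w J * Z (free J))
        ≤⟨ sum-mono subsets (λ J → *-monoʳ-≤ (0≤𝟙* (J ⊆? ∁ (N v)) (0≤weight H J)) (local (free J) (free⊆N J))) ⟩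
      sumˢ (λ J → w J * (C + γ * sumᵛ (occupied (free J))))
        ≡⟨ sum-cong subsets (λ J → solve 4 (λ w c g s → w :* (c :+ g :* s) := c :* w :+ g :* (w :* s)) refl (w J) C γ (sumᵛ (occupied (free J)))) ⟩
      sumˢ (λ J → C * w J + γ * (w J * sumᵛ (occupied (free J))))
        ≡⟨ trans (sum-+ subsets (λ J → C * w J) (λ J → γ * (w J * sumᵛ (occupied (free J)))))
             (cong₂ _+_ (sum-*ˡ subsets C w) (sum-*ˡ subsets γ (λ J → w J * sumᵛ (occupied (free J))))) ⟩
      C * uncovered H v + γ * sumˢ (λ J → w J * sumᵛ (occupied (free J)))
        ≡⟨ cong (λ x → C * uncovered H v + γ * x) (trans
             (sum-cong subsets λ J → sym (sum-*ˡ vertices (w J) (occupied (free J))))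
             (trans (sum-swap subsets vertices (λ J u → w J * occupied (free J) u)) (sum-cong vertices λ u → sym (occupied-condition u)))) ⟩
      C * uncovered H v + γ * sumᵛ (λ u → 𝟙 (u ∈? N v) * occupied H u) ∎
      where open ≤-Reasoning

-- Fractional colourings from the greedy algorithm

-- The half-open intervals from start W I to start W I + W I, over all subsets I, tile [ 0 , sumˢ W ⟩.
module Tiling (R : Reals) where
  open OrderedField R
  open FiniteSums R

  start : ∀ {n} → (Subset n → ℝ) → Subset n → ℝ
  start W []ᵛ            = 0#
  start W (outside ∷ᵛ I) = start (W ∘ (outside ∷ᵛ_)) I
  start W (inside ∷ᵛ I)  = sumˢ (W ∘ (outside ∷ᵛ_)) + start (W ∘ (inside ∷ᵛ_)) I

  0≤start : ∀ {n} {W : Subset n → ℝ} → (∀ I → 0# ≤ W I) → ∀ I → 0# ≤ start W I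
  0≤start 0≤W []ᵛ            = ≤-refl
  0≤start 0≤W (outside ∷ᵛ I) = 0≤start (0≤W ∘ (outside ∷ᵛ_)) I
  0≤start 0≤W (inside ∷ᵛ I)  = 0≤+ (0≤sum (allSubsets _) (0≤W ∘ (outside ∷ᵛ_))) (0≤start (0≤W ∘ (inside ∷ᵛ_)) I)

  end≤sum : ∀ {n} {W : Subset n → ℝ} → (∀ I → 0# ≤ W I) → ∀ I → start W I + W I ≤ sumˢ W
  end≤sum {W = W} 0≤W []ᵛ = ≤-reflexive (+-comm 0# (W []ᵛ))
  end≤sum {W = W} 0≤W (outside ∷ᵛ I) = ≤-trans (end≤sum (0≤W ∘ (outside ∷ᵛ_)) I)
    (≤-by-gap _ (0≤sum (allSubsets _) (0≤W ∘ (inside ∷ᵛ_))) (sym (sumˢ-suc W)))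
  end≤sum {W = W} 0≤W (inside ∷ᵛ I) = ≤-trans (≤-reflexive (+-assoc _ _ _))
    (≤-trans (+-monoʳ-≤ (sumˢ (W ∘ (outside ∷ᵛ_))) (end≤sum (0≤W ∘ (inside ∷ᵛ_)) I)) (≤-reflexive (sym (sumˢ-suc W))))

  tiles-disjoint : ∀ {n} {W : Subset n → ℝ} → (∀ I → 0# ≤ W I) → ∀ I J → I ≢ J →
    start W I + W I ≤ start W J ⊎ start W J + W J ≤ start W I
  tiles-disjoint 0≤W []ᵛ []ᵛ I≢J = contradiction refl I≢J
  tiles-disjoint 0≤W (outside ∷ᵛ I) (outside ∷ᵛ J) I≢J =
    tiles-disjoint (0≤W ∘ (outside ∷ᵛ_)) I J (I≢J ∘ cong (outside ∷ᵛ_))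
  tiles-disjoint {W = W} 0≤W (inside ∷ᵛ I) (inside ∷ᵛ J) I≢J = Sum.map shift shift
    (tiles-disjoint (0≤W ∘ (inside ∷ᵛ_)) I J (I≢J ∘ cong (inside ∷ᵛ_)))
    where
    shift : ∀ {x y z} → x + y ≤ z → sumˢ (W ∘ (outside ∷ᵛ_)) + x + y ≤ sumˢ (W ∘ (outside ∷ᵛ_)) + z
    shift x+y≤z = ≤-trans (≤-reflexive (+-assoc _ _ _)) (+-monoʳ-≤ _ x+y≤z)
  tiles-disjoint {W = W} 0≤W (outside ∷ᵛ I) (inside ∷ᵛ J) _ = inj₁ (≤-trans (end≤sum (0≤W ∘ (outside ∷ᵛ_)) I)
    (≤-by-gap _ (0≤start (0≤W ∘ (inside ∷ᵛ_)) J) refl))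
  tiles-disjoint {W = W} 0≤W (inside ∷ᵛ I) (outside ∷ᵛ J) _ = inj₂ (≤-trans (end≤sum (0≤W ∘ (outside ∷ᵛ_)) J)
    (≤-by-gap _ (0≤start (0≤W ∘ (inside ∷ᵛ_)) I) refl))

module Colouring (R : Reals) {n} (G : Graph n) where
  open OrderedField R
  open FiniteSums R
  open Tiling R
  open Intervals R
  open FractionalColourings R

  private
    subsets = allSubsets n

  coverage : (Subset n → ℝ) → Fin n → ℝ
  coverage W u = sumˢ (λ I → 𝟙 (u ∈? I) * W I)

  module _ {W : Subset n → ℝ} (0≤W : ∀ I → 0# ≤ W I) (W-dependent : ∀ I → ¬ Independent G I → W I ≡ 0#) where

    -- As W vanishes on dependent sets, sums over `independentSets` may be replaced by sums over all
    -- subsets.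
    restrict : ∀ I → 𝟙 (independent? G I) * W I ≡ W I
    restrict I = go (independent? G I)
      where
      go : (d : Dec (Independent G I)) → 𝟙 d * W I ≡ W I
      go (yes _)      = *-identityˡ _
      go (no  ¬indep) = trans (zeroˡ _) (sym (W-dependent I ¬indep))

    colouring : (∀ u → 1# ≤ coverage W u) → FractionalColouring G
    colouring covered = record
      { w = λ I → record
          { set        = [ start W I , start W I + W I ⟩
          ; measurable = measurable-interval (start≤end I)
          ; μ          = W I
          ; hasMeasure = subst (Lebesgue.OuterMeasure R [ start W I , start W I + W I ⟩)
              (solve 2 (λ s w → s :+ w :- s := w) refl (start W I) (W I)) (outerMeasure-interval (start≤end I))
          }
      ; disjoint = λ I J _ _ I≢J ((I≤x , x<I) , (J≤x , x<J)) →
          [ (λ I≤J → <⇒≱ x<I (≤-trans I≤J J≤x)) , (λ J≤I → <⇒≱ x<J (≤-trans J≤I I≤x)) ]′ (tiles-disjoint 0≤W I J I≢J)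
      ; covers = λ u → ≤-trans (covered u) (≤-reflexive (sym (trans
          (sum-filter (u ∈?_) (independentSets G) W)
          (trans (sum-filter (independent? G) subsets (λ I → 𝟙 (u ∈? I) * W I))
            (sum-cong subsets λ I → trans
              (solve 3 (λ i j w → i :* (j :* w) := j :* (i :* w)) refl (𝟙 (independent? G I)) (𝟙 (u ∈? I)) (W I))
              (cong (𝟙 (u ∈? I) *_) (restrict I)))))))
      }
      where
      start≤end : ∀ I → start W I ≤ start W I + W I
      start≤end I = ≤-by-gap (W I) (0≤W I) refl

    chromatic-≤ : (∀ u → 1# ≤ coverage W u) → ∀ {χ} → IsFractionalChromaticNumber G χ → χ ≤ sumˢ W
    chromatic-≤ covered (_ , minimal) = ≤-trans (minimal (colouring covered))
      (≤-reflexive (trans (sum-filter (independent? G) subsets W) (sum-cong subsets restrict)))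

-- The greedy covering

module Greedy (R : Reals) {n} (G : Graph n) (λ₀ : Reals.ℝ R) (0<λ₀ : Reals._<_ R (Reals.0# R) λ₀) where
  open OrderedField R
  open FiniteSums R
  open HardCore R G λ₀ 0<λ₀
  open Colouring R G
  open Intervals R using (totalOrder)
  open import Data.List.Extrema totalOrder using (argmin; argmin-all; f[argmin]≤f[xs])

  private
    subsets = allSubsets n
    vertices = allFin n

  nearby : (Fin n → ℝ) → Fin n → ℝ
  nearby p v = sumᵛ (λ u → 𝟙 (u ∈? N v) * p u)

  minimise : ∀ H (g : Fin n → ℝ) → Subset.Nonempty H → ∃[ u ] (u ∈ H × (∀ {x} → x ∈ H → g u ≤ g x))
  minimise H g (x₀ , x₀∈H) = argmin g x₀ members
    , argmin-all g x₀∈H (all-filter (_∈? H) vertices)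
    , λ x∈H → All.lookup (f[argmin]≤f[xs] {f = g} x₀ members) (∈-filter⁺ (_∈? H) (∈-allFin _) x∈H)
    where members = filter (_∈? H) vertices

  module _ {β γ Δ : ℝ} (0≤β : 0# ≤ β) (0≤γ : 0# ≤ γ) (0≤Δ : 0# ≤ Δ) (deg≤Δ : ∀ v → fromℕ ∣ N v ∣ ≤ Δ)
    (occupancy : ∀ H v → v ∈ H → Z H ≤ β * occupied H v + γ * nearby (occupied H) v) where

    -- The loop invariant. `total-local` survives each round because any multiple of the hard-core
    -- weights on H obeys the occupancy inequality at every v in H, and H only shrinks. `total≤` is
    -- carried separately because in the end H is empty and offers no vertex at which to apply
    -- `total-local`.
    record Partial (H : Subset n) : Set where
      field
        W           : Subset n → ℝ
        0≤W         : ∀ I → 0# ≤ W I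
        W-dependent : ∀ I → ¬ Independent G I → W I ≡ 0#
        covered≤1   : ∀ u → coverage W u ≤ 1#
        covered     : ∀ u → u ∉ H → coverage W u ≡ 1#
        total-local : ∀ v → v ∈ H → sumˢ W ≤ β * coverage W v + γ * nearby (coverage W) v
        total≤      : sumˢ W ≤ β + γ * Δ

    nearby≤Δ : ∀ {p} → (∀ u → p u ≤ 1#) → ∀ v → nearby p v ≤ Δ
    nearby≤Δ {p} p≤1 v = begin
      nearby p v                  ≤⟨ sum-mono vertices (λ u → ≤-trans (*-monoʳ-≤ (0≤𝟙 (u ∈? N v)) (p≤1 u)) (≤-reflexive (*-identityʳ _))) ⟩
      sumᵛ (λ u → 𝟙 (u ∈? N v))   ≡⟨ fromℕ-∣∣ (N v) ⟨
      fromℕ ∣ N v ∣               ≤⟨ deg≤Δ v ⟩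
      Δ                           ∎
      where open ≤-Reasoning

    initial : Partial Subset.⊤
    initial = record
      { W           = λ _ → 0#
      ; 0≤W         = λ _ → ≤-refl
      ; W-dependent = λ _ _ → refl
      ; covered≤1   = λ u → ≤-trans (≤-reflexive (uncovered-by-0 u)) 0≤1
      ; covered     = λ u u∉⊤ → contradiction ∈⊤ u∉⊤
      ; total-local = λ v _ → ≤-trans (≤-reflexive (sum-0 subsets))
          (0≤+ (0≤* 0≤β (≤-reflexive (sym (uncovered-by-0 v)))) (0≤* 0≤γ (0≤sum vertices λ u → 0≤𝟙* (u ∈? N v) (≤-reflexive (sym (uncovered-by-0 u))))))
      ; total≤      = ≤-trans (≤-reflexive (sum-0 subsets)) (0≤+ 0≤β (0≤* 0≤γ 0≤Δ))
      }
      where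
      uncovered-by-0 : ∀ u → coverage (λ _ → 0#) u ≡ 0#
      uncovered-by-0 u = trans (sum-cong subsets λ I → zeroʳ (𝟙 (u ∈? I))) (sum-0 subsets)

    ratio : (W : Subset n → ℝ) (H : Subset n) → Fin n → ℝ
    ratio W H u = (1# - coverage W u) / occupied H u

    -- Add the largest multiple of the hard-core distribution on H that overcovers no vertex.
    extend : ∀ {H} (P : Partial H) {u₀} → u₀ ∈ H → (∀ {x} → x ∈ H → ratio (Partial.W P) H u₀ ≤ ratio (Partial.W P) H x) →
      Partial (H Subset.- u₀)
    extend {H} P {u₀} u₀∈H minimal = record
      { W           = W′
      ; 0≤W         = λ I → 0≤+ (0≤W I) (0≤* 0≤τ (0≤weight H I))
      ; W-dependent = λ I ¬indep → trans (cong₂ (λ x y → x + τ * y) (W-dependent I ¬indep)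
          (𝟙*-no (admissible? H I) (¬indep ∘ proj₂) (λ₀ ^ ∣ I ∣))) (solve 1 (λ t → :0 :+ t :* :0 := :0) refl τ)
      ; covered≤1   = covered≤1′
      ; covered     = covered′
      ; total-local = λ v v∈ → total-local′ v (p─q⊆p H ⁅ u₀ ⁆ v∈)
      -- The vertex u₀ about to leave H still satisfies the local bound, and there all coverages are
      -- at most 1.
      ; total≤      = ≤-trans (total-local′ u₀ u₀∈H) (+-mono-≤
          (≤-trans (*-monoʳ-≤ 0≤β (covered≤1′ u₀)) (≤-reflexive (*-identityʳ β)))
          (*-monoʳ-≤ 0≤γ (nearby≤Δ covered≤1′ u₀)))
      }
      where
      open Partial P
      τ = ratio W H u₀
      0≤τ : 0# ≤ τ
      0≤τ = 0≤x⇒0≤x/y (x≤y⇒0≤y-x (covered≤1 u₀)) (0<occupied u₀∈H)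
      W′ : Subset n → ℝ
      W′ I = W I + τ * weight H I

      coverage′ : ∀ u → coverage W′ u ≡ coverage W u + τ * occupied H u
      coverage′ u = trans
        (sum-cong subsets λ I → solve 4 (λ i w t x → i :* (w :+ t :* x) := i :* w :+ t :* (i :* x)) refl (𝟙 (u ∈? I)) (W I) τ (weight H I))
        (trans (sum-+ subsets (λ I → 𝟙 (u ∈? I) * W I) (λ I → τ * (𝟙 (u ∈? I) * weight H I)))
          (cong (coverage W u +_) (sum-*ˡ subsets τ (λ I → 𝟙 (u ∈? I) * weight H I))))

      total′ : sumˢ W′ ≡ sumˢ W + τ * Z H
      total′ = trans (sum-+ subsets W (λ I → τ * weight H I)) (cong (sumˢ W +_) (sum-*ˡ subsets τ (weight H)))

      nearby′ : ∀ v → nearby (coverage W′) v ≡ nearby (coverage W) v + τ * nearby (occupied H) v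
      nearby′ v = trans
        (sum-cong vertices λ u → trans (cong (𝟙 (u ∈? N v) *_) (coverage′ u))
          (solve 4 (λ i w t x → i :* (w :+ t :* x) := i :* w :+ t :* (i :* x)) refl (𝟙 (u ∈? N v)) (coverage W u) τ (occupied H u)))
        (trans (sum-+ vertices (λ u → 𝟙 (u ∈? N v) * coverage W u) (λ u → τ * (𝟙 (u ∈? N v) * occupied H u)))
          (cong (nearby (coverage W) v +_) (sum-*ˡ vertices τ (λ u → 𝟙 (u ∈? N v) * occupied H u))))

      ratio-spec : ∀ {u} → u ∈ H → coverage W u + ratio W H u * occupied H u ≡ 1#
      ratio-spec {u} u∈H = trans (cong (coverage W u +_) (x/y*y≡x (1# - coverage W u) (0<occupied u∈H)))
        (solve 1 (λ c → c :+ (:1 :- c) := :1) refl (coverage W u))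

      covered-∉ : ∀ {u} → u ∉ H → coverage W′ u ≡ 1#
      covered-∉ {u} u∉H = trans (coverage′ u) (trans (cong₂ (λ c o → c + τ * o) (covered u u∉H) (occupied-∉ u∉H))
        (solve 1 (λ t → :1 :+ t :* :0 := :1) refl τ))

      covered≤1′ : ∀ u → coverage W′ u ≤ 1#
      covered≤1′ u = case u ∈? H of λ
        { (no  u∉H) → ≤-reflexive (covered-∉ u∉H)
        ; (yes u∈H) → ≤-trans (≤-reflexive (coverage′ u)) (≤-trans
            (+-monoʳ-≤ (coverage W u) (*-monoˡ-≤ (0≤occupied H u) (minimal u∈H))) (≤-reflexive (ratio-spec u∈H)))
        }

      covered′ : ∀ u → u ∉ H Subset.- u₀ → coverage W′ u ≡ 1#
      covered′ u u∉ = case ((u ∈? H) , (u Fin.≟ u₀)) of λ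
        { (no  u∉H , _)        → covered-∉ u∉H
        ; (yes u∈H , no  u≢u₀) → contradiction (x∈p∧x≢y⇒x∈p-y u∈H u≢u₀) u∉
        ; (yes _   , yes u≡u₀) → trans (cong (coverage W′) u≡u₀) (trans (coverage′ u₀) (ratio-spec u₀∈H))
        }

      total-local′ : ∀ v → v ∈ H → sumˢ W′ ≤ β * coverage W′ v + γ * nearby (coverage W′) v
      total-local′ v v∈H = begin
        sumˢ W′
          ≡⟨ total′ ⟩
        sumˢ W + τ * Z H
          ≤⟨ +-mono-≤ (total-local v v∈H) (*-monoʳ-≤ 0≤τ (occupancy H v v∈H)) ⟩
        β * coverage W v + γ * nearby (coverage W) v + τ * (β * occupied H v + γ * nearby (occupied H) v)
          ≡⟨ solve 5 (λ c o x y t → c :+ x :+ t :* (o :+ y) := (c :+ t :* o) :+ (x :+ t :* y)) refl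
               (β * coverage W v) (β * occupied H v) (γ * nearby (coverage W) v) (γ * nearby (occupied H) v) τ ⟩
        (β * coverage W v + τ * (β * occupied H v)) + (γ * nearby (coverage W) v + τ * (γ * nearby (occupied H) v))
          ≡⟨ cong₂ _+_ (factor β (coverage W v) (occupied H v)) (factor γ (nearby (coverage W) v) (nearby (occupied H) v)) ⟩
        β * (coverage W v + τ * occupied H v) + γ * (nearby (coverage W) v + τ * nearby (occupied H) v)
          ≡⟨ cong₂ (λ c x → β * c + γ * x) (coverage′ v) (nearby′ v) ⟨
        β * coverage W′ v + γ * nearby (coverage W′) v ∎
        where
        open ≤-Reasoning
        factor : ∀ b c o → b * c + τ * (b * o) ≡ b * (c + τ * o)
        factor b c o = solve 4 (λ b c o t → b :* c :+ t :* (b :* o) := b :* (c :+ t :* o)) refl b c o τ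

    complete : ∀ m {H} → ∣ H ∣ ℕ.≤ m → Partial H → ∃[ F ] (Subset.Empty F × Partial F)
    complete m {H} ∣H∣≤m P with nonempty? H
    ... | no  empty    = H , empty , P
    ... | yes nonempty with minimise H (ratio (Partial.W P) H) nonempty
    ...   | u , u∈H , minimal with ℕ.≤-trans (x∈p⇒∣p-x∣<∣p∣ u∈H) ∣H∣≤m
    ...     | ℕ.s≤s ∣H-u∣≤m = complete _ ∣H-u∣≤m (extend P u∈H minimal)

    chromatic≤ : ∀ {χ} → FractionalColourings.IsFractionalChromaticNumber R G χ → χ ≤ β + γ * Δ
    chromatic≤ isχ with complete ∣ Subset.⊤ {n} ∣ ℕ.≤-refl initial
    ... | F , empty , P = ≤-trans
          (chromatic-≤ 0≤W W-dependent (λ u → ≤-reflexive (sym (covered u λ u∈F → empty (u , u∈F)))) isχ) total≤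
      where open Partial P

-- The expected size of a uniform independent set

module Averages (R : Reals) where
  open OrderedField R
  open FiniteSums R

  -- The right side minus the left is the sum of (a x - a y) * (b y - b x) over unordered pairs of
  -- entries; the induction adds the pairs that involve the head.
  chebyshev : ∀ {A : Set} (xs : List A) (a b : A → ℝ) → (∀ x y → 0# ≤ (a x - a y) * (b y - b x)) →
    fromℕ (length xs) * sumOver xs (λ x → a x * b x) ≤ sumOver xs a * sumOver xs b
  chebyshev []       a b _     = ≤-reflexive (trans (zeroʳ 0#) (sym (zeroʳ 0#)))
  chebyshev (x ∷ xs) a b oppos = ≤-by-gap _ (0≤+ (x≤y⇒0≤y-x (chebyshev xs a b oppos)) (x≤y⇒0≤y-x cross))
    (solve 6 (λ n s p q a b → (:1 :+ n) :* (a :* b :+ s) :+ (p :* q :- n :* s :+ (a :* q :+ p :* b :- (s :+ n :* (a :* b))))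
       := (a :+ p) :* (b :+ q)) refl
      (fromℕ (length xs)) S (sumOver xs a) (sumOver xs b) (a x) (b x))
    where
    S = sumOver xs (λ y → a y * b y)
    cross : S + fromℕ (length xs) * (a x * b x) ≤ a x * sumOver xs b + sumOver xs a * b x
    cross = subst₂ _≤_
      (trans (sum-+ xs (λ y → a y * b y) (λ _ → a x * b x)) (cong (S +_) (sum-const xs (a x * b x))))
      (trans (sum-+ xs (λ y → a x * b y) (λ y → a y * b x)) (cong₂ _+_ (sum-*ˡ xs (a x) b) (sum-*ʳ xs (b x) a)))
      (sum-mono xs λ y → ≤-by-gap _ (oppos x y)
        (solve 4 (λ a b c d → c :* d :+ a :* b :+ (a :- c) :* (d :- b) := a :* d :+ c :* b) refl (a x) (b x) (a y) (b y)))

  ^-antimonoʳ-≤ : ∀ {x m n} → 0# ≤ x → x ≤ 1# → m ℕ.≤ n → x ^ n ≤ x ^ m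
  ^-antimonoʳ-≤ {x} {n = zero}  0≤x x≤1 ℕ.z≤n = ≤-refl
  ^-antimonoʳ-≤ {x} {n = suc n} 0≤x x≤1 ℕ.z≤n = ≤-trans (*-mono-≤ (0≤^ n 0≤x) 0≤1 x≤1 (^-antimonoʳ-≤ 0≤x x≤1 (ℕ.z≤n {n})))
    (≤-reflexive (*-identityˡ 1#))
  ^-antimonoʳ-≤ 0≤x x≤1 (ℕ.s≤s m≤n) = *-monoʳ-≤ 0≤x (^-antimonoʳ-≤ 0≤x x≤1 m≤n)

  opposite : ∀ {x} → 0# ≤ x → x ≤ 1# → ∀ m n → 0# ≤ (fromℕ m - fromℕ n) * (x ^ n - x ^ m)
  opposite {x} 0≤x x≤1 m n with ℕ.≤-total m n
  ... | inj₂ n≤m = 0≤* (x≤y⇒0≤y-x (fromℕ-mono-≤ n≤m)) (x≤y⇒0≤y-x (^-antimonoʳ-≤ 0≤x x≤1 n≤m))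
  ... | inj₁ m≤n = subst (0# ≤_)
        (solve 4 (λ a b c d → (b :- a) :* (c :- d) := (a :- b) :* (d :- c)) refl (fromℕ m) (fromℕ n) (x ^ m) (x ^ n))
        (0≤* (x≤y⇒0≤y-x (fromℕ-mono-≤ m≤n)) (x≤y⇒0≤y-x (^-antimonoʳ-≤ 0≤x x≤1 m≤n)))

  bernoulli : ∀ {h} → 0# ≤ h → ∀ n → 1# + fromℕ n * h ≤ (1# + h) ^ n
  bernoulli {h} 0≤h zero    = ≤-reflexive (solve 1 (λ h → :1 :+ :0 :* h := :1) refl h)
  bernoulli {h} 0≤h (suc n) = ≤-trans
    (≤-by-gap (fromℕ n * h * h) (0≤* (0≤* (0≤fromℕ n) 0≤h) 0≤h)
      (solve 2 (λ h n → :1 :+ (:1 :+ n) :* h :+ n :* h :* h := (:1 :+ h) :* (:1 :+ n :* h)) refl h (fromℕ n)))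
    (*-monoʳ-≤ (0≤+ 0≤1 0≤h) (bernoulli 0≤h n))

module ExpectedSize (R : Reals) {n} (G : Graph n) (λ₀ : Reals.ℝ R) (0<λ₀ : Reals._<_ R (Reals.0# R) λ₀) where
  open OrderedField R
  open FiniteSums R
  open Averages R
  open IndependentSets R
  open HardCore R G λ₀ 0<λ₀

  private
    subsets = allSubsets n
    vertices = allFin n
    sets = independentSets G

    size : Subset n → ℝ
    size I = fromℕ ∣ I ∣

    numberOfSets = fromℕ (length sets)
    totalSize = sumOver sets size

    sum-weight : ∀ (g : Subset n → ℝ) → sumˢ (λ K → g K * weight Subset.⊤ K) ≡ sumOver sets (λ K → g K * λ₀ ^ ∣ K ∣)
    sum-weight g = trans
      (sum-cong subsets λ K → trans
        (cong (λ i → g K * (i * λ₀ ^ ∣ K ∣)) (𝟙-cong (admissible? Subset.⊤ K) (independent? G K) proj₂ (λ indep → ⊆-max K , indep)))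
        (solve 3 (λ g i p → g :* (i :* p) := i :* (g :* p)) refl (g K) (𝟙 (independent? G K)) (λ₀ ^ ∣ K ∣)))
      (sym (sum-filter (independent? G) subsets (λ K → g K * λ₀ ^ ∣ K ∣)))

    Z⊤ : Z Subset.⊤ ≡ sumOver sets (λ K → λ₀ ^ ∣ K ∣)
    Z⊤ = trans (sum-cong subsets λ K → sym (*-identityˡ _)) (trans (sum-weight (λ _ → 1#)) (sum-cong sets λ K → *-identityˡ _))

    occupied-sum : sumᵛ (occupied Subset.⊤) ≡ sumOver sets (λ K → size K * λ₀ ^ ∣ K ∣)
    occupied-sum = trans (sum-swap vertices subsets (λ u K → 𝟙 (u ∈? K) * weight Subset.⊤ K)) (trans
      (sum-cong subsets λ K → trans (sum-*ʳ vertices (weight Subset.⊤ K) (λ u → 𝟙 (u ∈? K)))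
        (cong (_* weight Subset.⊤ K) (sym (fromℕ-∣∣ K))))
      (sum-weight size))

    0<numberOfSets : 0# < numberOfSets
    0<numberOfSets = ≰⇒> λ #≤0 → <⇒≱ (0<Z Subset.⊤) (begin
      Z Subset.⊤                              ≡⟨ Z⊤ ⟩
      sumOver sets (λ K → λ₀ ^ ∣ K ∣)          ≡⟨ cong (λ xs → sumOver xs (λ K → λ₀ ^ ∣ K ∣)) (empty sets #≤0) ⟩
      0#                                      ∎)
      where
      open ≤-Reasoning
      empty : ∀ {A : Set} (xs : List A) → fromℕ (length xs) ≤ 0# → xs ≡ []
      empty []       _   = refl
      empty (x ∷ xs) #≤0 = contradiction #≤0 (<⇒≱ (0<fromℕ-suc (length xs)))

  module _ {β γ Δ : ℝ} (0≤γ : 0# ≤ γ) (λ₀≤1 : λ₀ ≤ 1#) (deg≤Δ : ∀ v → fromℕ ∣ N v ∣ ≤ Δ)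
    (occupancy : ∀ v → Z Subset.⊤ ≤ β * occupied Subset.⊤ v + γ * sumᵛ (λ u → 𝟙 (u ∈? N v) * occupied Subset.⊤ u)) where

    private
      occ = occupied Subset.⊤

    -- Double counting: each u is a neighbour of at most Δ vertices v.
    neighbour-sum : sumᵛ (λ v → sumᵛ (λ u → 𝟙 (u ∈? N v) * occ u)) ≤ Δ * sumᵛ occ
    neighbour-sum = begin
      sumᵛ (λ v → sumᵛ (λ u → 𝟙 (u ∈? N v) * occ u))
        ≡⟨ sum-swap vertices vertices (λ v u → 𝟙 (u ∈? N v) * occ u) ⟩
      sumᵛ (λ u → sumᵛ (λ v → 𝟙 (u ∈? N v) * occ u))
        ≤⟨ sum-mono vertices (λ u → begin
             sumᵛ (λ v → 𝟙 (u ∈? N v) * occ u)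
               ≡⟨ sum-*ʳ vertices (occ u) (λ v → 𝟙 (u ∈? N v)) ⟩
             sumᵛ (λ v → 𝟙 (u ∈? N v)) * occ u
               ≡⟨ cong (_* occ u) (trans (sum-cong vertices λ v → 𝟙-cong (u ∈? N v) (v ∈? N u) N-sym N-sym) (sym (fromℕ-∣∣ (N u)))) ⟩
             fromℕ ∣ N u ∣ * occ u
               ≤⟨ *-monoˡ-≤ (0≤occupied Subset.⊤ u) (deg≤Δ u) ⟩
             Δ * occ u ∎) ⟩
      sumᵛ (λ u → Δ * occ u)
        ≡⟨ sum-*ˡ vertices Δ occ ⟩
      Δ * sumᵛ occ ∎
      where
      open ≤-Reasoning
      N-sym : ∀ {u v} → u ∈ N v → v ∈ N u
      N-sym = Adj⇒∈N ∘ Graph.symm G ∘ ∈N⇒Adj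

    -- Both means are fractions, so everything is multiplied by `Z Subset.⊤` and by the number of
    -- independent sets. Chebyshev's inequality applies because the size increases and, as λ₀ ≤ 1,
    -- the weight decreases.
    expectedSize-≥ : 0# ≤ β + γ * Δ → fromℕ n ≤ (β + γ * Δ) * expectedSize G
    expectedSize-≥ 0≤κ = *-cancelʳ-≤ 0<numberOfSets (*-cancelʳ-≤ (0<Z Subset.⊤) (begin
      fromℕ n * M * Z⊤′
        ≡⟨ solve 3 (λ n m z → n :* m :* z := m :* (n :* z)) refl (fromℕ n) M Z⊤′ ⟩
      M * (fromℕ n * Z⊤′)
        ≤⟨ *-monoʳ-≤ (<⇒≤ 0<numberOfSets) nZ≤ ⟩
      M * ((β + γ * Δ) * sumᵛ occ)
        ≡⟨ solve 3 (λ m k s → m :* (k :* s) := k :* (m :* s)) refl M (β + γ * Δ) (sumᵛ occ) ⟩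
      (β + γ * Δ) * (M * sumᵛ occ)
        ≤⟨ *-monoʳ-≤ 0≤κ (subst₂ _≤_ (cong (M *_) (sym occupied-sum)) (cong (totalSize *_) (sym Z⊤))
             (chebyshev sets size (λ K → λ₀ ^ ∣ K ∣) (λ I J → opposite (<⇒≤ 0<λ₀) λ₀≤1 ∣ I ∣ ∣ J ∣))) ⟩
      (β + γ * Δ) * (totalSize * Z⊤′)
        ≡⟨ cong (λ t → (β + γ * Δ) * (t * Z⊤′)) (x/y*y≡x totalSize 0<numberOfSets) ⟨
      (β + γ * Δ) * (expectedSize G * M * Z⊤′)
        ≡⟨ solve 4 (λ k e m z → k :* (e :* m :* z) := k :* e :* m :* z) refl (β + γ * Δ) (expectedSize G) M Z⊤′ ⟩
      (β + γ * Δ) * expectedSize G * M * Z⊤′ ∎))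
      where
      open ≤-Reasoning
      M = numberOfSets
      Z⊤′ = Z Subset.⊤
      nZ≤ : fromℕ n * Z⊤′ ≤ (β + γ * Δ) * sumᵛ occ
      nZ≤ = begin
        fromℕ n * Z⊤′
          ≡⟨ trans (sum-const vertices Z⊤′) (cong (λ k → fromℕ k * Z⊤′) (List.length-tabulate {n = n} id)) ⟨
        sumᵛ {n} (λ _ → Z⊤′)
          ≤⟨ sum-mono vertices occupancy ⟩
        sumᵛ (λ v → β * occ v + γ * sumᵛ (λ u → 𝟙 (u ∈? N v) * occ u))
          ≡⟨ trans (sum-+ vertices (λ v → β * occ v) (λ v → γ * sumᵛ (λ u → 𝟙 (u ∈? N v) * occ u)))
               (cong₂ _+_ (sum-*ˡ vertices β occ) (sum-*ˡ vertices γ (λ v → sumᵛ (λ u → 𝟙 (u ∈? N v) * occ u)))) ⟩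
        β * sumᵛ occ + γ * sumᵛ (λ v → sumᵛ (λ u → 𝟙 (u ∈? N v) * occ u))
          ≤⟨ +-monoʳ-≤ (β * sumᵛ occ) (*-monoʳ-≤ 0≤γ neighbour-sum) ⟩
        β * sumᵛ occ + γ * (Δ * sumᵛ occ)
          ≡⟨ solve 4 (λ b g d s → b :* s :+ g :* (d :* s) := (b :+ g :* d) :* s) refl β γ Δ (sumᵛ occ) ⟩
        (β + γ * Δ) * sumᵛ occ ∎

-- Choice of parameters

module Estimates (R : Reals) where
  open OrderedField R
  open Completeness R
  open ExponentialSeries R
  open Averages R
  open Logarithm R

  -- Take the integer part j of √f. From 1 ≤ f follows j ≥ 1 and so (1 + j)² ≤ 4 j². From f ≤ Δ² + 1
  -- < (1 + Δ)² follows j ≤ Δ, which will keep the fugacity at most c.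
  rough-sqrt : ∀ {f} Δ → 1# ≤ f → 0 <ℕ Δ → f ≤ fromℕ Δ ^ 2 + 1# →
    ∃[ q ] (0# < q × q * q ≤ f × f ≤ fromℕ 4 * (q * q) × q ≤ fromℕ Δ)
  rough-sqrt {f} Δ@(suc δ) 1≤f _ f≤Δ²+1 = from-crossing (crossing (λ k → fromℕ k ^ 2 ≤? f) 0≤f (suc Δ) (<⇒≱ f<[1+Δ]²))
    where
    0≤f : fromℕ 0 ^ 2 ≤ f
    0≤f = ≤-trans (≤-reflexive (zeroˡ _)) (≤-trans 0≤1 1≤f)
    f<[1+Δ]² : f < fromℕ (suc Δ) ^ 2
    f<[1+Δ]² = ≤-<-trans f≤Δ²+1 (<-by-gap (fromℕ 2 * fromℕ Δ) (0<* 0<2 (0<fromℕ-suc δ))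
      (solve 1 (λ d → d :^ 2 :+ :1 :+ :2 :* d := (:1 :+ d) :^ 2) refl (fromℕ Δ)))
    from-crossing : ∃[ j ] (fromℕ j ^ 2 ≤ f × ¬ (fromℕ (suc j) ^ 2 ≤ f)) →
      ∃[ q ] (0# < q × q * q ≤ f × f ≤ fromℕ 4 * (q * q) × q ≤ fromℕ Δ)
    from-crossing (zero , _ , 1≰f) = contradiction (≤-trans (≤-reflexive (solve 0 ((:1 :+ :0) :^ 2 := :1) refl)) 1≤f) 1≰f
    from-crossing (j@(suc k) , j²≤f , [1+j]²≰f) = q , 0<fromℕ-suc k
      , ≤-trans (≤-reflexive (solve 1 (λ q → q :* q := q :^ 2) refl q)) j²≤f
      , ≤-trans (<⇒≤ (≰⇒> [1+j]²≰f)) (≤-by-gap (fromℕ k * (fromℕ 3 * q + 1#)) (0≤* (0≤fromℕ k) (0≤+ (0≤* (0≤fromℕ 3) (0≤fromℕ j)) 0≤1))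
          (solve 1 (λ k → (:1 :+ (:1 :+ k)) :^ 2 :+ k :* (con (pos 3) :* (:1 :+ k) :+ :1) := con (pos 4) :* ((:1 :+ k) :* (:1 :+ k))) refl (fromℕ k)))
      , fromℕ-mono-≤ {j} {Δ} (ℕ.≮⇒≥ λ Δ<j → <⇒≱ f<[1+Δ]² (≤-trans (^-monoˡ-≤ 2 (0≤fromℕ (suc Δ)) (fromℕ-mono-≤ {suc Δ} {j} Δ<j)) j²≤f))
      where q = fromℕ j

  -- X is about f to the power (1 - c) / 2 and has to beat √f by a factor of order ℓ. The room is
  -- provided by Y³: Y² would merely cancel ℓ², while the third factor leaves one ℓ to spare. With
  -- (1 + h)² ≤ 4 the squared claim needs 4 * 27 * 4 = 432 at most c ^ 7 * ℓ, where c ^ 3 comes from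
  -- Y³ and c ^ 4 from the squared right side.
  partition-bound : ∀ {X Y ℓ c q h} → 0# ≤ X → 0# ≤ Y → 0# ≤ ℓ → 0# ≤ c → 0# ≤ q → 0# ≤ h → h ≤ 1# →
    X * X * (Y * (Y * Y)) ≤ fromℕ 4 * (q * q) → c * ℓ ≤ fromℕ 3 * Y → fromℕ 432 ≤ c ^ 7 * ℓ →
    X * ℓ * (1# + h) ≤ c * c * q
  partition-bound {X} {Y} {ℓ} {c} {q} {h} 0≤X 0≤Y 0≤ℓ 0≤c 0≤q 0≤h h≤1 X²Y³≤4q² cℓ≤3Y large =
    ²-cancel-≤ (0≤* (0≤* 0≤c 0≤c) 0≤q) (≤-trans with-4 (*-cancelʳ-≤ (0<fromℕ-suc 431) (begin
      A * fromℕ 4 * fromℕ 432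
        ≤⟨ *-monoʳ-≤ (0≤* 0≤A (0≤fromℕ 4)) large ⟩
      A * fromℕ 4 * (c ^ 7 * ℓ)
        ≡⟨ solve 3 (λ x l c → x :* x :* (l :* l) :* con (pos 4) :* (c :^ 7 :* l) := c :^ 4 :* (con (pos 4) :* (x :* x)) :* (c :* l) :^ 3) refl X ℓ c ⟩
      c ^ 4 * (fromℕ 4 * (X * X)) * (c * ℓ) ^ 3
        ≤⟨ *-monoʳ-≤ (0≤* (0≤^ 4 0≤c) (0≤* (0≤fromℕ 4) (0≤x² X))) (^-monoˡ-≤ 3 (0≤* 0≤c 0≤ℓ) cℓ≤3Y) ⟩
      c ^ 4 * (fromℕ 4 * (X * X)) * (fromℕ 3 * Y) ^ 3
        ≡⟨ solve 3 (λ x y c → c :^ 4 :* (con (pos 4) :* (x :* x)) :* (con (pos 3) :* y) :^ 3 := con (pos 108) :* c :^ 4 :* (x :* x :* (y :* (y :* y)))) refl X Y c ⟩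
      fromℕ 108 * c ^ 4 * (X * X * (Y * (Y * Y)))
        ≤⟨ *-monoʳ-≤ (0≤* (0≤fromℕ 108) (0≤^ 4 0≤c)) X²Y³≤4q² ⟩
      fromℕ 108 * c ^ 4 * (fromℕ 4 * (q * q))
        ≡⟨ solve 2 (λ c q → con (pos 108) :* c :^ 4 :* (con (pos 4) :* (q :* q)) := c :* c :* q :* (c :* c :* q) :* con (pos 432)) refl c q ⟩
      c * c * q * (c * c * q) * fromℕ 432 ∎)))
    where
    open ≤-Reasoning
    A = X * X * (ℓ * ℓ)
    0≤A : 0# ≤ A
    0≤A = 0≤* (0≤x² X) (0≤x² ℓ)
    with-4 : X * ℓ * (1# + h) * (X * ℓ * (1# + h)) ≤ A * fromℕ 4
    with-4 = ≤-by-gap (A * ((1# - h) * (fromℕ 3 + h))) (0≤* 0≤A (0≤* (x≤y⇒0≤y-x h≤1) (0≤+ (0≤fromℕ 3) 0≤h)))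
      (solve 3 (λ x l h → x :* l :* (:1 :+ h) :* (x :* l :* (:1 :+ h)) :+ x :* x :* (l :* l) :* ((:1 :- h) :* (con (pos 3) :+ h))
        := x :* x :* (l :* l) :* con (pos 4)) refl X ℓ h)

  -- The edges cost 4 c² ≤ c ℓ, so twice the expected size is at least (1 - 2 c) ℓ / (1 + h). The
  -- rest is 2 (1 + c) ≤ (2 + 8 c) (1 - 2 c), which holds as 8 c ≤ 1.
  occupancy-bound : ∀ {c ℓ h y d z s} → 0# ≤ c → fromℕ 16 * c ≤ 1# → 0# ≤ z → 0# ≤ s → fromℕ 4 ≤ ℓ → h ≤ c →
    (1# - c) * ℓ ≤ y * (fromℕ 2 * h) → h * h * d ≤ fromℕ 2 * (c * c) →
    h * (y - h * d) * z ≤ (1# + h) * s → ℓ * z ≤ (fromℕ 2 + fromℕ 8 * c) * s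
  occupancy-bound {c} {ℓ} {h} {y} {d} {z} {s} 0≤c 16c≤1 0≤z 0≤s 4≤ℓ h≤c y-large d-small size =
    *-cancelʳ-≤ 0<1-2c (begin
      ℓ * z * (1# - fromℕ 2 * c)
        ≤⟨ ≤-by-gap (c * (ℓ - fromℕ 4 * c) * z) (0≤* (0≤* 0≤c (x≤y⇒0≤y-x 4c≤ℓ)) 0≤z)
             (solve 3 (λ l z c → l :* z :* (:1 :- :2 :* c) :+ c :* (l :- con (pos 4) :* c) :* z := ((:1 :- c) :* l :- con (pos 4) :* (c :* c)) :* z) refl ℓ z c) ⟩
      ((1# - c) * ℓ - fromℕ 4 * (c * c)) * z
        ≤⟨ ≤-by-gap (((y * (fromℕ 2 * h) - (1# - c) * ℓ) + fromℕ 2 * (fromℕ 2 * (c * c) - h * h * d)) * z)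
             (0≤* (0≤+ (x≤y⇒0≤y-x y-large) (0≤* (<⇒≤ 0<2) (x≤y⇒0≤y-x d-small))) 0≤z)
             (solve 5 (λ b c h e z → (b :- con (pos 4) :* c) :* z :+ ((h :- b) :+ :2 :* (:2 :* c :- e)) :* z := (h :- :2 :* e) :* z) refl
               ((1# - c) * ℓ) (c * c) (y * (fromℕ 2 * h)) (h * h * d) z) ⟩
      (y * (fromℕ 2 * h) - fromℕ 2 * (h * h * d)) * z
        ≡⟨ solve 4 (λ y h d z → (y :* (:2 :* h) :- :2 :* (h :* h :* d)) :* z := :2 :* (h :* (y :- h :* d) :* z)) refl y h d z ⟩
      fromℕ 2 * (h * (y - h * d) * z)
        ≤⟨ *-monoʳ-≤ (<⇒≤ 0<2) size ⟩
      fromℕ 2 * ((1# + h) * s)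
        ≤⟨ *-monoʳ-≤ (<⇒≤ 0<2) (*-monoˡ-≤ 0≤s (+-monoʳ-≤ 1# h≤c)) ⟩
      fromℕ 2 * ((1# + c) * s)
        ≤⟨ ≤-by-gap (fromℕ 2 * c * (1# - fromℕ 8 * c) * s) (0≤* (0≤* (0≤* (<⇒≤ 0<2) 0≤c) 0≤1-8c) 0≤s)
             (solve 2 (λ c s → :2 :* ((:1 :+ c) :* s) :+ :2 :* c :* (:1 :- con (pos 8) :* c) :* s
               := (:2 :+ con (pos 8) :* c) :* s :* (:1 :- :2 :* c)) refl c s) ⟩
      (fromℕ 2 + fromℕ 8 * c) * s * (1# - fromℕ 2 * c) ∎)
    where
    open ≤-Reasoning
    4c≤ℓ : fromℕ 4 * c ≤ ℓ
    4c≤ℓ = ≤-trans (≤-by-gap (fromℕ 12 * c + fromℕ 3) (0≤+ (0≤* (0≤fromℕ 12) 0≤c) (0≤fromℕ 3))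
        (solve 1 (λ c → con (pos 4) :* c :+ (con (pos 12) :* c :+ con (pos 3)) := con (pos 16) :* c :+ con (pos 3)) refl c))
      (≤-trans (+-mono-≤ 16c≤1 ≤-refl) (≤-trans (≤-reflexive (solve 0 (:1 :+ con (pos 3) := con (pos 4)) refl)) 4≤ℓ))
    0≤1-8c : 0# ≤ 1# - fromℕ 8 * c
    0≤1-8c = x≤y⇒0≤y-x (≤-trans (≤-by-gap (fromℕ 8 * c) (0≤* (0≤fromℕ 8) 0≤c)
      (solve 1 (λ c → con (pos 8) :* c :+ con (pos 8) :* c := con (pos 16) :* c) refl c)) 16c≤1)
    0<1-2c : 0# < 1# - fromℕ 2 * c
    0<1-2c = x<y⇒0<y-x (≤-<-trans 2c≤half (<-by-gap (half 1#) (0<half 0<1) (half+half 1#)))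
      where
      2c≤half : fromℕ 2 * c ≤ half 1#
      2c≤half = x≤y/z 0<2 (≤-trans (≤-by-gap (fromℕ 12 * c) (0≤* (0≤fromℕ 12) 0≤c)
        (solve 1 (λ c → :2 :* c :* :2 :+ con (pos 12) :* c := con (pos 16) :* c) refl c)) 16c≤1)

-- The occupancy inequality in locally sparse graphs and the two bounds

module LocallySparse (R : Reals) where
  open OrderedField R
  open Completeness R
  open ExponentialSeries R
  open Averages R
  open Logarithm R
  open FiniteSums R
  open Estimates R
  open IndependentSets R
  open FractionalColourings R

  module _ {c : ℝ} (0<c : 0# < c) (16c≤1 : fromℕ 16 * c ≤ 1#)
    {f ℓ : ℝ} (isLog : IsLog f ℓ) (large : fromℕ 432 ≤ c ^ 7 * ℓ) (4≤ℓ : fromℕ 4 ≤ ℓ)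
    {D : ℕ} (0<D : 0 <ℕ D) (f≤D²+1 : f ≤ fromℕ D ^ 2 + 1#)
    {n : ℕ} (G : Graph n) (deg≤D : ∀ v → degree G v ℕ.≤ D)
    (sparse : ∀ v → fromℕ (length (inducedEdges G (neighbourhood G v))) ≤ fromℕ D ^ 2 / f) where

    private
      Δ = fromℕ D
      0≤c = <⇒≤ 0<c

      0<Δ : 0# < Δ
      0<Δ = go 0<D
        where
        go : ∀ {D} → 0 <ℕ D → 0# < fromℕ D
        go {suc d} _ = 0<fromℕ-suc d

      0<ℓ : 0# < ℓ
      0<ℓ = <-≤-trans (0<fromℕ-suc 3) 4≤ℓ

      c≤1 : c ≤ 1#
      c≤1 = ≤-trans (≤-by-gap (fromℕ 15 * c) (0≤* (0≤fromℕ 15) 0≤c)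
        (solve 1 (λ c → c :+ con (pos 15) :* c := con (pos 16) :* c) refl c)) 16c≤1

      1≤f : 1# ≤ f
      1≤f = [1+h]^≤ {h = 0#} 0 isLog ≤-refl (≤-trans (≤-reflexive (zeroˡ 0#)) (<⇒≤ 0<ℓ))

      0<f : 0# < f
      0<f = <-≤-trans 0<1 1≤f

      sqrt = rough-sqrt D 1≤f 0<D f≤D²+1
      q     = proj₁ sqrt
      0<q   = proj₁ (proj₂ sqrt)
      q²≤f  = proj₁ (proj₂ (proj₂ sqrt))
      f≤4q² = proj₁ (proj₂ (proj₂ (proj₂ sqrt)))
      q≤Δ   = proj₂ (proj₂ (proj₂ (proj₂ sqrt)))

      -- The fugacity is of order √f / Δ, so that a neighbourhood with Δ² / f edges
      -- contributes only O(c²) to the expected occupation.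
      h : ℝ
      h = c * (q / Δ)

      0<h : 0# < h
      0<h = 0<* 0<c (0<x⇒0<x/y 0<q 0<Δ)
      0≤h = <⇒≤ 0<h

      hΔ≡cq : h * Δ ≡ c * q
      hΔ≡cq = trans (*-assoc _ _ _) (cong (c *_) (x/y*y≡x q 0<Δ))

      h≤c : h ≤ c
      h≤c = ≤-trans (*-monoʳ-≤ 0≤c (x/z≤y 0<Δ (≤-trans q≤Δ (≤-reflexive (sym (*-identityˡ Δ)))))) (≤-reflexive (*-identityʳ c))

      h≤1 : h ≤ 1#
      h≤1 = ≤-trans h≤c c≤1

      0<1+h : 0# < 1# + h
      0<1+h = 0<+ 0<1 0≤h

      -- The factor c makes β a small share of β + γ Δ. C is β rescaled by h / (1 + h), since
      -- conditioning produces `uncovered` where the conclusion wants `occupied`, and these are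
      -- proportional with that ratio.
      β γ C : ℝ
      β = c * Δ / ℓ
      γ = (fromℕ 2 + fromℕ 8 * c) / ℓ
      C = β * h / (1# + h)

      0≤β : 0# ≤ β
      0≤β = 0≤x⇒0≤x/y (0≤* 0≤c (<⇒≤ 0<Δ)) 0<ℓ
      0≤γ : 0# ≤ γ
      0≤γ = 0≤x⇒0≤x/y (0≤+ (<⇒≤ 0<2) (0≤* (0≤fromℕ 8) 0≤c)) 0<ℓ
      0≤C : 0# ≤ C
      0≤C = 0≤x⇒0≤x/y (0≤* 0≤β 0≤h) 0<1+h

    open HardCore R G h 0<h

    private
      deg≤Δ : ∀ v → fromℕ ∣ N v ∣ ≤ Δ
      deg≤Δ v = fromℕ-mono-≤ (deg≤D v)

      degreeSum-small : ∀ v → h * h * degreeSum (N v) ≤ fromℕ 2 * (c * c)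
      degreeSum-small v = *-cancelʳ-≤ 0<f (begin
        h * h * degreeSum (N v) * f
          ≡⟨ cong (λ d → h * h * d * f) (degreeSum≡2*edges (N v)) ⟩
        h * h * (fromℕ 2 * m) * f
          ≡⟨ solve 3 (λ h m f → h :* h :* (:2 :* m) :* f := :2 :* (h :* h) :* (m :* f)) refl h m f ⟩
        fromℕ 2 * (h * h) * (m * f)
          ≤⟨ *-monoʳ-≤ (0≤* (<⇒≤ 0<2) (0≤x² h)) (≤-trans (*-monoˡ-≤ (<⇒≤ 0<f) (sparse v)) (≤-reflexive (x/y*y≡x (Δ ^ 2) 0<f))) ⟩
        fromℕ 2 * (h * h) * Δ ^ 2
          ≡⟨ solve 2 (λ h d → :2 :* (h :* h) :* d :^ 2 := :2 :* (h :* d :* (h :* d))) refl h Δ ⟩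
        fromℕ 2 * (h * Δ * (h * Δ))
          ≡⟨ cong (λ x → fromℕ 2 * (x * x)) hΔ≡cq ⟩
        fromℕ 2 * (c * q * (c * q))
          ≡⟨ solve 2 (λ c q → :2 :* (c :* q :* (c :* q)) := :2 :* (c :* c) :* (q :* q)) refl c q ⟩
        fromℕ 2 * (c * c) * (q * q)
          ≤⟨ *-monoʳ-≤ (0≤* (<⇒≤ 0<2) (0≤x² c)) q²≤f ⟩
        fromℕ 2 * (c * c) * f ∎)
        where
        open ≤-Reasoning
        m = fromℕ (length (inducedEdges G (N v)))

      C*uncovered : ∀ {H v} → v ∈ H → C * uncovered H v ≡ β * occupied H v
      C*uncovered {H} {v} v∈H = begin
        β * h * (1# + h) ⁻¹ * uncovered H v
          ≡⟨ solve 4 (λ b h r u → b :* h :* r :* u := b :* (h :* u) :* r) refl β h ((1# + h) ⁻¹) (uncovered H v) ⟩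
        β * (h * uncovered H v) * (1# + h) ⁻¹
          ≡⟨ cong (λ x → β * x * (1# + h) ⁻¹) (occupied-uncovered v∈H) ⟨
        β * ((1# + h) * occupied H v) * (1# + h) ⁻¹
          ≡⟨ solve 4 (λ b k o r → b :* (k :* o) :* r := b :* o :* (k :* r)) refl β (1# + h) (occupied H v) ((1# + h) ⁻¹) ⟩
        β * occupied H v * ((1# + h) * (1# + h) ⁻¹)
          ≡⟨ trans (cong (β * occupied H v *_) (⁻¹-inverse 0<1+h)) (*-identityʳ _) ⟩
        β * occupied H v ∎
        where open ≡-Reasoning

    κ : ℝ
    κ = (fromℕ 2 + fromℕ 9 * c) * Δ / ℓ

    private
      β+γΔ≡κ : β + γ * Δ ≡ κ
      β+γΔ≡κ = solve 3 (λ c d r → c :* d :* r :+ (:2 :+ con (pos 8) :* c) :* r :* d := (:2 :+ con (pos 9) :* c) :* d :* r) refl c Δ (ℓ ⁻¹)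

    -- J is the size at which F stops counting as small, and i measures the slack left by the factor
    -- 1 - c. The denominators 2 h and 3 h are chosen so that (2 J + 3 i) h ≤ ℓ, that is, X²Y³ ≤ f.
    -- Both integers exist only under a double negation, hence they are parameters.
    module _ {J i : ℕ}
      (J-floor : fromℕ J * (fromℕ 2 * h) ≤ (1# - c) * ℓ × (1# - c) * ℓ < fromℕ (suc J) * (fromℕ 2 * h))
      (i-floor : fromℕ i * (fromℕ 3 * h) ≤ c * ℓ × c * ℓ < fromℕ (suc i) * (fromℕ 3 * h)) where

      private
        X = (1# + h) ^ J
        Y = (1# + h) ^ i

        1≤1+h : 1# ≤ 1# + h
        1≤1+h = ≤-by-gap h 0≤h refl

        X²Y³≤f : X * X * (Y * (Y * Y)) ≤ f
        X²Y³≤f = subst (_≤ f) power ([1+h]^≤ N′ isLog 0≤h (begin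
          fromℕ N′ * h
            ≡⟨ cong (_* h) (trans (fromℕ-+ (J ℕ.+ J) (i ℕ.+ (i ℕ.+ i))) (cong₂ _+_ (fromℕ-+ J J)
                 (trans (fromℕ-+ i (i ℕ.+ i)) (cong (fromℕ i +_) (fromℕ-+ i i))))) ⟩
          (fromℕ J + fromℕ J + (fromℕ i + (fromℕ i + fromℕ i))) * h
            ≡⟨ solve 3 (λ j i h → (j :+ j :+ (i :+ (i :+ i))) :* h := j :* (:2 :* h) :+ i :* (con (pos 3) :* h)) refl (fromℕ J) (fromℕ i) h ⟩
          fromℕ J * (fromℕ 2 * h) + fromℕ i * (fromℕ 3 * h)
            ≤⟨ +-mono-≤ (proj₁ J-floor) (proj₁ i-floor) ⟩
          (1# - c) * ℓ + c * ℓ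
            ≡⟨ solve 2 (λ c l → (:1 :- c) :* l :+ c :* l := l) refl c ℓ ⟩
          ℓ ∎))
          where
          open ≤-Reasoning
          N′ = J ℕ.+ J ℕ.+ (i ℕ.+ (i ℕ.+ i))
          power : (1# + h) ^ N′ ≡ X * X * (Y * (Y * Y))
          power = trans (^-homo-* (1# + h) (J ℕ.+ J) (i ℕ.+ (i ℕ.+ i))) (cong₂ _*_ (^-homo-* (1# + h) J J)
            (trans (^-homo-* (1# + h) i (i ℕ.+ i)) (cong (Y *_) (^-homo-* (1# + h) i i))))

        cℓ≤3Y : c * ℓ ≤ fromℕ 3 * Y
        cℓ≤3Y = begin
          c * ℓ
            ≤⟨ <⇒≤ (proj₂ i-floor) ⟩
          fromℕ (suc i) * (fromℕ 3 * h)
            ≤⟨ ≤-by-gap (fromℕ 3 * (1# - h)) (0≤* (0≤fromℕ 3) (x≤y⇒0≤y-x h≤1))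
                 (solve 2 (λ i h → (:1 :+ i) :* (con (pos 3) :* h) :+ con (pos 3) :* (:1 :- h) := con (pos 3) :* (:1 :+ i :* h)) refl (fromℕ i) h) ⟩
          fromℕ 3 * (1# + fromℕ i * h)
            ≤⟨ *-monoʳ-≤ (0≤fromℕ 3) (bernoulli 0≤h i) ⟩
          fromℕ 3 * Y ∎
          where open ≤-Reasoning

        X≤C : X ≤ C
        X≤C = x≤y/z 0<1+h (*-cancelʳ-≤ 0<ℓ (begin
          X * (1# + h) * ℓ
            ≡⟨ solve 3 (λ x k l → x :* k :* l := x :* l :* k) refl X (1# + h) ℓ ⟩
          X * ℓ * (1# + h)
            ≤⟨ partition-bound (0≤^ J (<⇒≤ 0<1+h)) (0≤^ i (<⇒≤ 0<1+h)) (<⇒≤ 0<ℓ) 0≤c (<⇒≤ 0<q) 0≤h h≤1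
                 (≤-trans X²Y³≤f f≤4q²) cℓ≤3Y large ⟩
          c * c * q
            ≡⟨ trans (*-assoc c c q) (cong (c *_) (sym hΔ≡cq)) ⟩
          c * (h * Δ)
            ≡⟨ solve 3 (λ c h d → c :* (h :* d) := c :* d :* h) refl c h Δ ⟩
          c * Δ * h
            ≡⟨ cong (_* h) (x/y*y≡x (c * Δ) 0<ℓ) ⟨
          β * ℓ * h
            ≡⟨ solve 3 (λ b l h → b :* l :* h := b :* h :* l) refl β ℓ h ⟩
          β * h * ℓ ∎))
          where open ≤-Reasoning

        -- In either case one of the two summands suffices by itself.
        local : ∀ v F → F ⊆ N v → Z F ≤ C + γ * sumᵛ (occupied F)
        local v F F⊆N = case ∣ F ∣ ℕ.≤? J of λ
          { (yes ∣F∣≤J) → ≤-trans (≤-trans (Z≤ F) (≤-trans (^-monoʳ-≤ 1≤1+h ∣F∣≤J) X≤C)) (≤-by-gap _ (0≤* 0≤γ 0≤S) refl)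
          ; (no  ∣F∣≰J) → ≤-trans (many (ℕ.≰⇒> ∣F∣≰J)) (≤-by-gap C 0≤C (+-comm _ _))
          }
          where
          S = sumᵛ (occupied F)
          0≤S : 0# ≤ S
          0≤S = 0≤sum (allFin n) (0≤occupied F)
          many : J ℕ.< ∣ F ∣ → Z F ≤ γ * S
          many J<∣F∣ = *-cancelʳ-≤ 0<ℓ (begin
            Z F * ℓ
              ≡⟨ *-comm _ _ ⟩
            ℓ * Z F
              ≤⟨ occupancy-bound 0≤c 16c≤1 (<⇒≤ (0<Z F)) 0≤S 4≤ℓ h≤c
                   (≤-trans (<⇒≤ (proj₂ J-floor)) (*-monoˡ-≤ (0≤* (<⇒≤ 0<2) 0≤h) (fromℕ-mono-≤ J<∣F∣)))
                   (≤-trans (*-monoʳ-≤ (0≤x² h) (degreeSum-mono F⊆N)) (degreeSum-small v))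
                   (expected-size-≥ F) ⟩
            (fromℕ 2 + fromℕ 8 * c) * S
              ≡⟨ cong (_* S) (x/y*y≡x (fromℕ 2 + fromℕ 8 * c) 0<ℓ) ⟨
            γ * ℓ * S
              ≡⟨ solve 3 (λ g l s → g :* l :* s := g :* s :* l) refl γ ℓ S ⟩
            γ * S * ℓ ∎)
            where open ≤-Reasoning

        occupancy : ∀ H v → v ∈ H → Z H ≤ β * occupied H v + γ * sumᵛ (λ u → 𝟙 (u ∈? N v) * occupied H u)
        occupancy H v v∈H = ≤-trans (local-occupancy H v (local v))
          (≤-reflexive (cong (_+ γ * sumᵛ (λ u → 𝟙 (u ∈? N v) * occupied H u)) (C*uncovered v∈H)))

      bounds-at : fromℕ n ≤ κ * expectedSize G × (∀ χ → IsFractionalChromaticNumber G χ → χ ≤ κ)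
      bounds-at =
          subst (λ k → fromℕ n ≤ k * expectedSize G) β+γΔ≡κ
            (ExpectedSize.expectedSize-≥ R G h 0<h 0≤γ h≤1 deg≤Δ (λ v → occupancy Subset.⊤ v ∈⊤)
              (0≤+ 0≤β (0≤* 0≤γ (<⇒≤ 0<Δ))))
        , λ χ isχ → subst (χ ≤_) β+γΔ≡κ
            (Greedy.chromatic≤ R G h 0<h 0≤β 0≤γ (<⇒≤ 0<Δ) deg≤Δ occupancy isχ)

    -- Both conclusions are inequalities in which J and i no longer occur, so the double negation of
    -- the integer parts can be removed from each of them.
    bounds : fromℕ n ≤ κ * expectedSize G × (∀ χ → IsFractionalChromaticNumber G χ → χ ≤ κ)
    bounds = ≤-stable (λ ¬h → ¬¬bounds (¬h ∘ proj₁)) , λ χ isχ → ≤-stable (λ ¬h → ¬¬bounds (λ b → ¬h (proj₂ b χ isχ)))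
      where
      ¬¬bounds : ¬ ¬ (fromℕ n ≤ κ * expectedSize G × (∀ χ → IsFractionalChromaticNumber G χ → χ ≤ κ))
      ¬¬bounds ¬b =
        floor (0≤* (x≤y⇒0≤y-x c≤1) (<⇒≤ 0<ℓ)) (0<* 0<2 0<h) λ (J , J-floor) →
        floor (0≤* 0≤c (<⇒≤ 0<ℓ)) (0<* (0<fromℕ-suc 2) 0<h) λ (i , i-floor) →
        ¬b (bounds-at {J} {i} J-floor i-floor)

  at-most-one : ∀ {ε} → 0# < ε → ∃[ e ] (0# < e × e ≤ ε × e ≤ 1#)
  at-most-one {ε} 0<ε = case ≤-total ε 1# of λ
    { (inj₁ ε≤1) → ε , 0<ε , ≤-refl , ε≤1
    ; (inj₂ 1≤ε) → 1# , 0<1 , 1≤ε , ≤-refl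
    }

  -- If t ≤ 2 E, the term with ε only helps. Otherwise 2 ε t ≥ 4 ε E ≥ 64 c E, which outweighs the
  -- excess 9 c E; the coefficient 55 is the difference. No sign of 1 / 2 - ε is assumed.
  size-estimate : ∀ {ε c t E} → 0# ≤ c → fromℕ 16 * c ≤ ε → 0# ≤ t → 0# ≤ E → t ≤ (fromℕ 2 + fromℕ 9 * c) * E →
    (1# / fromℕ 2 - ε) * t ≤ E
  size-estimate {ε} {c} {t} {E} 0≤c 16c≤ε 0≤t 0≤E t≤ = *-cancelʳ-≤ 0<2 (≤-trans (≤-reflexive doubled) (case ≤-total t (fromℕ 2 * E) of λ
    { (inj₁ t≤2E) → ≤-trans (≤-by-gap (fromℕ 2 * ε * t) (0≤* (0≤* (<⇒≤ 0<2) 0≤ε) 0≤t)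
        (solve 2 (λ x t → t :- x :* t :+ x :* t := t) refl (fromℕ 2 * ε) t)) (≤-trans t≤2E (≤-reflexive (*-comm _ _)))
    ; (inj₂ 2E≤t) → ≤-by-gap (((fromℕ 2 + fromℕ 9 * c) * E - t) + fromℕ 2 * (ε * (t - fromℕ 2 * E) + fromℕ 2 * ((ε - fromℕ 16 * c) * E)) + fromℕ 55 * c * E)
        (0≤+ (0≤+ (x≤y⇒0≤y-x t≤) (0≤* (<⇒≤ 0<2) (0≤+ (0≤* 0≤ε (x≤y⇒0≤y-x 2E≤t)) (0≤* (<⇒≤ 0<2) (0≤* (x≤y⇒0≤y-x 16c≤ε) 0≤E)))))
          (0≤* (0≤* (0≤fromℕ 55) 0≤c) 0≤E))
        (solve 4 (λ ε c t E → t :- :2 :* ε :* t :+ (((:2 :+ con (pos 9) :* c) :* E :- t)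
            :+ :2 :* (ε :* (t :- :2 :* E) :+ :2 :* ((ε :- con (pos 16) :* c) :* E)) :+ con (pos 55) :* c :* E) := E :* :2) refl ε c t E)
    }))
    where
    0≤ε : 0# ≤ ε
    0≤ε = ≤-trans (0≤* (0≤fromℕ 16) 0≤c) 16c≤ε
    doubled : (1# / fromℕ 2 - ε) * t * fromℕ 2 ≡ t - fromℕ 2 * ε * t
    doubled = trans (solve 3 (λ x ε t → (x :- ε) :* t :* :2 := (x :+ x) :* t :- :2 :* ε :* t) refl (half 1#) ε t)
      (cong (_- fromℕ 2 * ε * t) (trans (cong (_* t) (half+half 1#)) (*-identityˡ t)))

  module _ {ε : ℝ} (0<ε : 0# < ε) where

    private
      small = at-most-one 0<ε
      e    = proj₁ small
      0<e  = proj₁ (proj₂ small)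
      e≤ε  = proj₁ (proj₂ (proj₂ small))
      e≤1  = proj₂ (proj₂ (proj₂ small))
      c = e / fromℕ 16
      0<c : 0# < c
      0<c = 0<x⇒0<x/y 0<e (0<fromℕ-suc 15)
      0≤c = <⇒≤ 0<c
      16c≡e : fromℕ 16 * c ≡ e
      16c≡e = trans (*-comm _ _) (x/y*y≡x e (0<fromℕ-suc 15))
      16c≤ε : fromℕ 16 * c ≤ ε
      16c≤ε = ≤-trans (≤-reflexive 16c≡e) e≤ε
      -- The two summands secure 432 ≤ c ^ 7 * ℓ and 4 ≤ ℓ at the same time.
      K = fromℕ 432 / c ^ 7 + fromℕ 4

    threshold : ℝ
    threshold = proj₁ (log-unbounded K)

    above-threshold : ∀ f Δ → 0 <ℕ Δ → threshold ≤ f → f ≤ fromℕ Δ ^ 2 + 1# →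
      ∀ logf → IsLog f logf → ∀ n (G : Graph n) → HasMaxDegree G Δ →
      (∀ v → fromℕ (length (inducedEdges G (neighbourhood G v))) ≤ fromℕ Δ ^ 2 / f) →
      ((1# / fromℕ 2 - ε) * (fromℕ n / fromℕ Δ) * logf ≤ expectedSize G)
      × (∀ χ → IsFractionalChromaticNumber G χ → χ ≤ (fromℕ 2 + ε) * fromℕ Δ / logf)
    above-threshold f D@(suc d) 0<D f₀≤f f≤ ℓ isLog n G (deg≤ , _) sparse =
        ≤-trans (≤-reflexive (*-assoc _ _ _)) (size-estimate 0≤c 16c≤ε 0≤t 0≤E t≤)
      , λ χ isχ → ≤-trans (proj₂ result χ isχ) (*-monoˡ-≤ (0≤⁻¹ 0<ℓ) (*-monoˡ-≤ (0≤fromℕ D) (+-monoʳ-≤ (fromℕ 2)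
          (≤-trans (≤-by-gap (fromℕ 7 * c) (0≤* (0≤fromℕ 7) 0≤c)
            (solve 1 (λ c → con (pos 9) :* c :+ con (pos 7) :* c := con (pos 16) :* c) refl c)) 16c≤ε))))
      where
      K≤ℓ : K ≤ ℓ
      K≤ℓ = proj₂ (log-unbounded K) f ℓ f₀≤f isLog
      0<c⁷ = 0<^ 7 0<c
      4≤ℓ : fromℕ 4 ≤ ℓ
      4≤ℓ = ≤-trans (≤-by-gap _ (0≤x⇒0≤x/y (0≤fromℕ 432) 0<c⁷) (+-comm _ _)) K≤ℓ
      large : fromℕ 432 ≤ c ^ 7 * ℓ
      large = ≤-trans (≤-reflexive (sym (x/y*y≡x (fromℕ 432) 0<c⁷))) (≤-trans
        (*-monoˡ-≤ (<⇒≤ 0<c⁷) (≤-trans (≤-by-gap _ (0≤fromℕ 4) refl) K≤ℓ)) (≤-reflexive (*-comm _ _)))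
      0<ℓ : 0# < ℓ
      0<ℓ = <-≤-trans (0<fromℕ-suc 3) 4≤ℓ
      0<Δ : 0# < fromℕ D
      0<Δ = 0<fromℕ-suc d
      result = bounds 0<c (≤-trans (≤-reflexive 16c≡e) e≤1) isLog large 4≤ℓ 0<D f≤ G deg≤ sparse
      E = expectedSize G
      A = fromℕ 2 + fromℕ 9 * c
      0<A : 0# < A
      0<A = 0<+ 0<2 (0≤* (0≤fromℕ 9) 0≤c)
      nℓ≤ : fromℕ n * ℓ ≤ A * E * fromℕ D
      nℓ≤ = ≤-trans (*-monoˡ-≤ (<⇒≤ 0<ℓ) (proj₁ result)) (≤-reflexive (trans
        (solve 4 (λ a r e l → a :* r :* e :* l := a :* r :* l :* e) refl (A * fromℕ D) (ℓ ⁻¹) E ℓ)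
        (trans (cong (_* E) (x/y*y≡x (A * fromℕ D) 0<ℓ)) (solve 3 (λ a d e → a :* d :* e := a :* e :* d) refl A (fromℕ D) E))))
      t = fromℕ n / fromℕ D * ℓ
      0≤t : 0# ≤ t
      0≤t = 0≤* (0≤x⇒0≤x/y (0≤fromℕ n) 0<Δ) (<⇒≤ 0<ℓ)
      0≤E : 0# ≤ E
      0≤E = *-cancelʳ-≤ (0<* 0<Δ 0<A) (≤-trans (≤-reflexive (zeroˡ _)) (≤-trans (0≤* (0≤fromℕ n) (<⇒≤ 0<ℓ)) (≤-trans nℓ≤
        (≤-reflexive (solve 3 (λ a e d → a :* e :* d := e :* (d :* a)) refl A E (fromℕ D))))))
      t≤ : t ≤ A * E
      t≤ = *-cancelʳ-≤ 0<Δ (≤-trans (≤-reflexive (trans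
        (solve 4 (λ n r l d → n :* r :* l :* d := n :* r :* d :* l) refl (fromℕ n) (fromℕ D ⁻¹) ℓ (fromℕ D))
        (cong (_* ℓ) (x/y*y≡x (fromℕ n) 0<Δ)))) nℓ≤)

theorem1p2 : (R : Reals) →
    let open Reals R
        open Logarithm R
        open IndependentSets R
        open FractionalColourings R
    in
    ∀ (ε : ℝ) → 0# < ε →
    ∃[ f₀ ]
      (∀ (f : ℝ) (Δ : ℕ) → 0 <ℕ Δ → f₀ ≤ f → f ≤ fromℕ Δ ^ 2 + 1# →
       ∀ (logf : ℝ) → IsLog f logf →
       ∀ (n : ℕ) (G : Graph n) → HasMaxDegree G Δ →
       (∀ v → fromℕ (length (inducedEdges G (neighbourhood G v))) ≤ fromℕ Δ ^ 2 / f) →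
       ((1# / fromℕ 2 - ε) * (fromℕ n / fromℕ Δ) * logf ≤ expectedSize G)
       ×
       (∀ (χ : ℝ) → IsFractionalChromaticNumber G χ →
        χ ≤ (fromℕ 2 + ε) * fromℕ Δ / logf))
theorem1p2 R ε 0<ε = LocallySparse.threshold R 0<ε , LocallySparse.above-threshold R 0<ε
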